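{- Let $k\ge r\ge 3$ be integers. \begin{enumerate} \item If $r\ge \frac{k}{2}+1$, then $\mathrm{ex}_k(n,Q_k(r))=\Theta(n^{k-1})$ as $n\to\infty$. \item If $r\le \frac{k+1}{2}$, then $\mathrm{ex}_k(n,Q_k(r))=o(n^{k-1})$ as $n\to\infty$, but for every $\varepsilon>0$ it is not the case that $\mathrm{ex}_k(n,Q_k(r))=O(n^{k-1-\varepsilon})$. \end{enumerate}
   Context: A $k$-uniform hypergraph ($k$-graph) is a pair $(V,E)$ with $E$ a collection of $k$-element subsets of $V$. For a $k$-graph $F$, a $k$-graph $H$ is $F$-free if it contains no subhypergraph isomorphic to $F$; $\mathrm{ex}_k(n,F)$ denotes the maximum number of edges in an $n$-vertex $F$-free $k$-graph. For integers $k\ge r\ge 2$, let $A=\{a_1,\dots,a_{k-r}\}$, $B=\{b_1,\dots,b_r\}$, $C=\{c_1,\dots,c_r\}$ be pairwise disjoint sets; $Q_k(r)$ is the $k$-graph on $A\cup B\cup C$ whose edges are the $r$ sets $A\cup(B\setminus\{b_i\})\cup\{c_i\}$, $1\le i\le r$. -}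

module Defs where

open import Data.Nat using (ℕ; zero; suc; _+_; _*_; _∸_; _^_; _≤_)
open import Data.Bool using (Bool; true; false; not)
open import Data.Fin using (Fin; zero; suc; splitAt)
open import Data.Fin.Properties using (_≟_)
open import Data.Fin.Subset using (Subset; ⁅_⁆; _∪_; ∣_∣) renaming (⊥ to ∅)
open import Data.Vec using (Vec; []; _∷_; tabulate)
open import Data.List using (List; length; map; allFin)
open import Data.List.Membership.Propositional using (_∈_)
open import Data.List.Relation.Unary.All using (All)
open import Data.List.Relation.Unary.Unique.Propositional using (Unique)
open import Data.Sum using (_⊎_; inj₁; inj₂)
open import Data.Product using (Σ; ∃; _×_)
open import Function.Definitions using (Injective)
open import Relation.Binary.PropositionalEquality using (_≡_)
open import Relation.Nullary using (¬_)
open import Relation.Nullary.Decidable using (⌊_⌋)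

record KGraph (k n : ℕ) : Set where
  field
    edges   : List (Subset n)
    unique  : Unique edges
    uniform : All (λ e → ∣ e ∣ ≡ k) edges
open KGraph public

e[_] : ∀ {k n} → KGraph k n → ℕ
e[ H ] = length (edges H)

image : ∀ {m n} → (Fin m → Fin n) → Subset m → Subset n
image {zero}  f []      = ∅
image {suc m} f (b ∷ e) = piece b ∪ image (λ i → f (suc i)) e
  where
  piece : Bool → Subset _
  piece true  = ⁅ f zero ⁆
  piece false = ∅

Contains : ∀ {k m n} → KGraph k m → KGraph k n → Set
Contains {m = m} {n = n} F H =
  Σ (Fin m → Fin n) λ φ → Injective _≡_ _≡_ φ × All (λ e → image φ e ∈ edges H) (edges F)

Free : ∀ {k m n} → KGraph k m → KGraph k n → Set
Free F H = ¬ Contains F H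

IsEx : ∀ {m} (k : ℕ) → KGraph k m → ℕ → ℕ → Set
IsEx k F n M =
  (Σ (KGraph k n) λ H → Free F H × e[ H ] ≡ M)
  × ((H : KGraph k n) → Free F H → e[ H ] ≤ M)

-- The k-graph Q_k(r) on vertex set A ⊎ B ⊎ C = Fin ((k ∸ r) + r + r),
-- with |A| = k - r, |B| = |C| = r; edges A ∪ (B ∖ {b_i}) ∪ {c_i}.
QEdge : (k r : ℕ) → Fin r → Subset ((k ∸ r) + r + r)
QEdge k r i = tabulate λ v → cls (splitAt ((k ∸ r) + r) v)
  where
  cls : Fin ((k ∸ r) + r) ⊎ Fin r → Bool
  cls (inj₁ w) with splitAt (k ∸ r) w
  ... | inj₁ _ = true                    -- vertex of A
  ... | inj₂ j = not ⌊ j ≟ i ⌋           -- vertex b_j, j ≠ i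
  cls (inj₂ j) = ⌊ j ≟ i ⌋               -- vertex c_j, j = i

QEdges : (k r : ℕ) → List (Subset ((k ∸ r) + r + r))
QEdges k r = map (QEdge k r) (allFin r)

-- Q_k(r) as a k-graph requires proofs of uniformity / distinctness; to
-- avoid proof obligations in the statement we phrase containment of
-- Q_k(r) directly via its edge list.
ContainsQ : (k r : ℕ) → ∀ {n} → KGraph k n → Set
ContainsQ k r {n} H =
  Σ (Fin ((k ∸ r) + r + r) → Fin n) λ φ →
    Injective _≡_ _≡_ φ × All (λ e → image φ e ∈ edges H) (QEdges k r)

IsExQ : (k r n M : ℕ) → Set
IsExQ k r n M =
  (Σ (KGraph k n) λ H → ¬ ContainsQ k r H × e[ H ] ≡ M)
  × ((H : KGraph k n) → ¬ ContainsQ k r H → e[ H ] ≤ M)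

{-# OPTIONS --safe #-}

-- Upper bounds. In a Q_k(r)-free H every edge has at most r − 1 vertices v such that e ∖ v lies in many edges
-- (otherwise A ∪ B = e extends greedily to a copy). So each edge has a (k−1)-subset of bounded degree, which
-- gives O(n^(k−1)); and if 2r ≤ k + 1 it has r of them, so after fixing the other k − r vertices one is left
-- with an r-uniform system X of bounded codegree. If X had positive density in n^(r−1), the shadows of X would
-- by the removal lemma for K_r^(r−1) contain c·n^r simplices; all but O(n^(r−1)) of these give a copy of Q_k(r).
--
-- The removal lemma is proved in a dual form: if some measure ν with bounded (r−1)-dimensional marginals lives
-- on ⋂ Sᵢ, then ⋂ Sᵢ has positive uniform measure. One descends through levels j: cells of j-ary partitions are
-- regularised by (j−1)-ary ones (coarse and fine, energy increment), ν selects a tuple of cells on which the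
-- densities are not small and the defect Sᵢ ∖ Tᵢ is, and the statement of level j − 1 is applied to the set of
-- points where the fine partition sees the right densities. Everything for fixed n happens under double negation.
--
-- Lower bounds. Put t = k + 1 − r. In a k-partite k-graph a copy of Q_k(r) is a tuple x together with r positions
-- at each of which x can be changed to give an edge. Take edges whose first t coordinates satisfy one linear
-- equation and whose other r − 1 are free: the r positions must then all be linear, which is impossible if t < r.
-- If t ≥ r, require in addition that a second linear form takes values in a Behrend-type set (digits v followed
-- by |v|²); three of the positions would give three distinct points of this set on a line.

module Submission where

open import Agda.Builtin.Int using (pos)
open import Algebra.Bundles using (CommutativeRing)
open import Data.Bool using (Bool; true; false; _∧_; not; if_then_else_)
open import Data.Bool.ListAction using (all)
import Data.Bool.Properties as Bool
open import Data.Empty using (⊥; ⊥-elim)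
open import Data.Fin as Fin using (Fin; zero; suc; combine; _↑ˡ_; _↑ʳ_; splitAt; join; toℕ)
import Data.Fin.Properties as Fin
open import Data.Fin.Subset as Subset using (Subset; _∩_; ∣_∣; _⊆_; _∈_; _∉_; inside; outside; ∁; ⁅_⁆; _∪_) renaming (⊤ to full; _-_ to _∖_)
import Data.Fin.Subset.Properties as Sub
open import Data.Integer as ℤ using (ℤ; 0ℤ; 1ℤ)
import Data.Integer.Properties as ℤ
open import Data.Integer.Tactic.RingSolver using () renaming (ring to ℤring)
open import Data.List as List using (List; []; _∷_; _++_; map; filter; length; allFin; concatMap; cartesianProduct; cartesianProductWith; upTo)
import Data.List.Properties as List
open import Data.List.Membership.DecPropositional using () renaming (_∈?_ to ∈?-with)
open import Data.List.Membership.Propositional using () renaming (_∈_ to _∈ˡ_; _∉_ to _∉ˡ_)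
open import Data.List.Membership.Propositional.Properties using (∈-filter⁺; ∈-filter⁻; ∈-map⁺; ∈-map⁻; ∈-++⁺ˡ; ∈-++⁺ʳ; ∈-++⁻; ∈-allFin; ∈-concatMap⁺; ∈-cartesianProduct⁺; ∈-cartesianProduct⁻; ∈-cartesianProductWith⁻; ∈-upTo⁻)
open import Data.List.Relation.Unary.All as All using (All; []; _∷_)
import Data.List.Relation.Unary.All.Properties as All
open import Data.List.Relation.Unary.Any using (Any; here; there; index)
open import Data.List.Relation.Unary.Any.Properties using (lookup-index)
open import Data.List.Relation.Unary.Unique.Propositional using (Unique; []; _∷_)
import Data.List.Relation.Unary.Unique.Propositional.Properties as Unique
open import Data.Nat as ℕ using (ℕ; zero; suc; _^_)
open import Data.Nat.DivMod using (_/_; _%_; m%n<n; m<n⇒m%n≡m; [m+kn]%n≡m%n; m/n*n≤m; m≡m%n+[m/n]*n; m≥n⇒m/n>0)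
import Data.Nat.Properties as ℕ
open import Data.Nat.Tactic.RingSolver using () renaming (ring to ℕring)
open import Data.Product using (Σ; _×_; _,_; proj₁; proj₂)
import Data.Rational as R
import Data.Rational.Properties as ℚ
open import Data.Sum using (_⊎_; inj₁; inj₂; [_,_]′)
open import Data.Vec as Vec using (Vec; []; _∷_; lookup; _[_]≔_; here; there)
import Data.Vec.Properties as Vec
open import Function.Definitions using (Injective)
open import Level using (0ℓ)
open import Relation.Binary.PropositionalEquality using (_≡_; _≢_; refl; sym; trans; cong; cong₂; subst; subst₂; module ≡-Reasoning)
open import Relation.Nullary using (¬_; Dec; yes; no; contradiction)
open import Relation.Nullary.Decidable using (⌊_⌋; _×-dec_; ¬?; dec⇒maybe)
open import Tactic.RingSolver using (solve-∀)
open import Tactic.RingSolver.Core.AlmostCommutativeRing using (AlmostCommutativeRing; fromCommutativeRing)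

-- The system X left by the bounded codegrees has density of order 1/n, so the uniform measure does
-- not see it. Its normalised indicator ν, however, has bounded (r-1)-dimensional marginals, because
-- the factor 1/n of the codegree cancels against the density. Hence a set that depends on at most
-- r-1 coordinates and is small for the uniform measure is small for ν as well, and the defects of a
-- regularisation can be discarded at a small cost in ν. This takes the place of deleting edges from
-- sparse or irregular cells.
--
-- Two partitions are forced on the descent. The sets handed to level j-1 must have bounded
-- complexity m₀, so the coarse partition defines them; but the box that comes back may have measure
-- as small as 1/C(m₀), and counting errors are additive, so uniformity is needed for a fine
-- partition with an error that depends on m₀.
--
-- Arguments end in ⊥ so that a failing test or a heavy cell is used where it is met and never has
-- to be searched for. Nothing is lost, since what is drawn from them is a negation or a decidable
-- inequality.

module UpperBounds where

  open import Data.Rational using (ℚ; 0ℚ; 1ℚ; _≤_; _<_; 1/_; positive; nonNegative)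

  -- Rational arithmetic

  -- The operations are made opaque so that unification treats them as injective.

  infixl 6 _+_ _-_
  infixl 7 _*_
  infix 8 -_

  opaque
    _+_ _*_ : ℚ → ℚ → ℚ
    _+_ = R._+_
    _*_ = R._*_

    -_ : ℚ → ℚ
    -_ = R.-_

  _-_ : ℚ → ℚ → ℚ
  x - y = x + - y

  opaque
    unfolding _+_

    ℚ-commutativeRing : CommutativeRing 0ℓ 0ℓ
    ℚ-commutativeRing = record
      { Carrier = ℚ ; _≈_ = _≡_ ; _+_ = _+_ ; _*_ = _*_ ; -_ = -_ ; 0# = 0ℚ ; 1# = 1ℚ
      ; isCommutativeRing = ℚ.+-*-isCommutativeRing }

    ℚring : AlmostCommutativeRing 0ℓ 0ℓ
    ℚring = fromCommutativeRing ℚ-commutativeRing (λ x → dec⇒maybe (0ℚ ℚ.≟ x))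

    +-identityˡ : ∀ x → 0ℚ + x ≡ x
    +-identityˡ = ℚ.+-identityˡ

    +-identityʳ : ∀ x → x + 0ℚ ≡ x
    +-identityʳ = ℚ.+-identityʳ

    *-identityˡ : ∀ x → 1ℚ * x ≡ x
    *-identityˡ = ℚ.*-identityˡ

    *-identityʳ : ∀ x → x * 1ℚ ≡ x
    *-identityʳ = ℚ.*-identityʳ

    *-zeroˡ : ∀ x → 0ℚ * x ≡ 0ℚ
    *-zeroˡ = ℚ.*-zeroˡ

    *-zeroʳ : ∀ x → x * 0ℚ ≡ 0ℚ
    *-zeroʳ = ℚ.*-zeroʳ

    *-distribˡ-+ : ∀ x y z → x * (y + z) ≡ x * y + x * z
    *-distribˡ-+ = ℚ.*-distribˡ-+

    +-comm : ∀ x y → x + y ≡ y + x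
    +-comm = ℚ.+-comm

    *-comm : ∀ x y → x * y ≡ y * x
    *-comm = ℚ.*-comm

    *-assoc : ∀ x y z → x * y * z ≡ x * (y * z)
    *-assoc = ℚ.*-assoc

    +-mono : ∀ {a b c d} → a ≤ b → c ≤ d → a + c ≤ b + d
    +-mono = ℚ.+-mono-≤

    +-monoˡ-< : ∀ {a b} c → a < b → a + c < b + c
    +-monoˡ-< c = ℚ.+-monoˡ-< c

    +-monoʳ : ∀ {a b} c → a ≤ b → c + a ≤ c + b
    +-monoʳ c = ℚ.+-monoʳ-≤ c

    +-monoˡ : ∀ {a b} c → a ≤ b → a + c ≤ b + c
    +-monoˡ c = ℚ.+-monoˡ-≤ c

    0≤1 : 0ℚ ≤ 1ℚ
    0≤1 = ℚ.nonNegative⁻¹ 1ℚ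

    0<1 : 0ℚ < 1ℚ
    0<1 = ℚ.positive⁻¹ 1ℚ

    ≤-by : ∀ {x y} d → y ≡ x + d → 0ℚ ≤ d → x ≤ y
    ≤-by {x} d refl 0≤d = subst (_≤ x + d) (ℚ.+-identityʳ x) (ℚ.+-monoʳ-≤ x 0≤d)

    y-x : ∀ x y → y ≡ x + (y - x)
    y-x = solve-∀ ℚring

    x-x : ∀ x → x - x ≡ 0ℚ
    x-x = solve-∀ ℚring

    ≤⇒0≤ : ∀ {x y} → x ≤ y → 0ℚ ≤ y - x
    ≤⇒0≤ {x} {y} p = subst (_≤ y - x) (x-x x) (ℚ.+-monoˡ-≤ (- x) p)

    0≤⇒≤ : ∀ {x y} → 0ℚ ≤ y - x → x ≤ y
    0≤⇒≤ {x} {y} = ≤-by (y - x) (y-x x y)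

    <⇒0< : ∀ {x y} → x < y → 0ℚ < y - x
    <⇒0< {x} {y} p = subst (_< y - x) (x-x x) (ℚ.+-monoˡ-< (- x) p)

    0<⇒< : ∀ {x y} → 0ℚ < y - x → x < y
    0<⇒< {x} {y} p = subst₂ _<_ (ℚ.+-identityʳ x) (sym (y-x x y)) (ℚ.+-monoʳ-< x p)

    0≤+ : ∀ {x y} → 0ℚ ≤ x → 0ℚ ≤ y → 0ℚ ≤ x + y
    0≤+ p q = ℚ.+-mono-≤ p q

    0≤* : ∀ {x y} → 0ℚ ≤ x → 0ℚ ≤ y → 0ℚ ≤ x * y
    0≤* {x} {y} p q = ℚ.nonNegative⁻¹ (x * y) {{ℚ.nonNeg*nonNeg⇒nonNeg x {{nonNegative p}} y {{nonNegative q}}}}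

    0<* : ∀ {x y} → 0ℚ < x → 0ℚ < y → 0ℚ < x * y
    0<* {x} {y} p q = ℚ.positive⁻¹ (x * y) {{ℚ.pos*pos⇒pos x {{positive p}} y {{positive q}}}}

    0<+ : ∀ {x y} → 0ℚ < x → 0ℚ ≤ y → 0ℚ < x + y
    0<+ p q = ℚ.+-mono-<-≤ p q

    *-monoˡ : ∀ {x y} c → 0ℚ ≤ c → x ≤ y → c * x ≤ c * y
    *-monoˡ c p = ℚ.*-monoˡ-≤-nonNeg c {{nonNegative p}}

    *-monoʳ : ∀ {x y} c → 0ℚ ≤ c → x ≤ y → x * c ≤ y * c
    *-monoʳ c p = ℚ.*-monoʳ-≤-nonNeg c {{nonNegative p}}

    *-cancelˡ : ∀ {x y} c → 0ℚ < c → c * x ≤ c * y → x ≤ y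
    *-cancelˡ c p = ℚ.*-cancelˡ-≤-pos c {{positive p}}

    *-mono : ∀ {a b c d} → 0ℚ ≤ a → 0ℚ ≤ d → a ≤ b → c ≤ d → a * c ≤ b * d
    *-mono {a} {b} {c} {d} 0≤a 0≤d p q = ℚ.≤-trans (*-monoˡ a 0≤a q) (*-monoʳ d 0≤d p)

    neg-sq : ∀ x → (- x) * (- x) ≡ x * x
    neg-sq = solve-∀ ℚring

    0≤sq : ∀ x → 0ℚ ≤ x * x
    0≤sq x with ℚ.≤-total 0ℚ x
    ... | inj₁ p = 0≤* p p
    ... | inj₂ p = subst (0ℚ ≤_) (neg-sq x) (0≤* { - x } { - x } p′ p′)
      where
      p′ : 0ℚ ≤ - x
      p′ = ℚ.neg-antimono-≤ p

  opaque
    unfolding ℚring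

    ι : ℕ → ℚ
    ι zero    = 0ℚ
    ι (suc n) = 1ℚ + ι n

    ι-zero : ι 0 ≡ 0ℚ
    ι-zero = refl

    ι-suc : ∀ n → ι (suc n) ≡ 1ℚ + ι n
    ι-suc n = refl

    0≤ι : ∀ n → 0ℚ ≤ ι n
    0≤ι zero    = ℚ.≤-refl
    0≤ι (suc n) = 0≤+ 0≤1 (0≤ι n)

    0<ι : ∀ n → 0ℚ < ι (suc n)
    0<ι n = 0<+ 0<1 (0≤ι n)

    ι-+ : ∀ m n → ι (m ℕ.+ n) ≡ ι m + ι n
    ι-+ zero    n = sym (ℚ.+-identityˡ (ι n))
    ι-+ (suc m) n = trans (cong (1ℚ +_) (ι-+ m n)) (sym (ℚ.+-assoc 1ℚ (ι m) (ι n)))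

    suc-* : ∀ x y → y + x * y ≡ (1ℚ + x) * y
    suc-* = solve-∀ ℚring

    ι-* : ∀ m n → ι (m ℕ.* n) ≡ ι m * ι n
    ι-* zero    n = sym (ℚ.*-zeroˡ (ι n))
    ι-* (suc m) n = trans (ι-+ n (m ℕ.* n)) (trans (cong (ι n +_) (ι-* m n)) (suc-* (ι m) (ι n)))

    ι-mono : ∀ {m n} → m ℕ.≤ n → ι m ≤ ι n
    ι-mono {n = n} ℕ.z≤n = 0≤ι n
    ι-mono (ℕ.s≤s p) = ℚ.+-monoʳ-≤ 1ℚ (ι-mono p)

    ι-cancel : ∀ {m n} → ι m ≤ ι n → m ℕ.≤ n
    ι-cancel {m} {n} p with m ℕ.≤? n
    ... | yes q = q
    ... | no ¬q = ⊥-elim (ℚ.<-irrefl refl (ℚ.<-≤-trans (ℚ.<-≤-trans (ℚ.+-monoˡ-< (ι n) 0<1) (ι-mono (ℕ.≰⇒> ¬q)))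
                    (subst (ι m ≤_) (sym (ℚ.+-identityˡ (ι n))) p)))

    1≤ι : ∀ {n} → 1 ℕ.≤ n → 1ℚ ≤ ι n
    1≤ι {n} p = subst (_≤ ι n) (ℚ.+-identityʳ 1ℚ) (ι-mono p)

    -- Total, with value 0 at 0, so that averages and conditional expectations carry no proof that a
    -- denominator is nonzero; `*-inv` asks for positivity instead.
    inv : ℚ → ℚ
    inv x with x ℚ.≟ 0ℚ
    ... | yes _ = 0ℚ
    ... | no ¬p = 1/_ x {{R.≢-nonZero ¬p}}

    *-inv : ∀ {x} → 0ℚ < x → x * inv x ≡ 1ℚ
    *-inv {x} p with x ℚ.≟ 0ℚ
    ... | yes refl = ⊥-elim (ℚ.<-irrefl refl p)
    ... | no ¬p = ℚ.*-inverseʳ x {{R.≢-nonZero ¬p}}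

    0≤inv : ∀ {x} → 0ℚ < x → 0ℚ ≤ inv x
    0≤inv {x} p = *-cancelˡ x p (subst₂ _≤_ (sym (ℚ.*-zeroʳ x)) (sym (*-inv p)) 0≤1)

  ⟦_⟧ : Bool → ℚ
  ⟦ true ⟧  = 1ℚ
  ⟦ false ⟧ = 0ℚ

  opaque
    unfolding _+_

    0≤⟦⟧ : ∀ b → 0ℚ ≤ ⟦ b ⟧
    0≤⟦⟧ true  = 0≤1
    0≤⟦⟧ false = ℚ.≤-refl

    ⟦⟧≤1 : ∀ b → ⟦ b ⟧ ≤ 1ℚ
    ⟦⟧≤1 true  = ℚ.≤-refl
    ⟦⟧≤1 false = 0≤1

    ⟦∧⟧ : ∀ a b → ⟦ a ∧ b ⟧ ≡ ⟦ a ⟧ * ⟦ b ⟧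
    ⟦∧⟧ true  b = sym (ℚ.*-identityˡ ⟦ b ⟧)
    ⟦∧⟧ false b = sym (ℚ.*-zeroˡ ⟦ b ⟧)

    ⟦⟧-mono : ∀ {a b} → (a ≡ true → b ≡ true) → ⟦ a ⟧ ≤ ⟦ b ⟧
    ⟦⟧-mono {false} {b} f = 0≤⟦⟧ b
    ⟦⟧-mono {true}  {b} f rewrite f refl = ℚ.≤-refl

    ⟦⟧-idem : ∀ b → ⟦ b ⟧ * ⟦ b ⟧ ≡ ⟦ b ⟧
    ⟦⟧-idem true  = refl
    ⟦⟧-idem false = refl

  infix 4 _≡ᵇ_

  _≡ᵇ_ : ∀ {m} → Fin m → Fin m → Bool
  i ≡ᵇ j = ⌊ i Fin.≟ j ⌋

  ≡ᵇ⇒≡ : ∀ {m} {i j : Fin m} → (i ≡ᵇ j) ≡ true → i ≡ j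
  ≡ᵇ⇒≡ {i = i} {j} p with i Fin.≟ j
  ... | yes q = q

  ≡⇒≡ᵇ : ∀ {m} {i j : Fin m} → i ≡ j → (i ≡ᵇ j) ≡ true
  ≡⇒≡ᵇ {i = i} {j} p with i Fin.≟ j
  ... | yes _ = refl
  ... | no ¬q = contradiction p ¬q

  ≡≤ : ∀ {a b c : ℚ} → a ≡ b → b ≤ c → a ≤ c
  ≡≤ refl q = q

  ≤≡ : ∀ {a b c : ℚ} → a ≤ b → b ≡ c → a ≤ c
  ≤≡ p refl = p

  -- Finite sums

  opaque
    unfolding ℚring ι

    sumF : ∀ {m} → (Fin m → ℚ) → ℚ
    sumF {zero}  f = 0ℚ
    sumF {suc m} f = f zero + sumF (λ i → f (suc i))

    sumF-zero : (f : Fin 0 → ℚ) → sumF f ≡ 0ℚ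
    sumF-zero f = refl

    sumF-suc : ∀ {m} (f : Fin (suc m) → ℚ) → sumF f ≡ f zero + sumF (λ i → f (suc i))
    sumF-suc f = refl

    sumF-cong : ∀ {m} {f g : Fin m → ℚ} → (∀ i → f i ≡ g i) → sumF f ≡ sumF g
    sumF-cong {zero}  h = refl
    sumF-cong {suc m} h = cong₂ _+_ (h zero) (sumF-cong (λ i → h (suc i)))

    +-interchange : ∀ a b c d → (a + b) + (c + d) ≡ (a + c) + (b + d)
    +-interchange = solve-∀ ℚring

    sumF-+ : ∀ {m} (f g : Fin m → ℚ) → sumF (λ i → f i + g i) ≡ sumF f + sumF g
    sumF-+ {zero}  f g = sym (ℚ.+-identityʳ 0ℚ)
    sumF-+ {suc m} f g = trans (cong (f zero + g zero +_) (sumF-+ (λ i → f (suc i)) (λ i → g (suc i))))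
                               (+-interchange (f zero) (g zero) _ _)

    sumF-* : ∀ {m} c (f : Fin m → ℚ) → sumF (λ i → c * f i) ≡ c * sumF f
    sumF-* {zero}  c f = sym (ℚ.*-zeroʳ c)
    sumF-* {suc m} c f = trans (cong (c * f zero +_) (sumF-* c (λ i → f (suc i))))
                               (sym (ℚ.*-distribˡ-+ c (f zero) _))

    sumF-mono : ∀ {m} {f g : Fin m → ℚ} → (∀ i → f i ≤ g i) → sumF f ≤ sumF g
    sumF-mono {zero}  h = ℚ.≤-refl
    sumF-mono {suc m} h = ℚ.+-mono-≤ (h zero) (sumF-mono (λ i → h (suc i)))

    sumF-const : ∀ {m} c → sumF {m} (λ _ → c) ≡ ι m * c
    sumF-const {zero}  c = sym (ℚ.*-zeroˡ c)
    sumF-const {suc m} c = trans (cong (c +_) (sumF-const {m} c)) (suc-* (ι m) c)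

    sumF-0≤ : ∀ {m} {f : Fin m → ℚ} → (∀ i → 0ℚ ≤ f i) → 0ℚ ≤ sumF f
    sumF-0≤ {zero}  h = ℚ.≤-refl
    sumF-0≤ {suc m} h = 0≤+ (h zero) (sumF-0≤ (λ i → h (suc i)))

    sumF-term : ∀ {m} {f : Fin m → ℚ} → (∀ i → 0ℚ ≤ f i) → ∀ i → f i ≤ sumF f
    sumF-term {f = f} h zero    = ≤-by (sumF (λ i → f (suc i))) refl (sumF-0≤ (λ i → h (suc i)))
    sumF-term {f = f} h (suc i) = ≤-by (f zero + (sumF (λ i → f (suc i)) - f (suc i)))
      (lem (f zero) _ (f (suc i))) (0≤+ (h zero) (≤⇒0≤ (sumF-term {f = λ i → f (suc i)} (λ i → h (suc i)) i)))
      where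
      lem : ∀ a s x → a + s ≡ x + (a + (s - x))
      lem = solve-∀ ℚring

    sumF-δ : ∀ {m} (k : Fin m) (G : Fin m → ℚ) → sumF (λ i → ⟦ k ≡ᵇ i ⟧ * G i) ≡ G k
    sumF-δ {suc m} zero G = trans (cong₂ _+_ (ℚ.*-identityˡ (G zero))
        (trans (sumF-cong (λ i → ℚ.*-zeroˡ (G (suc i)))) (trans (sumF-const {m} 0ℚ) (ℚ.*-zeroʳ (ι m)))))
      (ℚ.+-identityʳ (G zero))
    sumF-δ {suc m} (suc k) G = trans (cong₂ _+_ (ℚ.*-zeroˡ (G zero))
        (trans (sumF-cong (λ i → cong (λ b → ⟦ b ⟧ * G (suc i)) (shift i))) (sumF-δ k (λ i → G (suc i)))))
      (ℚ.+-identityˡ (G (suc k)))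
      where
      shift : ∀ i → (suc k ≡ᵇ suc i) ≡ (k ≡ᵇ i)
      shift i with k Fin.≟ i
      ... | yes refl = refl
      ... | no _ = refl

    sumF-- : ∀ {m} (f g : Fin m → ℚ) → sumF (λ i → f i - g i) ≡ sumF f - sumF g
    sumF-- {zero}  f g = refl
    sumF-- {suc m} f g = trans (cong (f zero - g zero +_) (sumF-- (λ i → f (suc i)) (λ i → g (suc i)))) (lem (f zero) (g zero) _ _)
      where
      lem : ∀ a b c d → (a - b) + (c - d) ≡ (a + c) - (b + d)
      lem = solve-∀ ℚring

  -- The coordinates in `s` vary with the first tuple while the others stay frozen at the second.
  -- Full-length tuples on both sides avoid a separate type of functions of the coordinates in `s`.
  merge : ∀ {A : Set} {r} → Subset r → Vec A r → Vec A r → Vec A r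
  merge []          []      []      = []
  merge (true  ∷ s) (a ∷ x) (b ∷ y) = a ∷ merge s x y
  merge (false ∷ s) (a ∷ x) (b ∷ y) = b ∷ merge s x y

  opaque
    unfolding ℚring

    -- Ring identities are stated apart because the solver needs the operations unfolded.
    *-rotate : ∀ x y z → x * (y * z) ≡ y * x * z
    *-rotate = solve-∀ ℚring

    *-swap : ∀ a b c → a * (b * c) ≡ b * (a * c)
    *-swap = solve-∀ ℚring

    neg≡-1* : ∀ x → - x ≡ - 1ℚ * x
    neg≡-1* = solve-∀ ℚring

    ring₁ : ∀ a b c → a * b * c ≡ b * c * a
    ring₁ = solve-∀ ℚring

    ring₂ : ∀ a b c → a * b * c ≡ a * (c * b)
    ring₂ = solve-∀ ℚring

    ring₃ : ∀ a b c d → a * b * (c * d) ≡ c * b * a * d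
    ring₃ = solve-∀ ℚring

    ring₄ : ∀ a b c → a * (b * 0ℚ) ≡ c * 0ℚ
    ring₄ = solve-∀ ℚring

    sq-diff : ∀ a b → (a - b) * (a - b) ≡ a * a + (- (1ℚ + 1ℚ) * (a * b) + b * b)
    sq-diff = solve-∀ ℚring

    ring₇ : ∀ a b → a + (- (1ℚ + 1ℚ) * b + b) ≡ a - b
    ring₇ = solve-∀ ℚring

    *-distribʳ-sub : ∀ a b c → (a - b) * c ≡ a * c - b * c
    *-distribʳ-sub = solve-∀ ℚring

    ring₅ : ∀ u a h → (u - a * h) * (u - a * h) ≡ u * u + (- (1ℚ + 1ℚ) * a * (u * h) + a * a * (h * h))
    ring₅ = solve-∀ ℚring

    ring₆ : ∀ s a m → s ≡ a * a + (s + (- (1ℚ + 1ℚ) * a * a + a * a * m) + a * a * (1ℚ - m))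
    ring₆ = solve-∀ ℚring

  -- Averages over Vec (Fin (suc n)) r

  module Average (n : ℕ) where

    V : ℕ → Set
    V r = Vec (Fin (suc n)) r

    w : ℚ
    w = inv (ι (suc n))

    0≤w : 0ℚ ≤ w
    0≤w = 0≤inv (0<ι n)

    N*w : ι (suc n) * w ≡ 1ℚ
    N*w = *-inv (0<ι n)

    opaque
      avg : (Fin (suc n) → ℚ) → ℚ
      avg f = w * sumF f

      avg-cong : ∀ {f g} → (∀ i → f i ≡ g i) → avg f ≡ avg g
      avg-cong h = cong (w *_) (sumF-cong h)

      avg-const : ∀ c → avg (λ _ → c) ≡ c
      avg-const c = begin
        w * sumF {suc n} (λ _ → c) ≡⟨ cong (w *_) (sumF-const {suc n} c) ⟩
        w * (ι (suc n) * c)        ≡⟨ *-rotate w (ι (suc n)) c ⟩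
        ι (suc n) * w * c          ≡⟨ cong (_* c) N*w ⟩
        1ℚ * c                     ≡⟨ *-identityˡ c ⟩
        c ∎
        where
        open ≡-Reasoning

      avg-mono : ∀ {f g} → (∀ i → f i ≤ g i) → avg f ≤ avg g
      avg-mono h = *-monoˡ w 0≤w (sumF-mono h)

      avg-+ : ∀ f g → avg (λ i → f i + g i) ≡ avg f + avg g
      avg-+ f g = trans (cong (w *_) (sumF-+ f g)) (*-distribˡ-+ w (sumF f) (sumF g))

      avg-* : ∀ c f → avg (λ i → c * f i) ≡ c * avg f
      avg-* c f = trans (cong (w *_) (sumF-* c f)) (*-swap w c (sumF f))

      E : ∀ {r} → (V r → ℚ) → ℚ
      E {zero}  F = F []
      E {suc r} F = avg (λ a → E (λ x → F (a ∷ x)))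

      avg-def : ∀ f → avg f ≡ w * sumF f
      avg-def f = refl

      E-zero : (F : V 0 → ℚ) → E F ≡ F []
      E-zero F = refl

      E-suc : ∀ {r} (F : V (suc r) → ℚ) → E F ≡ avg (λ a → E (λ x → F (a ∷ x)))
      E-suc F = refl

      E-cong : ∀ {r} {F G : V r → ℚ} → (∀ x → F x ≡ G x) → E F ≡ E G
      E-cong {zero}  h = h []
      E-cong {suc r} h = avg-cong (λ a → E-cong (λ x → h (a ∷ x)))

      E-const : ∀ {r} c → E {r} (λ _ → c) ≡ c
      E-const {zero}  c = refl
      E-const {suc r} c = trans (avg-cong (λ a → E-const {r} c)) (avg-const c)

      E-mono : ∀ {r} {F G : V r → ℚ} → (∀ x → F x ≤ G x) → E F ≤ E G
      E-mono {zero}  h = h []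
      E-mono {suc r} h = avg-mono (λ a → E-mono (λ x → h (a ∷ x)))

      E-+ : ∀ {r} (F G : V r → ℚ) → E (λ x → F x + G x) ≡ E F + E G
      E-+ {zero}  F G = refl
      E-+ {suc r} F G = trans (avg-cong (λ a → E-+ (λ x → F (a ∷ x)) (λ x → G (a ∷ x)))) (avg-+ _ _)

      E-* : ∀ {r} c (F : V r → ℚ) → E (λ x → c * F x) ≡ c * E F
      E-* {zero}  c F = refl
      E-* {suc r} c F = trans (avg-cong (λ a → E-* c (λ x → F (a ∷ x)))) (avg-* c _)

      E-0≤ : ∀ {r} {F : V r → ℚ} → (∀ x → 0ℚ ≤ F x) → 0ℚ ≤ E F
      E-0≤ {r} {F} h = subst (_≤ E F) (E-const {r} 0ℚ) (E-mono h)

      E-≤ : ∀ {r} {F : V r → ℚ} {c} → (∀ x → F x ≤ c) → E F ≤ c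
      E-≤ {r} {F} {c} h = subst (E F ≤_) (E-const {r} c) (E-mono h)

      E-sumF : ∀ {r m} (F : Fin m → V r → ℚ) → E (λ x → sumF (λ i → F i x)) ≡ sumF (λ i → E (F i))
      E-sumF {r} {zero}  F = trans (E-cong (λ x → sumF-zero (λ i → F i x))) (trans (E-const {r} 0ℚ) (sym (sumF-zero _)))
      E-sumF {r} {suc m} F = trans (E-cong (λ x → sumF-suc (λ i → F i x))) (trans (E-+ (F zero) _)
        (trans (cong (E (F zero) +_) (E-sumF (λ i → F (suc i)))) (sym (sumF-suc (λ i → E (F i))))))

      E-avg : ∀ {r} (F : Fin (suc n) → V r → ℚ) → E (λ x → avg (λ a → F a x)) ≡ avg (λ a → E (F a))
      E-avg F = trans (E-* w (λ x → sumF (λ i → F i x))) (cong (w *_) (E-sumF F))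

      E-swap : ∀ {r r′} (F : V r → V r′ → ℚ) → E (λ x → E (λ y → F x y)) ≡ E (λ y → E (λ x → F x y))
      E-swap {zero}  F = refl
      E-swap {suc r} F = trans (avg-cong (λ a → E-swap (λ x → F (a ∷ x)))) (sym (E-avg (λ a y → E (λ x → F (a ∷ x) y))))

      -- Fubini for the coordinates inside and outside `s`. Both averages run over full tuples; the
      -- entries that `merge` drops are dummies and average away.
      E-merge : ∀ {r} (s : Subset r) (F : V r → ℚ) → E F ≡ E (λ y → E (λ x → F (merge s x y)))
      E-merge []          F = refl
      E-merge (true ∷ s)  F = begin
        avg (λ a → E (λ x → F (a ∷ x)))
          ≡⟨ avg-cong (λ a → E-merge s (λ x → F (a ∷ x))) ⟩
        avg (λ a → E (λ y → E (λ x → F (a ∷ merge s x y))))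
          ≡⟨ E-avg (λ a y → E (λ x → F (a ∷ merge s x y))) ⟨
        E (λ y → avg (λ a → E (λ x → F (a ∷ merge s x y))))
          ≡⟨ avg-const _ ⟨
        avg (λ b → E (λ y → avg (λ a → E (λ x → F (a ∷ merge s x y))))) ∎
        where open ≡-Reasoning
      E-merge (false ∷ s) F = avg-cong (λ b → trans (E-merge s (λ x → F (b ∷ x)))
        (E-cong (λ y → sym (avg-const (E (λ x → F (b ∷ merge s x y)))))))

      E-resample : ∀ {r} (i : Fin r) (F : V r → ℚ) → E F ≡ E (λ x → avg (λ a → F (x [ i ]≔ a)))
      E-resample {suc r} zero F = begin
        avg (λ a → E (λ x → F (a ∷ x)))                      ≡⟨ E-avg (λ a x → F (a ∷ x)) ⟨
        E (λ x → avg (λ a → F (a ∷ x)))                      ≡⟨ avg-const _ ⟨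
        avg (λ _ → E (λ x → avg (λ a → F (a ∷ x)))) ∎
        where open ≡-Reasoning
      E-resample (suc i) F = avg-cong (λ b → E-resample i (λ x → F (b ∷ x)))

      avg-0<w : 0ℚ < w
      avg-0<w with 0ℚ ℚ.<? w
      ... | yes p = p
      ... | no ¬p = ⊥-elim (ℚ.<-irrefl refl (subst (0ℚ <_) (trans (sym N*w)
                       (trans (cong (ι (suc n) *_) (ℚ.≤-antisym (ℚ.≮⇒≥ ¬p) 0≤w)) (*-zeroʳ (ι (suc n))))) 0<1))

      E-0< : ∀ {r} {F : V r → ℚ} → (∀ x → 0ℚ ≤ F x) → ∀ y → 0ℚ < F y → 0ℚ < E F
      E-0< {zero}  h []      p = p
      E-0< {suc r} {F} h (a ∷ y) p = 0<* avg-0<w (ℚ.<-≤-trans (E-0< (λ x → h (a ∷ x)) y p)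
                                   (sumF-term {f = λ a → E (λ x → F (a ∷ x))} (λ a → E-0≤ (λ x → h (a ∷ x))) a))

      E-- : ∀ {r} (F G : V r → ℚ) → E (λ x → F x - G x) ≡ E F - E G
      E-- F G = trans (E-+ F (λ x → - G x)) (cong (E F +_)
          (trans (E-cong (λ x → neg≡-1* (G x))) (trans (E-* (- 1ℚ) G) (sym (neg≡-1* (E G))))))

    μ : ∀ {r} → (V r → Bool) → ℚ
    μ B = E (λ x → ⟦ B x ⟧)

    0≤μ : ∀ {r} (B : V r → Bool) → 0ℚ ≤ μ B
    0≤μ B = E-0≤ (λ x → 0≤⟦⟧ (B x))

    μ≤1 : ∀ {r} (B : V r → Bool) → μ B ≤ 1ℚ
    μ≤1 B = E-≤ (λ x → ⟦⟧≤1 (B x))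

    μ-mono : ∀ {r} {A B : V r → Bool} → (∀ x → A x ≡ true → B x ≡ true) → μ A ≤ μ B
    μ-mono h = E-mono (λ x → ⟦⟧-mono (h x))

    -- Conditional expectations with respect to the partition into fibres of q

    module Cond {r M : ℕ} (q : V r → Fin M) where

      mass : V r → ℚ
      mass x = E (λ y → ⟦ q y ≡ᵇ q x ⟧)

      -- The fibre is the one through `x` itself, so there are no null fibres to exclude.
      0<mass : ∀ x → 0ℚ < mass x
      0<mass x = E-0< (λ y → 0≤⟦⟧ (q y ≡ᵇ q x)) x
        (subst (λ b → 0ℚ < ⟦ b ⟧) (sym (≡⇒≡ᵇ {i = q x} refl)) 0<1)

      opaque
        P : (V r → ℚ) → V r → ℚ
        P f x = E (λ y → f y * ⟦ q y ≡ᵇ q x ⟧) * inv (mass x)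

        P-inv : ∀ f {x y} → q x ≡ q y → P f x ≡ P f y
        P-inv f e = cong (λ β → E (λ y → f y * ⟦ q y ≡ᵇ β ⟧) * inv (E (λ y → ⟦ q y ≡ᵇ β ⟧))) e

        P-0≤ : ∀ {f} → (∀ x → 0ℚ ≤ f x) → ∀ x → 0ℚ ≤ P f x
        P-0≤ h x = 0≤* (E-0≤ (λ y → 0≤* (h y) (0≤⟦⟧ (q y ≡ᵇ q x)))) (0≤inv (0<mass x))

        P-≤1 : ∀ {f} → (∀ x → f x ≤ 1ℚ) → ∀ x → P f x ≤ 1ℚ
        P-≤1 {f} h x = subst (P f x ≤_) (*-inv (0<mass x)) (*-monoʳ (inv (mass x)) (0≤inv (0<mass x))
          (E-mono (λ y → subst (f y * ⟦ q y ≡ᵇ q x ⟧ ≤_) (*-identityˡ _) (*-monoʳ _ (0≤⟦⟧ (q y ≡ᵇ q x)) (h y)))))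

        private
          ≡ᵇ-sym : ∀ {m} (i j : Fin m) → (i ≡ᵇ j) ≡ (j ≡ᵇ i)
          ≡ᵇ-sym i j with i Fin.≟ j | j Fin.≟ i
          ... | yes _ | yes _ = refl
          ... | no _  | no _  = refl
          ... | yes p | no ¬p = contradiction (sym p) ¬p
          ... | no ¬p | yes p = contradiction (sym p) ¬p

        -- Exchange the two averages. Lying in the same fibre is symmetric, and `g` and the mass are
        -- constant on fibres, so the inner average becomes the mass of a fibre times its inverse.
        P-adjoint : ∀ (f g : V r → ℚ) → (∀ {x y} → q x ≡ q y → g x ≡ g y) → E (λ x → P f x * g x) ≡ E (λ x → f x * g x)
        P-adjoint f g g-inv = begin
          E (λ x → P f x * g x)
            ≡⟨ E-cong (λ x → trans (ring₁ _ (inv (mass x)) (g x)) (sym (E-* (inv (mass x) * g x) _))) ⟩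
          E (λ x → E (λ y → inv (mass x) * g x * (f y * ⟦ q y ≡ᵇ q x ⟧)))
            ≡⟨ E-swap _ ⟩
          E (λ y → E (λ x → inv (mass x) * g x * (f y * ⟦ q y ≡ᵇ q x ⟧)))
            ≡⟨ E-cong (λ y → E-cong (λ x → move x y)) ⟩
          E (λ y → E (λ x → f y * g y * inv (mass y) * ⟦ q x ≡ᵇ q y ⟧))
            ≡⟨ E-cong (λ y → trans (E-* _ _) (trans (ring₂ (f y * g y) (inv (mass y)) (mass y))
                 (trans (cong (f y * g y *_) (*-inv (0<mass y))) (*-identityʳ _)))) ⟩
          E (λ y → f y * g y) ∎
          where
          open ≡-Reasoning
          move : ∀ x y → inv (mass x) * g x * (f y * ⟦ q y ≡ᵇ q x ⟧) ≡ f y * g y * inv (mass y) * ⟦ q x ≡ᵇ q y ⟧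
          move x y rewrite ≡ᵇ-sym (q y) (q x) with q x Fin.≟ q y
          ... | yes e = trans (cong₂ (λ a b → inv a * b * (f y * 1ℚ)) (cong (λ β → E (λ y → ⟦ q y ≡ᵇ β ⟧)) e) (g-inv e)) (ring₃ (inv (mass y)) (g y) (f y) 1ℚ)
          ... | no _  = ring₄ (inv (mass x) * g x) (f y) (f y * g y * inv (mass y))

      E-P : ∀ f → E (P f) ≡ E f
      E-P f = trans (E-cong (λ x → sym (*-identityʳ _))) (trans (P-adjoint f (λ _ → 1ℚ) (λ _ → refl)) (E-cong (λ x → *-identityʳ (f x))))

    open Cond using (P; P-inv; P-0≤; P-≤1; P-adjoint; E-P)

    module _ {r M M′ : ℕ} (q : V r → Fin M) (q′ : V r → Fin M′) (finer : ∀ {x y} → q′ x ≡ q′ y → q x ≡ q y) where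

      -- The coarse expectation is constant on the fine fibres too, so by `P-adjoint` the cross term
      -- and the coarse energy both equal the average of `f` times the coarse expectation.
      pythagoras : ∀ f → E (λ x → (P q′ f x - P q f x) * (P q′ f x - P q f x))
                         ≡ E (λ x → P q′ f x * P q′ f x) - E (λ x → P q f x * P q f x)
      pythagoras f = begin
        E (λ x → (P q′ f x - P q f x) * (P q′ f x - P q f x))
          ≡⟨ E-cong (λ x → sq-diff (P q′ f x) (P q f x)) ⟩
        E (λ x → P q′ f x * P q′ f x + (- (1ℚ + 1ℚ) * (P q′ f x * P q f x) + P q f x * P q f x))
          ≡⟨ trans (E-+ _ _) (cong (E (λ x → P q′ f x * P q′ f x) +_) (trans (E-+ _ _) (cong (_+ b) (E-* _ _)))) ⟩
        E (λ x → P q′ f x * P q′ f x) + (- (1ℚ + 1ℚ) * E (λ x → P q′ f x * P q f x) + b)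
          ≡⟨ cong (λ c → E (λ x → P q′ f x * P q′ f x) + (- (1ℚ + 1ℚ) * c + b)) cross ⟩
        E (λ x → P q′ f x * P q′ f x) + (- (1ℚ + 1ℚ) * b + b)
          ≡⟨ ring₇ _ b ⟩
        E (λ x → P q′ f x * P q′ f x) - b ∎
        where
        open ≡-Reasoning
        b = E (λ x → P q f x * P q f x)
        cross : E (λ x → P q′ f x * P q f x) ≡ b
        cross = trans (P-adjoint q′ f (P q f) (λ e → P-inv q f (finer e))) (sym (P-adjoint q f (P q f) (P-inv q f)))

      -- A function of the finer partition that correlates with f − P f witnesses an energy increment.
      energy-increment : ∀ f (h : V r → Bool) → (∀ {x y} → q′ x ≡ q′ y → h x ≡ h y) →
        let a = E (λ x → (f x - P q f x) * ⟦ h x ⟧) in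
        a * a ≤ E (λ x → P q′ f x * P q′ f x) - E (λ x → P q f x * P q f x)
      energy-increment f h h-inv = subst (a * a ≤_) (pythagoras f)
        (≤-by (E (λ x → (u x - a * ⟦ h x ⟧) * (u x - a * ⟦ h x ⟧)) + a * a * (1ℚ - μ h)) expand
          (0≤+ (E-0≤ (λ x → 0≤sq (u x - a * ⟦ h x ⟧))) (0≤* (0≤sq a) (≤⇒0≤ (μ≤1 h)))))
        where
        open ≡-Reasoning
        a = E (λ x → (f x - P q f x) * ⟦ h x ⟧)
        u : V r → ℚ
        u x = P q′ f x - P q f x
        a≡ : E (λ x → u x * ⟦ h x ⟧) ≡ a
        a≡ = begin
          E (λ x → u x * ⟦ h x ⟧) ≡⟨ trans (E-cong (λ x → *-distribʳ-sub (P q′ f x) (P q f x) ⟦ h x ⟧)) (E-- _ _) ⟩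
          E (λ x → P q′ f x * ⟦ h x ⟧) - E (λ x → P q f x * ⟦ h x ⟧)
            ≡⟨ cong (_- E (λ x → P q f x * ⟦ h x ⟧)) (P-adjoint q′ f (λ x → ⟦ h x ⟧) (λ e → cong ⟦_⟧ (h-inv e))) ⟩
          E (λ x → f x * ⟦ h x ⟧) - E (λ x → P q f x * ⟦ h x ⟧) ≡⟨ trans (E-cong (λ x → *-distribʳ-sub (f x) (P q f x) ⟦ h x ⟧)) (E-- _ _) ⟨
          a ∎
        -- Cauchy-Schwarz without division: expand the square of u - a·h, using that u·h averages to
        -- `a` and that h² = h. The leftover terms are nonnegative because h has measure at most 1.
        expand : E (λ x → u x * u x) ≡ a * a + (E (λ x → (u x - a * ⟦ h x ⟧) * (u x - a * ⟦ h x ⟧)) + a * a * (1ℚ - μ h))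
        expand = trans (ring₆ (E (λ x → u x * u x)) a (μ h)) (cong (λ z → a * a + (z + a * a * (1ℚ - μ h))) (sym (begin
          E (λ x → (u x - a * ⟦ h x ⟧) * (u x - a * ⟦ h x ⟧))
            ≡⟨ E-cong (λ x → trans (ring₅ (u x) a ⟦ h x ⟧) (cong (λ z → u x * u x + (- (1ℚ + 1ℚ) * a * (u x * ⟦ h x ⟧) + a * a * z)) (⟦⟧-idem (h x)))) ⟩
          E (λ x → u x * u x + (- (1ℚ + 1ℚ) * a * (u x * ⟦ h x ⟧) + a * a * ⟦ h x ⟧))
            ≡⟨ trans (E-+ _ _) (cong (E (λ x → u x * u x) +_) (trans (E-+ _ _) (cong₂ _+_ (trans (E-* _ _) (cong (- (1ℚ + 1ℚ) * a *_) a≡)) (E-* _ _)))) ⟩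
          E (λ x → u x * u x) + (- (1ℚ + 1ℚ) * a * a + a * a * μ h) ∎)))

  -- Booleans and subsets

  bool-ext : ∀ {a b} → (a ≡ true → b ≡ true) → (b ≡ true → a ≡ true) → a ≡ b
  bool-ext {true}  {b}     f g = sym (f refl)
  bool-ext {false} {true}  f g = g refl
  bool-ext {false} {false} f g = refl

  ∧⁻ : ∀ {a b} → a ∧ b ≡ true → a ≡ true × b ≡ true
  ∧⁻ {true} p = refl , p

  ∧⁺ : ∀ {a b} → a ≡ true → b ≡ true → a ∧ b ≡ true
  ∧⁺ refl q = q

  module _ {A : Set} where

    all⁺ : (p : A → Bool) (xs : List A) → (∀ {x} → x ∈ˡ xs → p x ≡ true) → all p xs ≡ true
    all⁺ p []       h = refl
    all⁺ p (x ∷ xs) h = ∧⁺ (h (here refl)) (all⁺ p xs (λ m → h (there m)))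

    all⁻ : (p : A → Bool) (xs : List A) → all p xs ≡ true → ∀ {x} → x ∈ˡ xs → p x ≡ true
    all⁻ p (x ∷ xs) h (here refl) = proj₁ (∧⁻ h)
    all⁻ p (x ∷ xs) h (there m)   = all⁻ p xs (proj₂ (∧⁻ {p x} h)) m

    all-cong : {p q : A → Bool} (xs : List A) → (∀ x → p x ≡ q x) → all p xs ≡ all q xs
    all-cong []       h = refl
    all-cong (x ∷ xs) h = cong₂ _∧_ (h x) (all-cong xs h)

  subsets : ∀ r → List (Subset r)
  subsets zero    = [] ∷ []
  subsets (suc r) = map (outside ∷_) (subsets r) ++ map (inside ∷_) (subsets r)

  ∈-subsets : ∀ {r} (e : Subset r) → e ∈ˡ subsets r
  ∈-subsets []          = here refl
  ∈-subsets (false ∷ e) = ∈-++⁺ˡ (∈-map⁺ (outside ∷_) (∈-subsets e))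
  ∈-subsets {suc r} (true ∷ e)  = ∈-++⁺ʳ (map (outside ∷_) (subsets r)) (∈-map⁺ (inside ∷_) (∈-subsets e))

  subsets-unique : ∀ r → Unique (subsets r)
  subsets-unique zero    = [] ∷ []
  subsets-unique (suc r) = Unique.++⁺ (Unique.map⁺ (λ { refl → refl }) (subsets-unique r))
    (Unique.map⁺ (λ { refl → refl }) (subsets-unique r)) disjoint
    where
    disjoint : ∀ {v} → ¬ (v ∈ˡ map (outside ∷_) (subsets r) × v ∈ˡ map (inside ∷_) (subsets r))
    disjoint (p , q) with ∈-map⁻ (outside ∷_) p | ∈-map⁻ (inside ∷_) q
    ... | _ , _ , refl | _ , _ , ()

  below? : ∀ {r} j (s e : Subset r) → Dec (∣ e ∣ ≡ j × e ⊆ s)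
  below? j s e = (∣ e ∣ ℕ.≟ j) ×-dec (e Sub.⊆? s)

  -- The faces of arity `j` inside `s`: a partition of level `j` acts on functions of the
  -- coordinates in `s` through its classes on these faces.
  below : ∀ {r} → ℕ → Subset r → List (Subset r)
  below {r} j s = filter (below? j s) (subsets r)

  ∈-below⁺ : ∀ {r j} {s e : Subset r} → ∣ e ∣ ≡ j → e ⊆ s → e ∈ˡ below j s
  ∈-below⁺ {j = j} {s} {e} p q = ∈-filter⁺ (below? j s) (∈-subsets e) (p , q)

  ∈-below⁻ : ∀ {r j} {s e : Subset r} → e ∈ˡ below j s → ∣ e ∣ ≡ j × e ⊆ s
  ∈-below⁻ {r} {j} {s} m = proj₂ (∈-filter⁻ (below? j s) {xs = subsets r} m)

  below-unique : ∀ {r} j (s : Subset r) → Unique (below j s)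
  below-unique {r} j s = Unique.filter⁺ (below? j s) (subsets-unique r)

  ⊆-extend : ∀ {r} (s e : Subset r) j → e ⊆ s → ∣ e ∣ ℕ.≤ j → j ℕ.≤ ∣ s ∣ →
             Σ (Subset r) λ e′ → e ⊆ e′ × e′ ⊆ s × ∣ e′ ∣ ≡ j
  ⊆-extend [] [] zero _ _ _ = [] , (λ ()) , (λ ()) , refl
  ⊆-extend (false ∷ s) (true ∷ e) j e⊆s _ _ with () ← e⊆s here
  ⊆-extend (false ∷ s) (false ∷ e) j e⊆s p q with ⊆-extend s e j (Sub.drop-∷-⊆ e⊆s) p q
  ... | e′ , a , b , c = false ∷ e′ , Sub.s⊆s a , Sub.s⊆s b , c
  ⊆-extend (true ∷ s) (true ∷ e) (suc j) e⊆s (ℕ.s≤s p) (ℕ.s≤s q) with ⊆-extend s e j (Sub.drop-∷-⊆ e⊆s) p q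
  ... | e′ , a , b , c = true ∷ e′ , Sub.s⊆s a , Sub.s⊆s b , cong suc c
  ⊆-extend (true ∷ s) (false ∷ e) j e⊆s p q with j ℕ.≤? ∣ s ∣
  ... | yes q′ with ⊆-extend s e j (Sub.drop-∷-⊆ e⊆s) p q′
  ...   | e′ , a , b , c = false ∷ e′ , Sub.s⊆s a , Sub.out⊆ b , c
  ⊆-extend (true ∷ s) (false ∷ e) j e⊆s p q | no ¬q′
    with refl ← ℕ.≤-antisym q (ℕ.≰⇒> ¬q′)
    with ⊆-extend s e ∣ s ∣ (Sub.drop-∷-⊆ e⊆s) (Sub.p⊆q⇒∣p∣≤∣q∣ (Sub.drop-∷-⊆ e⊆s)) ℕ.≤-refl
  ... | e′ , a , b , c = true ∷ e′ , Sub.out⊆ a , Sub.s⊆s b , cong suc c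

  ∩-shrinks : ∀ {r} (e s : Subset r) → ¬ (e ⊆ s) → ∣ e ∩ s ∣ ℕ.< ∣ e ∣
  ∩-shrinks [] [] e⊈s = ⊥-elim (e⊈s (λ ()))
  ∩-shrinks (true ∷ e) (true ∷ s) e⊈s = ℕ.s≤s (∩-shrinks e s (λ h → e⊈s (Sub.s⊆s h)))
  ∩-shrinks (true ∷ e) (false ∷ s) e⊈s = ℕ.s≤s (Sub.∣p∩q∣≤∣p∣ e s)
  ∩-shrinks (false ∷ e) (_ ∷ s) e⊈s = ∩-shrinks e s (λ h → e⊈s (Sub.out⊆ h))

  ⊆∧∣≡∣⇒≡ : ∀ {r} {e s : Subset r} → e ⊆ s → ∣ e ∣ ≡ ∣ s ∣ → e ≡ s
  ⊆∧∣≡∣⇒≡ {e = []} {[]} _ _ = refl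
  ⊆∧∣≡∣⇒≡ {e = true ∷ e} {true ∷ s} p q = cong (true ∷_) (⊆∧∣≡∣⇒≡ (Sub.drop-∷-⊆ p) (ℕ.suc-injective q))
  ⊆∧∣≡∣⇒≡ {e = true ∷ e} {false ∷ s} p q with () ← p here
  ⊆∧∣≡∣⇒≡ {e = false ∷ e} {true ∷ s} p q = ⊥-elim (ℕ.<-irrefl q (ℕ.s≤s (Sub.p⊆q⇒∣p∣≤∣q∣ (Sub.drop-∷-⊆ p))))
  ⊆∧∣≡∣⇒≡ {e = false ∷ e} {false ∷ s} p q = cong (false ∷_) (⊆∧∣≡∣⇒≡ (Sub.drop-∷-⊆ p) q)

  _≟ˢ_ : ∀ {r} (e e′ : Subset r) → Dec (e ≡ e′)
  _≟ˢ_ = Vec.≡-dec Bool._≟_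

  -- Functions of the coordinates in s

  module _ {X : Set} where

    merge-⊆ : ∀ {r} (e s : Subset r) (x y : Vec X r) → e ⊆ s → merge e (merge s x y) x ≡ x
    merge-⊆ [] [] [] [] _ = refl
    merge-⊆ (true ∷ e) (true ∷ s) (a ∷ x) (b ∷ y) p = cong (a ∷_) (merge-⊆ e s x y (Sub.drop-∷-⊆ p))
    merge-⊆ (true ∷ e) (false ∷ s) x y p with () ← p here
    merge-⊆ (false ∷ e) (true ∷ s) (a ∷ x) (b ∷ y) p = cong (a ∷_) (merge-⊆ e s x y (Sub.drop-∷-⊆ p))
    merge-⊆ (false ∷ e) (false ∷ s) (a ∷ x) (b ∷ y) p = cong (a ∷_) (merge-⊆ e s x y (Sub.drop-∷-⊆ p))

    merge-∩ : ∀ {r} (e s : Subset r) (x y z : Vec X r) →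
              merge e (merge s (merge (e ∩ s) x z) y) (merge s x y) ≡ merge s x y
    merge-∩ [] [] [] [] [] = refl
    merge-∩ (true ∷ e) (true ∷ s) (a ∷ x) (b ∷ y) (c ∷ z) = cong (a ∷_) (merge-∩ e s x y z)
    merge-∩ (true ∷ e) (false ∷ s) (a ∷ x) (b ∷ y) (c ∷ z) = cong (b ∷_) (merge-∩ e s x y z)
    merge-∩ (false ∷ e) (true ∷ s) (a ∷ x) (b ∷ y) (c ∷ z) = cong (a ∷_) (merge-∩ e s x y z)
    merge-∩ (false ∷ e) (false ∷ s) (a ∷ x) (b ∷ y) (c ∷ z) = cong (b ∷_) (merge-∩ e s x y z)

    -- Measurability in the coordinates of `s`: as `y` varies, `merge s x y` runs over all tuples
    -- that agree with `x` on `s`.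
    Dep : ∀ {A : Set} {r} → Subset r → (Vec X r → A) → Set
    Dep s f = ∀ x y → f (merge s x y) ≡ f x

    Dep-⊆ : ∀ {A : Set} {r} {e s : Subset r} {f : Vec X r → A} → e ⊆ s → Dep e f → Dep s f
    Dep-⊆ {e = e} {s} {f} p d x y = trans (sym (d (merge s x y) x)) (cong f (merge-⊆ e s x y p))

    -- Freezing the coordinates outside `s` lowers the arity from `e` to its intersection with `s`.
    -- This is why a function on one face is a lower-order object when seen from another face.
    Dep-slice : ∀ {A : Set} {r} {e : Subset r} (s : Subset r) {f : Vec X r → A} (y : Vec X r) → Dep e f →
                Dep (e ∩ s) (λ x → f (merge s x y))
    Dep-slice {e = e} s {f} y d x z = trans (sym (d _ (merge s x y))) (cong f (merge-∩ e s x y z))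

    Dep-all : ∀ {I : Set} {r} {s : Subset r} (p : I → Vec X r → Bool) is → (∀ i → Dep s (p i)) → Dep s (λ x → all (λ i → p i x) is)
    Dep-all p is d x y = all-cong is (λ i → d i x y)

  -- Partition systems and uniformity

  sumUpTo : ℕ → (ℕ → ℕ) → ℕ
  sumUpTo zero    f = f 0
  sumUpTo (suc t) f = f (suc t) ℕ.+ sumUpTo t f

  sumUpTo-term : ∀ t f {a} → a ℕ.≤ t → f a ℕ.≤ sumUpTo t f
  sumUpTo-term zero    f ℕ.z≤n = ℕ.≤-refl
  sumUpTo-term (suc t) f {a} p with a ℕ.≟ suc t
  ... | yes refl = ℕ.m≤m+n _ _
  ... | no a≢ = ℕ.≤-trans (sumUpTo-term t f (ℕ.≤-pred (ℕ.≤∧≢⇒< p a≢))) (ℕ.m≤n+m _ _)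

  doublings : ℕ → ℕ → ℕ
  doublings m zero    = m
  doublings m (suc a) = doublings m a ℕ.* 2

  -- A failure of uniformity at 1/(1+ε) raises the energy by the square of that number. After (1+ε)²
  -- + 1 such increments the energy has grown by more than 1, hence by more than any allowed gap
  -- 1/(1+g).
  steps : ℕ → ℕ
  steps ε = suc (suc ε ℕ.* suc ε)

  -- Bounds C (m₀) over all complexities m₀ that the coarse partition of the regularity lemma can reach.
  regBound : (ε C : ℕ → ℕ) → ℕ → ℕ → ℕ
  regBound ε C zero    m = C m
  regBound ε C (suc u) m = C m ℕ.+ sumUpTo (steps (ε m)) (λ a → regBound ε C u (doublings m a))

  C≤regBound : ∀ ε C u m → C m ℕ.≤ regBound ε C u m
  C≤regBound ε C zero    m = ℕ.≤-refl
  C≤regBound ε C (suc u) m = ℕ.m≤m+n _ _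

  opaque
    unfolding ℚring

    diff-bound : ∀ E₀ E u γ N → E + u * γ - N ≡ (E₀ + (1ℚ + u) * γ - N) + (E - E₀ - γ)
    diff-bound = solve-∀ ℚring

    step-bound : ∀ E₀ E E′ a e → E′ - (E₀ + (1ℚ + a) * e) ≡ (E - (E₀ + a * e)) + (E′ - E - e)
    step-bound = solve-∀ ℚring

    steps-pos : ∀ E₀ E γ a e → γ < a * e → E₀ + a * e ≤ E → E - E₀ ≤ γ → ⊥
    steps-pos E₀ E γ a e p q s = ℚ.<-irrefl refl (ℚ.<-≤-trans p (ℚ.≤-trans (≤-by (E - (E₀ + a * e)) (lem E₀ E (a * e)) (≤⇒0≤ q)) s))
      where
      lem : ∀ E₀ E x → E - E₀ ≡ x + (E - (E₀ + x))
      lem = solve-∀ ℚring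

    two-sq : ∀ s i → s * i ≡ 1ℚ → (1ℚ + s * s) * (i * i) ≡ i * i + 1ℚ
    two-sq s i p = trans (lem s i) (cong (λ z → i * i + z * z) p)
      where
      lem : ∀ s i → (1ℚ + s * s) * (i * i) ≡ i * i + (s * i) * (s * i)
      lem = solve-∀ ℚring

  -- Small parameters are naturals `a` that stand for 1/(1+a), so that all constants are explicit
  -- natural numbers and no value is excluded.
  recip : ℕ → ℚ
  recip a = inv (ι (suc a))

  recip* : ∀ a → ι (suc a) * recip a ≡ 1ℚ
  recip* a = *-inv (0<ι a)

  0≤recip : ∀ a → 0ℚ ≤ recip a
  0≤recip a = 0≤inv (0<ι a)

  0<recip : ∀ a → 0ℚ < recip a
  0<recip a with 0ℚ ℚ.<? recip a
  ... | yes p = p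
  ... | no ¬p = ⊥-elim (ℚ.<-irrefl refl (subst (0ℚ <_) (trans (sym (recip* a))
                   (trans (cong (ι (suc a) *_) (ℚ.≤-antisym (ℚ.≮⇒≥ ¬p) (0≤recip a))) (*-zeroʳ (ι (suc a))))) 0<1))

  recip≤1 : ∀ a → recip a ≤ 1ℚ
  recip≤1 a = *-cancelˡ (ι (suc a)) (0<ι a) (subst₂ _≤_ (sym (recip* a)) (sym (*-identityʳ _)) (1≤ι {suc a} (ℕ.s≤s ℕ.z≤n)))

  steps-enough : ∀ g ε → recip g < ι (steps ε) * (recip ε * recip ε)
  steps-enough g ε = ℚ.≤-<-trans (recip≤1 g) (subst (1ℚ <_)
    (sym (trans (cong (_* (recip ε * recip ε)) (trans (ι-suc (suc ε ℕ.* suc ε)) (cong (1ℚ +_) (ι-* (suc ε) (suc ε))))) (two-sq (ι (suc ε)) (recip ε) (recip* ε))))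
    (subst (_< recip ε * recip ε + 1ℚ) (+-identityˡ 1ℚ) (+-monoˡ-< 1ℚ (0<* (0<recip ε) (0<recip ε)))))

  module Partitions (n r : ℕ) where
    open Average n
    open Cond using (P; P-inv; P-0≤; P-≤1; P-adjoint; E-P)

    -- A partition into `m` classes for every set of coordinates at once. A system is not tied to a
    -- level or to a face: `q b j s` selects the classes on the `j`-subsets of `s`, and one
    -- refinement serves all `s`.
    record Sys (m : ℕ) : Set where
      field
        class : Subset r → V r → Fin m
        dep   : ∀ e → Dep e (class e)
    open Sys public

    code : ∀ {m} (b : Sys m) (es : List (Subset r)) → V r → Fin (m ^ length es)
    code b []       x = zero
    code b (e ∷ es) x = combine (class b e x) (code b es x)

    code⁻ : ∀ {m} (b : Sys m) es {x y} → code b es x ≡ code b es y → ∀ {e} → e ∈ˡ es → class b e x ≡ class b e y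
    code⁻ b (e ∷ es) {x} {y} p (here refl) = Fin.combine-injectiveˡ (class b e x) (code b es x) (class b e y) (code b es y) p
    code⁻ b (e ∷ es) {x} {y} p (there m) =
      code⁻ b es (Fin.combine-injectiveʳ (class b e x) (code b es x) (class b e y) (code b es y) p) m

    code⁺ : ∀ {m} (b : Sys m) es {x y} → (∀ {e} → e ∈ˡ es → class b e x ≡ class b e y) → code b es x ≡ code b es y
    code⁺ b []       h = refl
    code⁺ b (e ∷ es) h = cong₂ combine (h (here refl)) (code⁺ b es (λ m → h (there m)))

    q : ∀ {m} (b : Sys m) (j : ℕ) (s : Subset r) → V r → Fin (m ^ length (below j s))
    q b j s = code b (below j s)

    q-⊆ : ∀ {m} (b : Sys m) j {s s′} → s ⊆ s′ → ∀ {x y} → q b j s′ x ≡ q b j s′ y → q b j s x ≡ q b j s y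
    q-⊆ b j {s} {s′} p eq = code⁺ b (below j s) (λ m → let (c , d) = ∈-below⁻ m in
      code⁻ b (below j s′) eq (∈-below⁺ c (Sub.⊆-trans d p)))

    q-dep : ∀ {m} (b : Sys m) j s → Dep s (q b j s)
    q-dep b j s x y = code⁺ b (below j s) (λ {e} m → Dep-⊆ (proj₂ (∈-below⁻ m)) (dep b e) x y)

    Finer : ∀ {m m′} → Sys m → Sys m′ → Set
    Finer b b′ = ∀ e {x y} → class b′ e x ≡ class b′ e y → class b e x ≡ class b e y

    q-finer : ∀ {m m′} {b : Sys m} {b′ : Sys m′} → Finer b b′ → ∀ j s {x y} → q b′ j s x ≡ q b′ j s y → q b j s x ≡ q b j s y
    q-finer {b = b} {b′} f j s eq = code⁺ b (below j s) (λ {e} m → f e (code⁻ b′ (below j s) eq m))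

    Pr : ∀ {m} → Sys m → ℕ → Subset r → (V r → Bool) → V r → ℚ
    Pr b j s f = P (q b j s) (λ x → ⟦ f x ⟧)

    Pr-inv : ∀ {m} (b : Sys m) j s f {x y} → q b j s x ≡ q b j s y → Pr b j s f x ≡ Pr b j s f y
    Pr-inv b j s f = P-inv (q b j s) (λ x → ⟦ f x ⟧)

    Pr-dep : ∀ {m} (b : Sys m) j s f → Dep s (Pr b j s f)
    Pr-dep b j s f x y = Pr-inv b j s f (q-dep b j s x y)

    0≤Pr : ∀ {m} (b : Sys m) j s f x → 0ℚ ≤ Pr b j s f x
    0≤Pr b j s f = P-0≤ (q b j s) (λ x → 0≤⟦⟧ (f x))

    Pr≤1 : ∀ {m} (b : Sys m) j s f x → Pr b j s f x ≤ 1ℚ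
    Pr≤1 b j s f = P-≤1 (q b j s) (λ x → ⟦⟧≤1 (f x))

    Test : Set
    Test = Σ (Subset r → V r → Bool) λ h → ∀ e → Dep e (h e)

    test : ℕ → Subset r → Test → V r → Bool
    test j s (h , _) x = all (λ e → h e x) (below j s)

    correlation : ∀ {m} → Sys m → ℕ → Subset r → (V r → Bool) → (V r → Bool) → ℚ
    correlation b j s f g = E (λ x → (⟦ f x ⟧ - Pr b j s f x) * ⟦ g x ⟧)

    -- The tests are cylinder intersections, that is, conjunctions of sets depending on `j`
    -- coordinates each; this is cut-norm regularity relative to the partition. Squares replace
    -- absolute values.
    Uniform : ∀ {m} → Sys m → ℕ → Subset r → (V r → Bool) → ℚ → Set
    Uniform b j s f ε = ∀ h → let a = correlation b j s f (test j s h) in a * a ≤ ε * ε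

    bit : Bool → Fin 2
    bit true  = zero
    bit false = suc zero

    bit-injective : ∀ {a b} → bit a ≡ bit b → a ≡ b
    bit-injective {true}  {true}  _ = refl
    bit-injective {false} {false} _ = refl

    refine : ∀ {m} → Sys m → Test → Sys (m ℕ.* 2)
    refine b (h , d) = record
      { class = λ e x → combine (class b e x) (bit (h e x))
      ; dep   = λ e x y → cong₂ (λ u v → combine u (bit v)) (dep b e x y) (d e x y) }

    refine-finer : ∀ {m} (b : Sys m) h → Finer b (refine b h)
    refine-finer b (h , _) e {x} {y} = Fin.combine-injectiveˡ (class b e x) (bit (h e x)) (class b e y) (bit (h e y))

    refine-test : ∀ {m} (b : Sys m) j s h {x y} → q (refine b h) j s x ≡ q (refine b h) j s y → test j s h x ≡ test j s h y
    refine-test b j s (h , d) {x} {y} eq = bool-ext (half eq) (half (sym eq))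
      where
      half : ∀ {x y} → q (refine b (h , d)) j s x ≡ q (refine b (h , d)) j s y → test j s (h , d) x ≡ true → test j s (h , d) y ≡ true
      half {x} {y} eq p = all⁺ (λ e → h e y) (below j s) (λ {e} m → trans (sym (bit-injective
        (Fin.combine-injectiveʳ (class b e x) (bit (h e x)) (class b e y) (bit (h e y)) (code⁻ (refine b (h , d)) (below j s) eq m))))
        (all⁻ (λ e → h e x) (below j s) p m))

    -- Regularity lemma

    module Regularity (j N g : ℕ) (s : Fin N → Subset r) (f : Fin N → V r → Bool) (ε C : ℕ → ℕ) where

      γ : ℚ
      γ = recip g

      energyAt : ∀ {m} → Sys m → Fin N → ℚ
      energyAt b k = E (λ x → Pr b j (s k) (f k) x * Pr b j (s k) (f k) x)

      energy : ∀ {m} → Sys m → ℚ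
      energy b = sumF (energyAt b)

      energy≤N : ∀ {m} (b : Sys m) → energy b ≤ ι N
      energy≤N b = subst (energy b ≤_) (trans (sumF-const {N} 1ℚ) (*-identityʳ (ι N)))
        (sumF-mono (λ k → E-≤ (λ x → subst (Pr b j (s k) (f k) x * Pr b j (s k) (f k) x ≤_) (*-identityʳ 1ℚ)
          (*-mono (0≤Pr b j (s k) (f k) x) 0≤1 (Pr≤1 b j (s k) (f k) x) (Pr≤1 b j (s k) (f k) x)))))

      gap : ∀ {m m′} → Sys m → Sys m′ → Fin N → ℚ
      gap b b′ k = E (λ x → (Pr b′ j (s k) (f k) x - Pr b j (s k) (f k) x) * (Pr b′ j (s k) (f k) x - Pr b j (s k) (f k) x))

      module _ {m m′} {b : Sys m} {b′ : Sys m′} (finer : Finer b b′) where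

        gap≡ : ∀ k → gap b b′ k ≡ energyAt b′ k - energyAt b k
        gap≡ k = pythagoras (q b j (s k)) (q b′ j (s k)) (q-finer {b = b} {b′} finer j (s k)) (λ x → ⟦ f k x ⟧)

        0≤gap : ∀ k → 0ℚ ≤ energyAt b′ k - energyAt b k
        0≤gap k = subst (0ℚ ≤_) (gap≡ k) (E-0≤ (λ x → 0≤sq _))

        gap≤ : ∀ k → energyAt b′ k - energyAt b k ≤ energy b′ - energy b
        gap≤ k = subst (energyAt b′ k - energyAt b k ≤_) (sumF-- (energyAt b′) (energyAt b))
          (sumF-term {f = λ k → energyAt b′ k - energyAt b k} 0≤gap k)

      -- The regularity lemma in continuation form. The bound `B` on `C m₀` is fixed before the pair
      -- of partitions, and hence `m₀`, is known.
      Conclusion : ℕ → Set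
      Conclusion B = ∀ {m₀ m₁} (b₀ : Sys m₀) (b₁ : Sys m₁) → Finer b₀ b₁ → C m₀ ℕ.≤ B →
        (∀ k → gap b₀ b₁ k ≤ γ) → (∀ k → Uniform b₁ j (s k) (f k) (recip (ε m₀))) → ⊥

      -- `u` counts how often the coarse partition may still be replaced. A replacement raises the
      -- energy by more than `γ` and the energy never exceeds `N`, so the inequality persists with
      -- `u` lowered by one and is absurd at `u = 0`.
      regularise : ∀ u m (b₀ : Sys m) → ι N < energy b₀ + ι u * γ → Conclusion (regBound ε C u m) → ⊥

      -- `a` refinements have been made over the coarse partition and `t` remain. If the fine energy
      -- is ahead by more than `γ`, the fine partition becomes the new coarse one; otherwise the
      -- pair goes to the continuation, and any test refuting uniformity refines the fine partition
      -- further.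
      inner : ∀ u m (b₀ : Sys m) → ι N < energy b₀ + ι (suc u) * γ → Conclusion (regBound ε C (suc u) m) →
        ∀ a t → a ℕ.+ t ≡ steps (ε m) → (b : Sys (doublings m a)) → Finer b₀ b →
        energy b₀ + ι a * (recip (ε m) * recip (ε m)) ≤ energy b → ⊥
      inner u m b₀ big k a t a+t b finer grow with energy b - energy b₀ ℚ.≤? γ
      ... | no ¬p = regularise u (doublings m a) b
        (0<⇒< (subst (0ℚ <_) (trans (cong (λ z → energy b₀ + z * γ - ι N + (energy b - energy b₀ - γ)) (ι-suc u)) (sym (diff-bound (energy b₀) (energy b) (ι u) γ (ι N))))
          (0<+ (<⇒0< big) (ℚ.<⇒≤ (<⇒0< (ℚ.≰⇒> ¬p))))))
        (λ b₀′ b₁ fi c → k b₀′ b₁ fi (ℕ.≤-trans c (ℕ.≤-trans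
          (sumUpTo-term (steps (ε m)) (λ a → regBound ε C u (doublings m a)) (subst (a ℕ.≤_) a+t (ℕ.m≤m+n a t)))
          (ℕ.m≤n+m _ (C m)))))
      inner u m b₀ big k a zero a+t b finer grow | yes p =
        steps-pos (energy b₀) (energy b) γ (ι a) _ (subst (λ a → γ < ι a * (recip (ε m) * recip (ε m))) (trans (sym a+t) (ℕ.+-identityʳ a)) (steps-enough g (ε m))) grow p
      inner u m b₀ big k a (suc t) a+t b finer grow | yes p =
        k b₀ b finer (C≤regBound ε C (suc u) m)
          (λ i → subst (_≤ γ) (sym (gap≡ {b = b₀} {b} finer i)) (ℚ.≤-trans (gap≤ {b = b₀} {b} finer i) p)) uniform
        where
        uniform : ∀ i → Uniform b j (s i) (f i) (recip (ε m))
        -- Only the test that the continuation supplies is examined. If it fails, refining by it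
        -- restarts the recursion, which ends in a contradiction.
        uniform i h with correlation b j (s i) (f i) (test j (s i) h) * correlation b j (s i) (f i) (test j (s i) h) ℚ.≤? recip (ε m) * recip (ε m)
        ... | yes small = small
        ... | no ¬small = ⊥-elim (inner u m b₀ big k (suc a) t (trans (sym (ℕ.+-suc a t)) a+t) (refine b h)
                (λ e eq → finer e (refine-finer b h e eq))
                (0≤⇒≤ (subst (0ℚ ≤_) (trans (sym (step-bound (energy b₀) (energy b) (energy (refine b h)) (ι a) _)) (cong (λ z → energy (refine b h) - (energy b₀ + z * _)) (sym (ι-suc a))))
                  (0≤+ (≤⇒0≤ grow) (≤⇒0≤ (ℚ.≤-trans (ℚ.<⇒≤ (ℚ.≰⇒> ¬small))
                    (ℚ.≤-trans (energy-increment (q b j (s i)) (q (refine b h) j (s i)) (q-finer {b = b} {refine b h} (refine-finer b h) j (s i))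
                      (λ x → ⟦ f i x ⟧) (test j (s i) h) (refine-test b j (s i) h))
                      (gap≤ {b = b} {refine b h} (refine-finer b h) i))))))))

      regularise zero m b₀ big k = ℚ.<-irrefl refl (ℚ.<-≤-trans big (subst (_≤ ι N) (sym (trans (cong (energy b₀ +_) (trans (cong (_* γ) ι-zero) (*-zeroˡ γ))) (+-identityʳ _))) (energy≤N b₀)))
      regularise (suc u) m b₀ big k = inner u m b₀ big k 0 (steps (ε m)) refl b₀ (λ e eq → eq)
        (ℚ.≤-reflexive (trans (cong (energy b₀ +_) (trans (cong (_* (recip (ε m) * recip (ε m))) ι-zero) (*-zeroˡ _))) (+-identityʳ _)))

  infix 4 _≤ᵇ_

  _≤ᵇ_ : ℚ → ℚ → Bool
  a ≤ᵇ b = ⌊ a ℚ.≤? b ⌋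

  ≤ᵇ⇒≤ : ∀ {a b} → (a ≤ᵇ b) ≡ true → a ≤ b
  ≤ᵇ⇒≤ {a} {b} p with a ℚ.≤? b
  ... | yes q = q

  ≤⇒≤ᵇ : ∀ {a b} → a ≤ b → (a ≤ᵇ b) ≡ true
  ≤⇒≤ᵇ {a} {b} p with a ℚ.≤? b
  ... | yes _ = refl
  ... | no ¬q = contradiction p ¬q

  ≰ᵇ⇒≥ : ∀ {a b} → not (a ≤ᵇ b) ≡ true → b ≤ a
  ≰ᵇ⇒≥ {a} {b} p with a ℚ.≤? b
  ... | no ¬q = ℚ.<⇒≤ (ℚ.≰⇒> ¬q)

  not⁻ : ∀ {b} → not b ≡ true → ¬ (b ≡ true)
  not⁻ {false} _ ()

  not⁺ : ∀ {b} → ¬ (b ≡ true) → not b ≡ true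
  not⁺ {false} _ = refl
  not⁺ {true}  h = ⊥-elim (h refl)

  ∧-not⁻ : ∀ {A : Set} (p : A → Bool) xs → not (all p xs) ≡ true → Σ A λ x → x ∈ˡ xs × not (p x) ≡ true
  ∧-not⁻ p (x ∷ xs) h with p x in eq
  ... | false = x , here refl , cong not eq
  ... | true with ∧-not⁻ p xs h
  ...   | y , m , e = y , there m , e

  co : ∀ {r} → Fin r → Subset r
  co i = ∁ ⁅ i ⁆

  ⊆-co : ∀ {r} {e : Subset r} {i} → i ∉ e → e ⊆ co i
  ⊆-co {i = i} i∉e x∈e = Sub.x∉p⇒x∈∁p (λ x∈ → i∉e (subst (_∈ _) (Sub.x∈⁅y⁆⇒x≡y i x∈) x∈e))

  ∣co∣ : ∀ {r} (i : Fin r) → ∣ co i ∣ ≡ r ℕ.∸ 1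
  ∣co∣ {r} i = trans (Sub.∣∁p∣≡n∸∣p∣ ⁅ i ⁆) (cong (r ℕ.∸_) (Sub.∣⁅x⁆∣≡1 i))

  missing : ∀ {r} (e : Subset r) → ∣ e ∣ ℕ.< r → Σ (Fin r) (_∉ e)
  missing (false ∷ e) _ = zero , λ ()
  missing (true ∷ e) (ℕ.s≤s p) with missing e p
  ... | i , i∉e = suc i , λ { (there q) → i∉e q }

  opaque
    unfolding ℚring

    sq-≤ : ∀ {a e} → 0ℚ ≤ e → a * a ≤ e * e → a ≤ e
    sq-≤ {a} {e} 0≤e p with a ℚ.≤? e
    ... | yes q = q
    ... | no ¬q = ⊥-elim (ℚ.<-irrefl refl (ℚ.<-≤-trans (0<⇒< (subst (0ℚ <_) (lem a e)
            (0<* {a - e} {a + e} (<⇒0< e<a) (0<+ {a} {e} (ℚ.≤-<-trans 0≤e e<a) 0≤e)))) p))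
      where
      e<a : e < a
      e<a = ℚ.≰⇒> ¬q
      lem : ∀ a e → (a - e) * (a + e) ≡ a * a - e * e
      lem = solve-∀ ℚring

    sq-≥ : ∀ {a e} → 0ℚ ≤ e → a * a ≤ e * e → - e ≤ a
    sq-≥ {a} {e} 0≤e p = 0≤⇒≤ (subst (0ℚ ≤_) (lem₂ a e) (≤⇒0≤ (sq-≤ { - a} {e} 0≤e (subst (_≤ e * e) (lem a) p))))
      where
      lem : ∀ a → a * a ≡ (- a) * (- a)
      lem = solve-∀ ℚring
      lem₂ : ∀ a e → e - (- a) ≡ a - (- e)
      lem₂ = solve-∀ ℚring

    add-swap : ∀ a b c → a + b + c ≡ a + (c + b)
    add-swap = solve-∀ ℚring

    ring-a : ∀ a b e → b + e ≡ a + (e - (a - b))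
    ring-a = solve-∀ ℚring

    ring-b : ∀ a b e → a + e ≡ b + ((a - b) - - e)
    ring-b = solve-∀ ℚring

    ring-c : ∀ m t x → m * (t * x) ≡ (t * m) * x
    ring-c = solve-∀ ℚring

    ring-d : ∀ a b c → a + (b + c) ≡ b + a + c
    ring-d = solve-∀ ℚring

    suc*-expand : ∀ k c → (1ℚ + k) * c ≡ c + k * c
    suc*-expand = solve-∀ ℚring

  scale-≤ : ∀ {a k z y} → suc z ℕ.* k ℕ.≤ a → 0ℚ ≤ y → ι a * y ≤ 1ℚ → ι k * y ≤ recip z
  scale-≤ {a} {k} {z} {y} p 0≤y q = *-cancelˡ (ι (suc z)) (0<ι z) (subst₂ _≤_ (trans (cong (_* y) (ι-* (suc z) k)) (*-assoc _ _ _)) (sym (recip* z))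
    (ℚ.≤-trans (*-monoʳ y 0≤y (ι-mono p)) q))

  -- Counting with conjunctions of functions of few coordinates

  module Factors (n r : ℕ) where
    open Average n
    open Cond using (P; P-inv; P-0≤; P-≤1; P-adjoint; E-P)
    open Partitions n r

    record Factor : Set where
      constructor factor
      field
        set  : Subset r
        fun  : V r → Bool
        fdep : Dep set fun
    open Factor public

    conj : List Factor → V r → Bool
    conj Fs x = all (λ F → fun F x) Fs

    module _ (j : ℕ) (s : Subset r) (j≤s : j ℕ.≤ ∣ s ∣) where

      -- Each factor is assigned one face of size `j` that carries its trace on `s`, so that a
      -- conjunction of factors can be grouped by faces into a single test. The fallback `set F`
      -- keeps `place-⊇` valid for every factor, so measurability of the test needs no size bound.
      place : Factor → Subset r
      place F with ∣ set F ∩ s ∣ ℕ.≤? j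
      ... | yes p = proj₁ (⊆-extend s (set F ∩ s) j (Sub.p∩q⊆q (set F) s) p j≤s)
      ... | no _  = set F

      place-⊇ : ∀ F → set F ∩ s ⊆ place F
      place-⊇ F with ∣ set F ∩ s ∣ ℕ.≤? j
      ... | yes p = proj₁ (proj₂ (⊆-extend s (set F ∩ s) j (Sub.p∩q⊆q (set F) s) p j≤s))
      ... | no _  = Sub.p∩q⊆p (set F) s

      place-∈ : ∀ F → ∣ set F ∩ s ∣ ℕ.≤ j → place F ∈ˡ below j s
      place-∈ F h with ∣ set F ∩ s ∣ ℕ.≤? j
      ... | no ¬p = contradiction h ¬p
      ... | yes p with ⊆-extend s (set F ∩ s) j (Sub.p∩q⊆q (set F) s) p j≤s
      ...   | e , _ , b , c = ∈-below⁺ c b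

      module _ (Fs : List Factor) (y : V r) where

        item : Subset r → Factor → V r → Bool
        item e F x = if ⌊ place F ≟ˢ e ⌋ then fun F (merge s x y) else true

        item-dep : ∀ e F → Dep e (item e F)
        item-dep e F x z with place F ≟ˢ e
        ... | yes refl = Dep-⊆ (place-⊇ F) (Dep-slice s y (fdep F)) x z
        ... | no _     = refl

        sliceTest : Test
        sliceTest = (λ e x → all (λ F → item e F x) Fs) , λ e → Dep-all (item e) Fs (item-dep e)

        sliceTest≡ : (∀ {F} → F ∈ˡ Fs → ∣ set F ∩ s ∣ ℕ.≤ j) → ∀ x → test j s sliceTest x ≡ conj Fs (merge s x y)
        sliceTest≡ small x = bool-ext to from
          where
          to : test j s sliceTest x ≡ true → conj Fs (merge s x y) ≡ true
          to h = all⁺ (λ F → fun F (merge s x y)) Fs (λ {F} m → unpack F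
            (all⁻ (λ F′ → item (place F) F′ x) Fs (all⁻ (λ e → all (λ F′ → item e F′ x) Fs) (below j s) h (place-∈ F (small m))) m))
            where
            unpack : ∀ F → item (place F) F x ≡ true → fun F (merge s x y) ≡ true
            unpack F p with place F ≟ˢ place F
            ... | yes _ = p
            ... | no ¬p = contradiction refl ¬p
          from : conj Fs (merge s x y) ≡ true → test j s sliceTest x ≡ true
          from h = all⁺ (λ e → all (λ F → item e F x) Fs) (below j s) (λ {e} _ → all⁺ (λ F → item e F x) Fs (λ {F} m → pack e F (all⁻ (λ F → fun F (merge s x y)) Fs h m)))
            where
            pack : ∀ e F → fun F (merge s x y) ≡ true → item e F x ≡ true
            pack e F p with place F ≟ˢ e
            ... | yes _ = p
            ... | no _  = refl

      -- Fixing the coordinates outside s turns a conjunction of factors into a test on s.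
      module _ {m : ℕ} (b : Sys m) (f : V r → Bool) (fd : Dep s f) (ε : ℚ) (0≤ε : 0ℚ ≤ ε) (uni : Uniform b j s f ε)
               (Fs : List Factor) (small : ∀ {F} → F ∈ˡ Fs → ∣ set F ∩ s ∣ ℕ.≤ j) where

        correlation-slices : correlation b j s f (conj Fs) ≡ E (λ y → correlation b j s f (test j s (sliceTest Fs y)))
        correlation-slices = trans (E-merge s _) (E-cong (λ y → E-cong (λ x →
          cong₂ _*_ (cong₂ _-_ (cong ⟦_⟧ (fd x y)) (Pr-dep b j s f x y)) (cong ⟦_⟧ (sym (sliceTest≡ Fs y small x))))))

        correlation≤ : correlation b j s f (conj Fs) ≤ ε
        correlation≤ = subst (_≤ ε) (sym correlation-slices) (E-≤ (λ y → sq-≤ 0≤ε (uni (sliceTest Fs y))))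

        -ε≤correlation : - ε ≤ correlation b j s f (conj Fs)
        -ε≤correlation = subst₂ _≤_ (E-const {r} (- ε)) (sym correlation-slices) (E-mono (λ y → sq-≥ 0≤ε (uni (sliceTest Fs y))))

        correlation-split : correlation b j s f (conj Fs) ≡ E (λ x → ⟦ f x ∧ conj Fs x ⟧) - E (λ x → Pr b j s f x * ⟦ conj Fs x ⟧)
        correlation-split = trans (E-cong (λ x → trans (*-distribʳ-sub ⟦ f x ⟧ (Pr b j s f x) ⟦ conj Fs x ⟧)
          (cong (_- (Pr b j s f x * ⟦ conj Fs x ⟧)) (sym (⟦∧⟧ (f x) (conj Fs x)))))) (E-- _ _)

        -- With `replace-≥` this is the counting lemma for one factor. The error is additive, so `ε`
        -- must be small compared with the measure of the conjunction and not merely with 1.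
        replace-≤ : E (λ x → ⟦ f x ∧ conj Fs x ⟧) ≤ E (λ x → Pr b j s f x * ⟦ conj Fs x ⟧) + ε
        replace-≤ = ≤-by (ε - correlation b j s f (conj Fs)) (trans (ring-a _ _ ε) (cong (λ z → μ (λ x → f x ∧ conj Fs x) + (ε - z)) (sym correlation-split)))
          (≤⇒0≤ correlation≤)

        replace-≥ : E (λ x → Pr b j s f x * ⟦ conj Fs x ⟧) ≤ E (λ x → ⟦ f x ∧ conj Fs x ⟧) + ε
        replace-≥ = ≤-by (correlation b j s f (conj Fs) - - ε) (trans (ring-b _ _ ε) (cong (λ z → E (λ x → Pr b j s f x * ⟦ conj Fs x ⟧) + (z - - ε)) (sym correlation-split)))
          (≤⇒0≤ -ε≤correlation)

    -- The bad event `W β` is a union of fibres, so on it the indicator of the cell `β` may be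
    -- exchanged for its conditional density, which is small there by assumption. Summing over the
    -- cells bounds the points whose own cell is bad.
    cell-markov : ∀ {m M} (b : Sys m) j s (κ : V r → Fin M) (W : Fin M → V r → Bool) (U : Fin M → V r → ℚ) →
      (∀ β {x y} → q b j s x ≡ q b j s y → W β x ≡ W β y) →
      (∀ β x → Pr b j s (λ y → κ y ≡ᵇ β) x * ⟦ W β x ⟧ ≤ U β x) →
      μ (λ x → W (κ x) x) ≤ sumF (λ β → E (U β))
    cell-markov b j s κ W U W-inv bound = subst (_≤ sumF (λ β → E (U β))) (sym expand) (sumF-mono (λ β → E-mono (bound β)))
      where
      expand : μ (λ x → W (κ x) x) ≡ sumF (λ β → E (λ x → Pr b j s (λ y → κ y ≡ᵇ β) x * ⟦ W β x ⟧))
      expand = trans (E-cong (λ x → sym (sumF-δ (κ x) (λ β → ⟦ W β x ⟧)))) (trans (E-sumF _)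
        (sumF-cong (λ β → sym (P-adjoint (q b j s) (λ x → ⟦ κ x ≡ᵇ β ⟧) (λ x → ⟦ W β x ⟧) (λ eq → cong ⟦_⟧ (W-inv β eq))))))

    cells-total : ∀ {M} (κ : V r → Fin M) (f : V r → ℚ) → sumF (λ β → E (λ x → ⟦ κ x ≡ᵇ β ⟧ * f x)) ≡ E f
    cells-total κ f = trans (sym (E-sumF _)) (E-cong (λ x → sumF-δ (κ x) (λ _ → f x)))

    -- If every cell had mass below 1/(2M′), summation would give M′ ≤ M. The strict `M < M′` makes
    -- this contradictory, although each cell is only bounded weakly.
    pigeonhole : ∀ {M M′} (κ : V r → Fin M) (f : V r → ℚ) → M ℕ.< M′ → 1ℚ ≤ ι 2 * E f →
      (∀ β → 1ℚ ≤ ι (2 ℕ.* M′) * E (λ x → ⟦ κ x ≡ᵇ β ⟧ * f x) → ⊥) → ⊥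
    pigeonhole {M} {M′} κ f M<M′ big none = ℕ.<-irrefl refl (ℕ.<-≤-trans M<M′ (ι-cancel (ℚ.≤-trans lower upper)))
      where
      lower : ι M′ ≤ ι (2 ℕ.* M′) * E f
      lower = subst₂ _≤_ (*-identityʳ (ι M′)) (trans (ring-c (ι M′) (ι 2) (E f)) (cong (_* E f) (sym (ι-* 2 M′)))) (*-monoˡ (ι M′) (0≤ι M′) big)
      each : ∀ β → ι (2 ℕ.* M′) * E (λ x → ⟦ κ x ≡ᵇ β ⟧ * f x) ≤ 1ℚ
      each β with 1ℚ ℚ.≤? ι (2 ℕ.* M′) * E (λ x → ⟦ κ x ≡ᵇ β ⟧ * f x)
      ... | yes p = ⊥-elim (none β p)
      ... | no ¬p = ℚ.<⇒≤ (ℚ.≰⇒> ¬p)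
      upper : ι (2 ℕ.* M′) * E f ≤ ι M
      upper = subst₂ _≤_ (trans (sumF-* _ _) (cong (ι (2 ℕ.* M′) *_) (cells-total κ f))) (trans (sumF-const {M} 1ℚ) (*-identityʳ (ι M))) (sumF-mono each)

    discard : (ν : V r → ℚ) (c : ℚ) (A : V r → Bool) (Bs : List (V r → Bool)) → (∀ x → 0ℚ ≤ ν x) →
      (∀ {B} → B ∈ˡ Bs → E (λ x → ν x * ⟦ B x ⟧) ≤ c) →
      E (λ x → ν x * ⟦ A x ⟧) ≤ E (λ x → ν x * ⟦ A x ∧ all (λ B → not (B x)) Bs ⟧) + ι (length Bs) * c
    discard ν c A [] 0≤ν h = ℚ.≤-reflexive (trans (E-cong (λ x → cong (λ b → ν x * ⟦ b ⟧) (sym (Bool.∧-identityʳ (A x))))) (sym (trans (cong (_ +_) (trans (cong (_* c) ι-zero) (*-zeroˡ c))) (+-identityʳ _))))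
    discard ν c A (B ∷ Bs) 0≤ν h = ℚ.≤-trans (discard ν c A Bs 0≤ν (λ m → h (there m)))
      (≤≡ (≡≤ (+-comm _ _) (≤≡ (+-monoʳ (ι (length Bs) * c) one) (ring-d _ _ _)))
        (trans (add-swap _ (ι (length Bs) * c) c) (cong (E (λ x → ν x * ⟦ A x ∧ all (λ B → not (B x)) (B ∷ Bs) ⟧) +_) (sym (trans (cong (_* c) (ι-suc (length Bs))) (suc*-expand (ι (length Bs)) c))))))
      where
      one : E (λ x → ν x * ⟦ A x ∧ all (λ B → not (B x)) Bs ⟧) ≤ E (λ x → ν x * ⟦ A x ∧ all (λ B → not (B x)) (B ∷ Bs) ⟧) + c
      one = ℚ.≤-trans (subst (E (λ x → ν x * ⟦ A x ∧ all (λ B → not (B x)) Bs ⟧) ≤_) (E-+ _ _) (E-mono (λ x →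
          subst (ν x * ⟦ A x ∧ all (λ B → not (B x)) Bs ⟧ ≤_) (*-distribˡ-+ (ν x) _ _) (*-monoˡ (ν x) (0≤ν x) (pt (A x) (B x) (all (λ B → not (B x)) Bs))))))
        (+-monoʳ _ (h (here refl)))
        where
        pt : ∀ a b c → ⟦ a ∧ c ⟧ ≤ ⟦ a ∧ (not b ∧ c) ⟧ + ⟦ b ⟧
        pt false b c = subst (0ℚ ≤_) (sym (+-identityˡ ⟦ b ⟧)) (0≤⟦⟧ b)
        pt true false c = ℚ.≤-reflexive (sym (+-identityʳ ⟦ c ⟧))
        pt true true c = subst (⟦ c ⟧ ≤_) (sym (+-identityˡ 1ℚ)) (⟦⟧≤1 c)

    union-bound : (A : V r → Bool) (T : Fin r → V r → Bool) →
      μ (λ x → A x ∧ not (all (λ i → T i x) (allFin r))) ≤ sumF (λ i → μ (λ x → A x ∧ not (T i x)))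
    union-bound A T = ≤≡ (E-mono pt) (E-sumF _)
      where
      pt : ∀ x → ⟦ A x ∧ not (all (λ i → T i x) (allFin r)) ⟧ ≤ sumF (λ i → ⟦ A x ∧ not (T i x) ⟧)
      pt x with A x
      ... | false = sumF-0≤ (λ i → ℚ.≤-refl)
      ... | true with not (all (λ i → T i x) (allFin r)) in eq
      ...   | false = sumF-0≤ (λ i → 0≤⟦⟧ (not (T i x)))
      ...   | true with ∧-not⁻ (λ i → T i x) (allFin r) eq
      ...     | i , _ , e = subst (_≤ _) (cong ⟦_⟧ e) (sumF-term {f = λ i → ⟦ not (T i x) ⟧} (λ i → 0≤⟦⟧ (not (T i x))) i)

  -- Numerical inequalities of the inductive step

  two : ℚ
  two = 1ℚ + 1ℚ

  four : ℚ
  four = two * two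

  opaque
    unfolding ℚring

    -- These identities are certificates: each writes a difference to be bounded below as a
    -- combination of the differences in the hypotheses with nonnegative coefficients.
    final₁-ring : ∀ θ D c X Y B ε → θ * (two * D * X - Y) ≡
      two * θ * (D * (X + c * ε) + B - Y) + (two * D * c * (Y - θ * ε) + (two * (Y - θ * B) + (θ - two * (D * c + 1ℚ)) * Y))
    final₁-ring = solve-∀ ℚring

    final₂-ring : ∀ θ′ θ₁ θ r D X Y B ε Q → two * θ′ * θ₁ * (X - θ * Q) ≡
      two * θ′ * θ * (r * (X + ε + θ₁ * (B + ε)) - θ₁ * Q)
      + (θ′ * X * (θ₁ - two * (r * θ))
      + (two * θ * r * ((Y - θ′ * ε) * (1ℚ + θ₁) + (Y - θ′ * B) * θ₁)
      + (two * θ * r * (1ℚ + two * θ₁) * (two * D * X - Y)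
      + (X * θ₁ * (θ′ - (four + four + four) * (θ * (r * D)))
      + four * θ * r * D * X * (θ₁ - 1ℚ)))))
    final₂-ring = solve-∀ ℚring

    cheb₁-ring : ∀ Δ θ a c → four * two * (Δ * Δ) * (θ * θ) * (a * a + c * c) ≡
      (two * Δ * (θ * a - c)) * (two * Δ * (θ * a - c)) + (four * (Δ * Δ) * ((θ * a + c) * (θ * a + c)) + four * two * (Δ * Δ) * (c * c) * (θ * θ - 1ℚ))
    cheb₁-ring = solve-∀ ℚring

    cheb₁-lin : ∀ Δ θ d₀ c₀ d₁ c₁ → two * Δ * (θ * (d₁ - d₀) - (c₁ - c₀)) - 1ℚ ≡
      two * Δ * (θ * d₁ - c₁) + (Δ * (c₀ - two * θ * d₀) + (Δ * c₀ - 1ℚ))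
    cheb₁-lin = solve-∀ ℚring

    cheb₂-ring : ∀ Δ a₀ a₁ → Δ * Δ * ((a₁ - a₀) * (a₁ - a₀)) ≡ (Δ * (a₀ - a₁)) * (Δ * (a₀ - a₁))
    cheb₂-ring = solve-∀ ℚring

    cheb₂-lin : ∀ Δ a₀ a₁ → Δ * (a₀ - a₁) - 1ℚ ≡ (Δ * a₀ - two) + (1ℚ - Δ * a₁)
    cheb₂-lin = solve-∀ ℚring

    ring-e : ∀ a b c → a * (b * c) ≡ a * c * b
    ring-e = solve-∀ ℚring

  0≤two : 0ℚ ≤ two
  0≤two = 0≤+ 0≤1 0≤1

  0≤four : 0ℚ ≤ four
  0≤four = 0≤* 0≤two 0≤two

  -- Both `ε` and `B` are at most Y/θ, so the error terms add up to at most Y·(Dc + 1)/θ, which is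
  -- at most Y/2.
  final₁ : ∀ {θ D c X Y B ε} → 0ℚ < θ → 0ℚ ≤ D → 0ℚ ≤ c → 0ℚ ≤ Y → Y ≤ D * (X + c * ε) + B →
           θ * ε ≤ Y → θ * B ≤ Y → two * (D * c + 1ℚ) ≤ θ → Y ≤ two * D * X
  final₁ {θ} {D} {c} {X} {Y} {B} {ε} 0<θ 0≤D 0≤c 0≤Y h₁ h₂ h₃ h₄ = 0≤⇒≤ (*-cancelˡ θ 0<θ
    (subst₂ _≤_ (sym (*-zeroʳ θ)) (sym (final₁-ring θ D c X Y B ε))
      (0≤+ (0≤* (0≤* 0≤two (ℚ.<⇒≤ 0<θ)) (≤⇒0≤ h₁)) (0≤+ (0≤* (0≤* (0≤* 0≤two 0≤D) 0≤c) (≤⇒0≤ h₂))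
        (0≤+ (0≤* 0≤two (≤⇒0≤ h₃)) (0≤* (≤⇒0≤ h₄) 0≤Y))))))

  -- `Q` is at most rX/θ₁ plus error terms. The main term is at most X/(2θ). The errors are at most
  -- 3rY/θ′, hence at most 6rDX/θ′, which is again at most X/(2θ); this is the origin of the factor
  -- 12.
  final₂ : ∀ {θ′ θ₁ θ r D X Y B ε Q} → 0ℚ < θ′ → 1ℚ ≤ θ₁ → 0ℚ ≤ θ → 0ℚ ≤ r → 0ℚ ≤ D → 0ℚ ≤ X →
           θ₁ * Q ≤ r * (X + ε + θ₁ * (B + ε)) → two * (r * θ) ≤ θ₁ → θ′ * ε ≤ Y → θ′ * B ≤ Y → Y ≤ two * D * X →
           (four + four + four) * (θ * (r * D)) ≤ θ′ → θ * Q ≤ X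
  final₂ {θ′} {θ₁} {θ} {r} {D} {X} {Y} {B} {ε} {Q} 0<θ′ 1≤θ₁ 0≤θ 0≤r 0≤D 0≤X h₁ h₂ h₃ h₄ h₅ h₆ =
    0≤⇒≤ (*-cancelˡ (two * θ′ * θ₁) (0<* (0<* (0<+ 0<1 0≤1) 0<θ′) 0<θ₁)
      (subst₂ _≤_ (sym (*-zeroʳ _)) (sym (final₂-ring θ′ θ₁ θ r D X Y B ε Q))
        (0≤+ (0≤* (0≤* (0≤* 0≤two 0≤θ′) 0≤θ) (≤⇒0≤ h₁))
        (0≤+ (0≤* (0≤* 0≤θ′ 0≤X) (≤⇒0≤ h₂))
        (0≤+ (0≤* (0≤* (0≤* 0≤two 0≤θ) 0≤r) (0≤+ (0≤* (≤⇒0≤ h₃) (0≤+ 0≤1 0≤θ₁)) (0≤* (≤⇒0≤ h₄) 0≤θ₁)))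
        (0≤+ (0≤* (0≤* (0≤* (0≤* 0≤two 0≤θ) 0≤r) (0≤+ 0≤1 (0≤* 0≤two 0≤θ₁))) (≤⇒0≤ h₅))
        (0≤+ (0≤* (0≤* 0≤X 0≤θ₁) (≤⇒0≤ h₆))
             (0≤* (0≤* (0≤* (0≤* (0≤* 0≤four 0≤θ) 0≤r) 0≤D) 0≤X) (≤⇒0≤ 1≤θ₁)))))))))
    where
    0<θ₁ = ℚ.<-≤-trans 0<1 1≤θ₁
    0≤θ₁ = ℚ.<⇒≤ 0<θ₁
    0≤θ′ = ℚ.<⇒≤ 0<θ′

  1≤sq : ∀ {x} → 1ℚ ≤ x → 1ℚ ≤ x * x
  1≤sq {x} p = ℚ.≤-trans p (≡≤ (sym (*-identityʳ x)) (*-monoˡ x (ℚ.≤-trans 0≤1 p) p))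

  -- The quantity θd - c is at most -c₀/2 at the coarse densities and nonnegative at the fine ones,
  -- so it moves by at least 1/(2Δ). Its square is at most 2θ² times the sum of the squared changes
  -- of `d` and `c`, which gives the constant 8.
  cheb₁ : ∀ {Δ θ d₀ c₀ d₁ c₁} → 0ℚ ≤ Δ → 1ℚ ≤ θ → two * θ * d₀ ≤ c₀ → 1ℚ ≤ Δ * c₀ → c₁ ≤ θ * d₁ →
    1ℚ ≤ four * two * (Δ * Δ) * (θ * θ) * ((d₁ - d₀) * (d₁ - d₀) + (c₁ - c₀) * (c₁ - c₀))
  cheb₁ {Δ} {θ} {d₀} {c₀} {d₁} {c₁} 0≤Δ 1≤θ h₁ h₂ h₃ = ℚ.≤-trans (1≤sq (0≤⇒≤ (subst (0ℚ ≤_) (sym (cheb₁-lin Δ θ d₀ c₀ d₁ c₁))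
      (0≤+ (0≤* (0≤* 0≤two 0≤Δ) (≤⇒0≤ h₃)) (0≤+ (0≤* 0≤Δ (≤⇒0≤ h₁)) (≤⇒0≤ h₂))))))
    (≤-by _ (cheb₁-ring Δ θ (d₁ - d₀) (c₁ - c₀))
      (0≤+ (0≤* (0≤* 0≤four (0≤sq Δ)) (0≤sq _)) (0≤* (0≤* (0≤* (0≤* 0≤four 0≤two) (0≤sq Δ)) (0≤sq _)) (≤⇒0≤ (1≤sq 1≤θ)))))

  -- The coarse threshold is twice the fine one, so a point that passes the first and fails the
  -- second moves by at least 1/Δ.
  cheb₂ : ∀ {Δ a₀ a₁} → two ≤ Δ * a₀ → Δ * a₁ ≤ 1ℚ → 1ℚ ≤ Δ * Δ * ((a₁ - a₀) * (a₁ - a₀))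
  cheb₂ {Δ} {a₀} {a₁} h₁ h₂ = subst (1ℚ ≤_) (sym (cheb₂-ring Δ a₀ a₁)) (1≤sq (0≤⇒≤ (subst (0ℚ ≤_) (sym (cheb₂-lin Δ a₀ a₁))
    (0≤+ (≤⇒0≤ h₁) (≤⇒0≤ h₂)))))

  -- The removal lemma

  module RemovalData (n r : ℕ) where
    open Average n
    open Partitions n r
    open Factors n r

    allᶠ : (Fin r → V r → Bool) → V r → Bool
    allᶠ S x = all (λ i → S i x) (allFin r)

    -- ν is a density whose (r−1)-dimensional marginals are at most K; it puts mass at least 1 on ⋂ S i.
    -- S i is a union of cells of level j, and T i fills it up to measure 1/(1+η).
    record Data (j K η m : ℕ) : Set where
      field
        ν        : V r → ℚ
        0≤ν      : ∀ x → 0ℚ ≤ ν x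
        marginal : ∀ i (f : V r → Bool) → Dep (co i) f → E (λ x → ν x * ⟦ f x ⟧) ≤ ι K * μ f
        b        : Sys m
        S T      : Fin r → V r → Bool
        S-inv    : ∀ i {x y} → q b j (co i) x ≡ q b j (co i) y → S i x ≡ S i y
        T-dep    : ∀ i → Dep (co i) (T i)
        heavy    : 1ℚ ≤ E (λ x → ν x * ⟦ allᶠ S x ⟧)
        close    : ∀ i → ι (suc η) * μ (λ x → S i x ∧ not (T i x)) ≤ 1ℚ
    open Data public

    -- A box is a conjunction of functions of at most j coordinates each; θ and C stand for the rationals
    -- 1/(1+θ) and 1/C.
    NoDenseBox : ℕ → ℕ → ℕ → (Fin r → V r → Bool) → Set
    NoDenseBox j θ C T = (L : List Factor) → (∀ {F} → F ∈ˡ L → ∣ set F ∣ ℕ.≤ j) → 1ℚ ≤ ι C * μ (conj L) →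
      ι (suc θ) * μ (λ x → conj L x ∧ not (allᶠ T x)) ≤ μ (conj L) → ⊥

    -- A positive average cannot vanish at every point. In this negated form a point of `B` can be
    -- used without searching the space of tuples.
    witness : (B : V r → Bool) (G : V r → ℚ) (c : ℚ) → 1ℚ ≤ c * E (λ x → ⟦ B x ⟧ * G x) → (∀ x → B x ≡ true → ⊥) → ⊥
    witness B G c big none = ℚ.<-irrefl refl (ℚ.<-≤-trans 0<1 (≤≡ big (trans (cong (c *_)
        (trans (E-cong zero-at) (E-const {r} 0ℚ))) (*-zeroʳ c))))
      where
      zero-at : ∀ x → ⟦ B x ⟧ * G x ≡ 0ℚ
      zero-at x with B x in eq
      ... | true  = ⊥-elim (none x eq)
      ... | false = *-zeroˡ (G x)

  -- Nothing depends on n. That η is chosen before the complexity m is what makes the induction on j work: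
  -- the next partition has to be compared with this η before its complexity is known.
  RemovalLemma : ℕ → ℕ → Set
  RemovalLemma r j = ∀ K θ → Σ ℕ λ η → ∀ m → Σ ℕ λ C → ∀ n → let open RemovalData n r in
    (D : Data j K η m) → NoDenseBox j θ C (T D) → ⊥

  merge-empty : ∀ {X : Set} {r} (e : Subset r) → ∣ e ∣ ≡ 0 → (x y : Vec X r) → merge e x y ≡ y
  merge-empty []          _ []      []      = refl
  merge-empty (false ∷ e) p (a ∷ x) (b ∷ y) = cong (b ∷_) (merge-empty e p x y)

  -- At level 0 the only face is empty, so a cell is the whole space; each `S i` contains a point
  -- and is therefore everything. The `r` defects, each at most 1/(1 + r(1+θ)), sum to at most
  -- 1/(1+θ), and the empty conjunction is a dense box.
  removal-zero : ∀ r → RemovalLemma r 0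
  removal-zero r K θ = r ℕ.* suc θ , λ m → 1 , λ n → Proof.absurd n
    where
    module Proof (n : ℕ) {m : ℕ} where
      open Average n
      open Partitions n r
      open Factors n r
      open RemovalData n r
      absurd : (D : Data 0 K (r ℕ.* suc θ) m) → NoDenseBox 0 θ 1 (T D) → ⊥
      absurd D none = witness (allᶠ (S D)) (ν D) 1ℚ
          (≤≡ (heavy D) (trans (E-cong (λ x → *-comm _ _)) (sym (*-identityˡ _)))) found
        where
        μ[] : μ (conj []) ≡ 1ℚ
        μ[] = E-const {r} 1ℚ
        found : ∀ x → allᶠ (S D) x ≡ true → ⊥
        found x Sx = none [] (λ ()) (ℚ.≤-reflexive (trans (sym μ[]) (trans (sym (*-identityˡ _)) (cong (_* μ (conj [])) (sym (trans (ι-suc 0) (trans (cong (1ℚ +_) ι-zero) (+-identityʳ 1ℚ))))))))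
            (≤≡ (ℚ.≤-trans (*-monoˡ _ (0≤ι (suc θ)) (union-bound (conj []) (T D))) (≡≤ (sym (sumF-* (ι (suc θ)) _))
              (ℚ.≤-trans (sumF-mono each) (≡≤ (sumF-const {r} (recip (r ℕ.* suc θ) * ι (suc θ))) total)))) (sym μ[]))
          where
          S-true : ∀ i y → S D i y ≡ true
          S-true i y = trans (S-inv D i (code⁺ (b D) (below 0 (co i)) (λ {e} m →
              trans (sym (dep (b D) e y x)) (cong (class (b D) e) (merge-empty e (proj₁ (∈-below⁻ m)) y x)))))
            (all⁻ (λ i → S D i x) (allFin r) Sx (∈-allFin i))
          μ≤ : ∀ i → μ (λ x → not (T D i x)) ≤ recip (r ℕ.* suc θ)
          μ≤ i = *-cancelˡ (ι (suc (r ℕ.* suc θ))) (0<ι (r ℕ.* suc θ)) (≤≡ (ℚ.≤-trans (*-monoˡ _ (0≤ι (suc (r ℕ.* suc θ)))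
            (μ-mono (λ y nT → ∧⁺ (S-true i y) nT))) (close D i)) (sym (recip* (r ℕ.* suc θ))))
          each : ∀ i → ι (suc θ) * μ (λ x → not (T D i x)) ≤ recip (r ℕ.* suc θ) * ι (suc θ)
          each i = ≤≡ (*-monoˡ _ (0≤ι (suc θ)) (μ≤ i)) (*-comm _ _)
          total : ι r * (recip (r ℕ.* suc θ) * ι (suc θ)) ≤ 1ℚ
          total = ≡≤ (trans (ring-e (ι r) (recip (r ℕ.* suc θ)) (ι (suc θ))) (cong (_* recip (r ℕ.* suc θ)) (sym (ι-* r (suc θ)))))
            (≤≡ (*-monoʳ _ (0≤recip (r ℕ.* suc θ)) (ι-mono (ℕ.n≤1+n (r ℕ.* suc θ)))) (recip* (r ℕ.* suc θ)))

  length-allFin : ∀ r → length (allFin r) ≡ r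
  length-allFin r = List.length-tabulate (λ i → i)

  below-length : ∀ {r} j (s : Subset r) → length (below j s) ℕ.≤ length (subsets r)
  below-length {r} j s = List.length-filter (below? j s) (subsets r)

  ι2≡two : ι 2 ≡ two
  ι2≡two = trans (ι-suc 1) (cong (1ℚ +_) (trans (ι-suc 0) (trans (cong (1ℚ +_) ι-zero) (+-identityʳ 1ℚ))))

  opaque
    unfolding ℚring ι

    ι8≡ : ι 8 ≡ four * two
    ι8≡ = refl

    ι12≡ : ι 12 ≡ four + four + four
    ι12≡ = refl

    heavy-ring : ∀ X l → two * X - 1ℚ ≡ two * (X + l - 1ℚ) + (1ℚ - two * l)
    heavy-ring = solve-∀ ℚring

    chain-ring : ∀ Δ P X l e → Δ * P * (X + (1ℚ + l) * e) - Δ * (P * (X + l * e) + e) ≡ Δ * ((P - 1ℚ) * e)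
    chain-ring = solve-∀ ℚring

    gaps-ring : ∀ k g l → k * (g + g + l * g) ≡ k * (1ℚ + (1ℚ + l)) * g
    gaps-ring = solve-∀ ℚring

    assemble-ring₂ : ∀ X e t L → (X + e) + t * L + t * e ≡ X + e + t * (L + e)
    assemble-ring₂ = solve-∀ ℚring

    ring-f : ∀ a e c y → a * e * (c * y) ≡ a * c * e * y
    ring-f = solve-∀ ℚring

    ring-g : ∀ a b c → a * b * c ≡ a * c * b
    ring-g = solve-∀ ℚring

  split-case : ∀ a t c → (a ≡ true → t ≡ true → c ≡ true) → ⟦ a ⟧ ≤ ⟦ c ⟧ + ⟦ a ∧ not t ⟧
  split-case false t c h = 0≤+ (0≤⟦⟧ c) ℚ.≤-refl
  split-case true false c h = ≤-by ⟦ c ⟧ (+-comm _ _) (0≤⟦⟧ c)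
  split-case true true c h = ≤≡ (⟦⟧-mono (h refl)) (sym (+-identityʳ _))

  indicator-≤ : ∀ {a u} c → 0ℚ ≤ u → (c ≡ true → a ≤ u) → a * ⟦ c ⟧ ≤ u
  indicator-≤ {a} true  0≤u h = ≡≤ (*-identityʳ a) (h refl)
  indicator-≤ {a} false 0≤u h = ≡≤ (*-zeroʳ a) 0≤u

  ⟦⟧-≤ : ∀ {u} c → 0ℚ ≤ u → (c ≡ true → 1ℚ ≤ u) → ⟦ c ⟧ ≤ u
  ⟦⟧-≤ true  0≤u h = h refl
  ⟦⟧-≤ false 0≤u h = 0≤u

  not-∧ : ∀ p {c} → not (p ∧ c) ≡ true → not p ≡ true ⊎ not c ≡ true
  not-∧ true  h = inj₂ h
  not-∧ false h = inj₁ refl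

  ⟦⟧-absorb : ∀ v c d → (c ≡ true → d ≡ true) → v * ⟦ c ⟧ * ⟦ d ⟧ ≡ v * ⟦ c ⟧
  ⟦⟧-absorb v true  d h = trans (cong (λ d → v * 1ℚ * ⟦ d ⟧) (h refl)) (*-identityʳ _)
  ⟦⟧-absorb v false d h = trans (cong (_* ⟦ d ⟧) (*-zeroʳ v)) (trans (*-zeroˡ ⟦ d ⟧) (sym (*-zeroʳ v)))

  -- Where `T` holds the density `p` is at most c/t; where it fails on `G`, `p` is bounded by 1 and
  -- the loss is charged to `B`.
  trade : ∀ {t p c} (G T B : Bool) → 0ℚ ≤ t → p ≤ 1ℚ → (T ≡ true → t * p ≤ c) → (G ≡ true → not T ≡ true → B ≡ true) → 0ℚ ≤ c →
          t * (p * ⟦ G ⟧) ≤ c * ⟦ G ⟧ + t * ⟦ B ⟧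
  trade {t} {p} {c} false T B 0≤t p≤1 h h′ 0≤c = ≡≤ (trans (cong (t *_) (*-zeroʳ p)) (*-zeroʳ t)) (0≤+ (0≤* 0≤c ℚ.≤-refl) (0≤* 0≤t (0≤⟦⟧ B)))
  trade {t} {p} {c} true true B 0≤t p≤1 h h′ 0≤c = ≡≤ (trans (cong (t *_) (*-identityʳ p)) (sym (+-identityʳ _)))
    (+-mono (≤≡ (h refl) (sym (*-identityʳ c))) (0≤* 0≤t (0≤⟦⟧ B)))
  trade {t} {p} {c} true false B 0≤t p≤1 h h′ 0≤c = ≡≤ (sym (+-identityˡ _)) (+-mono (0≤* 0≤c 0≤1)
    (*-monoˡ t 0≤t (≡≤ (*-identityʳ p) (≤≡ p≤1 (cong ⟦_⟧ (sym (h′ refl refl)))))))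

  not-not : ∀ {c} → not (not c) ≡ true → c ≡ true
  not-not {true} _ = refl

  1≤^ : ∀ a k → 1 ℕ.≤ suc a ^ k
  1≤^ a k = ℕ.m^n>0 (suc a) k

  -- The inductive step of the removal lemma

  module Step (r j′ : ℕ) (j<r : suc j′ ℕ.< r) (ih : RemovalLemma r j′) (K θ : ℕ) where

    whole : Subset r
    whole = full

    -- `Z` bounds the number of bad events: `r` of each of two kinds and at most `cc` for the faces.
    -- Each may take ν-mass 1/(1+2Z), so half of ν survives. Defects are allowed a proportion 1/Θ₁
    -- of their cells, `r` of which add up to at most 1/(2Θ). `η` makes the bound K·2Θ₁ times the
    -- defect of `S i` fit into 1/(1+2Z).
    j Θ cc Z Θ₁ η : ℕ
    j  = suc j′
    Θ  = suc θ
    cc = length (subsets r)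
    Z  = r ℕ.+ (r ℕ.+ cc)
    Θ₁ = suc (2 ℕ.* (r ℕ.* Θ))
    η  = suc (2 ℕ.* Z) ℕ.* (K ℕ.* (2 ℕ.* Θ₁))

    module Complexity (m : ℕ) where

      -- `Mx` exceeds every number of cells, 1/(1+d₁) and 1/(1+d) are the density thresholds for
      -- cells and atoms, and `K′` is the marginal bound after ν is restricted to cells of mass at
      -- least 1/(2·Mx) and rescaled. `D` is the loss from trading at most `cc` atoms. The two
      -- summands of `θ′` are those required by `final₂` and `final₁`, those of `Kc` by `cheb₁` and
      -- `cheb₂`; `g` makes the Chebyshev bound meet `η′`.
      Mx d₁ d K′ D θ′ η′ Kc g : ℕ
      Mx = suc (suc m ^ cc)
      d₁ = suc (2 ℕ.* Z) ℕ.* (K ℕ.* Mx)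
      d  = suc (2 ℕ.* Z) ℕ.* (K ℕ.* (m ℕ.* 2))
      K′ = 2 ℕ.* Mx ℕ.* K
      D  = suc d ^ cc
      θ′ = 12 ℕ.* (Θ ℕ.* (r ℕ.* D)) ℕ.+ 2 ℕ.* (D ℕ.* cc ℕ.+ 1)
      η′ = proj₁ (ih K′ θ′)
      Kc = 8 ℕ.* (suc d₁ ℕ.* suc d₁) ℕ.* (Θ₁ ℕ.* Θ₁) ℕ.+ suc d ℕ.* suc d
      g  = suc η′ ℕ.* (Kc ℕ.* (2 ℕ.+ cc))

      -- A box from the induction hypothesis has measure at least 1/C′(m₀). The uniformity error has
      -- to be at most a fraction 1/(1+θ′) of that, hence a function of the coarse complexity.
      C′ ε : ℕ → ℕ
      C′ m₀ = proj₁ (proj₂ (ih K′ θ′) m₀)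
      ε m₀  = suc θ′ ℕ.* C′ m₀

      -- The sets to be regularised together: for each cell of level `j` on a facet `co i`, the cell
      -- itself (`true`) and the part of it in the defect of `S i` (`false`); and, in the second
      -- summand, the atoms on single faces.
      Ix : Set
      Ix = (Σ (Fin r) λ i → Fin (m ^ length (below j (co i))) × Bool) ⊎ (Subset r × Fin m)

      cellsOf : Fin r → List Ix
      cellsOf i = concatMap (λ β → inj₁ (i , β , true) ∷ inj₁ (i , β , false) ∷ []) (allFin (m ^ length (below j (co i))))

      indices : List Ix
      indices = concatMap cellsOf (allFin r) ++ map inj₂ (cartesianProduct (subsets r) (allFin m))

      private
        any-of : ∀ {A : Set} {P : A → Set} {x xs} → x ∈ˡ xs → P x → Any P xs
        any-of (here refl) p = here p
        any-of (there m)   p = there (any-of m p)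

      ∈-indices : ∀ k → k ∈ˡ indices
      ∈-indices (inj₁ (i , β , c)) = ∈-++⁺ˡ (∈-concatMap⁺ cellsOf (any-of (∈-allFin i) (∈-concatMap⁺ (λ β → inj₁ (i , β , true) ∷ inj₁ (i , β , false) ∷ []) (any-of (∈-allFin β) (pick c)))))
        where
        pick : ∀ c → inj₁ (i , β , c) ∈ˡ (inj₁ (i , β , true) ∷ inj₁ (i , β , false) ∷ [])
        pick true  = here refl
        pick false = there (here refl)
      ∈-indices (inj₂ (e , β)) = ∈-++⁺ʳ (concatMap cellsOf (allFin r)) (∈-map⁺ inj₂ (∈-cartesianProduct⁺ (∈-subsets e) (∈-allFin β)))

      -- The fuel `u` times 1/(1+g) is N + 1, more than the maximal energy. `B` bounds `C′` over all
      -- coarse complexities reachable from the trivial system with one class; cutting a box down to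
      -- the atoms costs the further factor 2D.
      N u B C : ℕ
      N = length indices
      u = suc g ℕ.* suc N
      B = regBound ε C′ u 1
      C = 2 ℕ.* D ℕ.* B

      module Fixed (n : ℕ) where
        open Average n
        open Partitions n r
        open Factors n r
        open RemovalData n r

        module WithData (𝒟 : Data j K η m) (none : NoDenseBox j θ C (T 𝒟)) where

          κ : ∀ i → V r → Fin (m ^ length (below j (co i)))
          κ i = q (b 𝒟) j (co i)

          cell : ∀ i → Fin (m ^ length (below j (co i))) → V r → Bool
          cell i β x = κ i x ≡ᵇ β

          defect : ∀ i → Fin (m ^ length (below j (co i))) → V r → Bool
          defect i β x = (κ i x ≡ᵇ β) ∧ (S 𝒟 i x ∧ not (T 𝒟 i x))

          atom : Subset r → Fin m → V r → Bool
          atom e β x = class (b 𝒟) e x ≡ᵇ β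

          base : Ix → Subset r
          base (inj₁ (i , _)) = co i
          base (inj₂ (e , _)) = e

          fam : Ix → V r → Bool
          fam (inj₁ (i , β , true))  = cell i β
          fam (inj₁ (i , β , false)) = defect i β
          fam (inj₂ (e , β))         = atom e β

          S-dep : ∀ i → Dep (co i) (S 𝒟 i)
          S-dep i x y = S-inv 𝒟 i (q-dep (b 𝒟) j (co i) x y)

          fam-dep : ∀ k → Dep (base k) (fam k)
          fam-dep (inj₁ (i , β , true)) x y = cong (_≡ᵇ β) (q-dep (b 𝒟) j (co i) x y)
          fam-dep (inj₁ (i , β , false)) x y = cong₂ _∧_ (cong (_≡ᵇ β) (q-dep (b 𝒟) j (co i) x y))
            (cong₂ (λ s t → s ∧ not t) (S-dep i x y) (T-dep 𝒟 i x y))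
          fam-dep (inj₂ (e , β)) x y = cong (_≡ᵇ β) (dep (b 𝒟) e x y)

          trivial : Sys 1
          trivial = record { class = λ _ _ → zero ; dep = λ _ _ _ → refl }

          module Reg = Regularity j′ N g (λ k → base (List.lookup indices k)) (λ k → fam (List.lookup indices k)) ε C′

          -- The cells of level j are pseudorandom relative to the fine partition b₁, with an error depending on the
          -- complexity of the coarse partition b₀, and both partitions predict nearly the same cell densities.
          module Levels {m₀ m₁ : ℕ} (b₀ : Sys m₀) (b₁ : Sys m₁) (finer : Finer b₀ b₁) (C′≤B : C′ m₀ ℕ.≤ B)
                        (gap : ∀ k → Reg.gap b₀ b₁ k ≤ recip g)
                        (uniform : ∀ k → Uniform b₁ j′ (base (List.lookup indices k)) (fam (List.lookup indices k)) (recip (ε m₀))) where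

            P₀ P₁ : Ix → V r → ℚ
            P₀ k = Pr b₀ j′ (base k) (fam k)
            P₁ k = Pr b₁ j′ (base k) (fam k)

            gap′ : ∀ k → E (λ x → (P₁ k x - P₀ k x) * (P₁ k x - P₀ k x)) ≤ recip g
            gap′ k = subst (λ k → E (λ x → (P₁ k x - P₀ k x) * (P₁ k x - P₀ k x)) ≤ recip g) (sym (lookup-index (∈-indices k))) (gap (index (∈-indices k)))

            uniform′ : ∀ k → Uniform b₁ j′ (base k) (fam k) (recip (ε m₀))
            uniform′ k = subst (λ k → Uniform b₁ j′ (base k) (fam k) (recip (ε m₀))) (sym (lookup-index (∈-indices k))) (uniform (index (∈-indices k)))

            -- In coarse densities: the defect takes more than 1/(2Θ₁) of the cell, or the cell is
            -- rarer than 1/(1+d₁). Like the 2 in `bad₃`, the factor `two` leaves room for the fine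
            -- densities to differ slightly.
            bad₁ bad₂ : ∀ i → Fin (m ^ length (below j (co i))) → V r → Bool
            bad₁ i β x = not (two * ι Θ₁ * P₀ (inj₁ (i , β , false)) x ≤ᵇ P₀ (inj₁ (i , β , true)) x)
            bad₂ i β x = not (1ℚ ≤ᵇ (ι (suc d₁) * P₀ (inj₁ (i , β , true)) x))

            bad₃ : ∀ e → Fin m → V r → Bool
            bad₃ e β x = not (two ≤ᵇ (ι (suc d) * P₀ (inj₂ (e , β)) x))

            P₀-inv : ∀ k {x y} → q b₀ j′ (base k) x ≡ q b₀ j′ (base k) y → P₀ k x ≡ P₀ k y
            P₀-inv k = Pr-inv b₀ j′ (base k) (fam k)

            ν-bound : ∀ {B y} k → 0ℚ ≤ y → ∀ i → Dep (co i) B → μ B ≤ ι k * y → ∀ {a} → suc (2 ℕ.* Z) ℕ.* (K ℕ.* k) ℕ.≤ a →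
                      ι a * y ≤ 1ℚ → E (λ x → ν 𝒟 x * ⟦ B x ⟧) ≤ recip (2 ℕ.* Z)
            ν-bound {B} {y} k 0≤y i d h h′ h″ = ℚ.≤-trans (marginal 𝒟 i B d) (ℚ.≤-trans (*-monoˡ _ (0≤ι K) h)
              (≡≤ (trans (sym (*-assoc _ _ _)) (cong (_* y) (sym (ι-* K k)))) (scale-≤ {k = K ℕ.* k} {z = 2 ℕ.* Z} h′ 0≤y h″)))

            bad₁-inv : ∀ i β {x y} → q b₀ j′ (co i) x ≡ q b₀ j′ (co i) y → bad₁ i β x ≡ bad₁ i β y
            bad₁-inv i β eq = cong₂ (λ u v → not (two * ι Θ₁ * u ≤ᵇ v)) (P₀-inv (inj₁ (i , β , false)) eq) (P₀-inv (inj₁ (i , β , true)) eq)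

            bad₂-inv : ∀ i β {x y} → q b₀ j′ (co i) x ≡ q b₀ j′ (co i) y → bad₂ i β x ≡ bad₂ i β y
            bad₂-inv i β eq = cong (λ u → not (1ℚ ≤ᵇ (ι (suc d₁) * u))) (P₀-inv (inj₁ (i , β , true)) eq)

            bad₃-inv : ∀ e β {x y} → q b₀ j′ e x ≡ q b₀ j′ e y → bad₃ e β x ≡ bad₃ e β y
            bad₃-inv e β eq = cong (λ u → not (two ≤ᵇ (ι (suc d) * u))) (P₀-inv (inj₂ (e , β)) eq)

            M≤Mx : ∀ (s : Subset r) → m ^ length (below j s) ℕ.< Mx
            M≤Mx s = ℕ.s≤s (ℕ.≤-trans (ℕ.^-monoˡ-≤ (length (below j s)) (ℕ.n≤1+n m)) (ℕ.^-monoʳ-≤ (suc m) (below-length j s)))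

            -- The event depends only on the coordinates other than `i`, so the marginal bound
            -- transfers it to ν. In `cell-markov` the density of a bad cell is dominated by 2Θ₁
            -- times that of its defect, and the defects of all cells add up to the part of `S i`
            -- outside `T i`.
            ν-bad₁ : ∀ i → E (λ x → ν 𝒟 x * ⟦ bad₁ i (κ i x) x ⟧) ≤ recip (2 ℕ.* Z)
            ν-bad₁ i = ν-bound {y = μ (λ x → S 𝒟 i x ∧ not (T 𝒟 i x))} (2 ℕ.* Θ₁) (0≤μ (λ x → S 𝒟 i x ∧ not (T 𝒟 i x))) i
                (λ x y → trans (cong (λ β → bad₁ i β (merge (co i) x y)) (q-dep (b 𝒟) j (co i) x y)) (bad₁-inv i (κ i x) (q-dep b₀ j′ (co i) x y)))
                (≤≡ (cell-markov b₀ j′ (co i) (κ i) (bad₁ i) (λ β x → two * ι Θ₁ * P₀ (inj₁ (i , β , false)) x) (bad₁-inv i)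
                   (λ β x → indicator-≤ (bad₁ i β x) (0≤* (0≤* 0≤two (0≤ι Θ₁)) (0≤Pr b₀ j′ (co i) (defect i β) x)) ≰ᵇ⇒≥)) total)
                (ℕ.n≤1+n η) (close 𝒟 i)
              where
              total : sumF (λ β → E (λ x → two * ι Θ₁ * P₀ (inj₁ (i , β , false)) x)) ≡ ι (2 ℕ.* Θ₁) * μ (λ x → S 𝒟 i x ∧ not (T 𝒟 i x))
              total = trans (sumF-cong (λ β → trans (E-* _ _) (cong (two * ι Θ₁ *_) (trans (Cond.E-P (q b₀ j′ (co i)) (λ x → ⟦ defect i β x ⟧))
                  (E-cong (λ x → ⟦∧⟧ (κ i x ≡ᵇ β) _))))))
                (trans (sumF-* (two * ι Θ₁) _) (cong₂ _*_ (trans (cong (_* ι Θ₁) (sym ι2≡two)) (sym (ι-* 2 Θ₁)))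
                  (cells-total (κ i) (λ x → ⟦ S 𝒟 i x ∧ not (T 𝒟 i x) ⟧))))

            ν-bad₂ : ∀ i → E (λ x → ν 𝒟 x * ⟦ bad₂ i (κ i x) x ⟧) ≤ recip (2 ℕ.* Z)
            ν-bad₂ i = ν-bound Mx (0≤recip d₁) i
                (λ x y → trans (cong (λ β → bad₂ i β (merge (co i) x y)) (q-dep (b 𝒟) j (co i) x y)) (bad₂-inv i (κ i x) (q-dep b₀ j′ (co i) x y)))
                (ℚ.≤-trans (cell-markov b₀ j′ (co i) (κ i) (bad₂ i) (λ β x → recip d₁) (bad₂-inv i)
                   (λ β x → indicator-≤ (bad₂ i β x) (0≤recip d₁) (λ h → *-cancelˡ (ι (suc d₁)) (0<ι d₁) (≤≡ (≰ᵇ⇒≥ h) (sym (recip* d₁))))))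
                  (≡≤ (trans (sumF-cong (λ β → E-const {r} (recip d₁))) (sumF-const (recip d₁))) (*-monoʳ _ (0≤recip d₁) (ι-mono (ℕ.<⇒≤ (M≤Mx (co i)))))))
                (ℕ.n≤1+n d₁) (ℚ.≤-reflexive (recip* d₁))

            -- A face of size j < r omits some coordinate `i`, so the event is measurable on `co i`
            -- and the marginal bound in that direction applies.
            ν-bad₃ : ∀ e → Σ (Fin r) (_∉ e) → E (λ x → ν 𝒟 x * ⟦ bad₃ e (class (b 𝒟) e x) x ⟧) ≤ recip (2 ℕ.* Z)
            ν-bad₃ e (i , i∉e) = ν-bound (m ℕ.* 2) (0≤recip d) i
                (Dep-⊆ (⊆-co i∉e) (λ x y → trans (cong (λ β → bad₃ e β (merge e x y)) (dep (b 𝒟) e x y)) (bad₃-inv e (class (b 𝒟) e x) (q-dep b₀ j′ e x y))))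
                (≤≡ (cell-markov b₀ j′ e (class (b 𝒟) e) (bad₃ e) (λ β x → two * recip d) (bad₃-inv e)
                   (λ β x → indicator-≤ (bad₃ e β x) (0≤* 0≤two (0≤recip d)) (λ h → *-cancelˡ (ι (suc d)) (0<ι d) (≤≡ (≰ᵇ⇒≥ h) (sym cancel)))))
                  total)
                (ℕ.n≤1+n d) (ℚ.≤-reflexive (recip* d))
              where
              cancel : ι (suc d) * (two * recip d) ≡ two
              cancel = trans (ring-e (ι (suc d)) two (recip d)) (trans (cong (_* two) (recip* d)) (*-identityˡ two))
              total : sumF {m} (λ β → E (λ x → two * recip d)) ≡ ι (m ℕ.* 2) * recip d
              total = trans (sumF-cong (λ β → E-const {r} (two * recip d))) (trans (sumF-const (two * recip d))
                    (trans (sym (*-assoc _ _ _)) (cong (_* recip d) (trans (cong (ι m *_) (sym ι2≡two)) (sym (ι-* m 2))))))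

            event₁ event₂ : Fin r → V r → Bool
            event₁ i x = bad₁ i (κ i x) x
            event₂ i x = bad₂ i (κ i x) x

            event₃ : Subset r → V r → Bool
            event₃ e x = bad₃ e (class (b 𝒟) e x) x

            bads₁ bads₂ bads₃ bads : List (V r → Bool)
            bads₁ = map event₁ (allFin r)
            bads₂ = map event₂ (allFin r)
            bads₃ = map event₃ (below j whole)
            bads  = bads₁ ++ (bads₂ ++ bads₃)

            ν-bads : ∀ {B} → B ∈ˡ bads → E (λ x → ν 𝒟 x * ⟦ B x ⟧) ≤ recip (2 ℕ.* Z)
            ν-bads B∈ = [ from₁ , (λ B∈′ → [ from₂ , from₃ ]′ (∈-++⁻ bads₂ B∈′)) ]′ (∈-++⁻ bads₁ B∈)
              where
              from₁ : ∀ {B} → B ∈ˡ bads₁ → E (λ x → ν 𝒟 x * ⟦ B x ⟧) ≤ recip (2 ℕ.* Z)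
              from₁ B∈ = let (i , _ , eq) = ∈-map⁻ event₁ B∈ in subst (λ B → E (λ x → ν 𝒟 x * ⟦ B x ⟧) ≤ recip (2 ℕ.* Z)) (sym eq) (ν-bad₁ i)
              from₂ : ∀ {B} → B ∈ˡ bads₂ → E (λ x → ν 𝒟 x * ⟦ B x ⟧) ≤ recip (2 ℕ.* Z)
              from₂ B∈ = let (i , _ , eq) = ∈-map⁻ event₂ B∈ in subst (λ B → E (λ x → ν 𝒟 x * ⟦ B x ⟧) ≤ recip (2 ℕ.* Z)) (sym eq) (ν-bad₂ i)
              from₃ : ∀ {B} → B ∈ˡ bads₃ → E (λ x → ν 𝒟 x * ⟦ B x ⟧) ≤ recip (2 ℕ.* Z)
              from₃ B∈ = let (e , e∈ , eq) = ∈-map⁻ event₃ B∈ in subst (λ B → E (λ x → ν 𝒟 x * ⟦ B x ⟧) ≤ recip (2 ℕ.* Z)) (sym eq)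
                (ν-bad₃ e (missing e (subst (ℕ._< r) (sym (proj₁ (∈-below⁻ {j = j} {s = whole} e∈))) j<r)))

            bads-length : length bads ℕ.≤ Z
            bads-length = subst (ℕ._≤ Z) (sym (trans (List.length-++ bads₁) (cong₂ ℕ._+_ (trans (List.length-map event₁ (allFin r)) (length-allFin r))
                (trans (List.length-++ bads₂) (cong₂ ℕ._+_ (trans (List.length-map event₂ (allFin r)) (length-allFin r)) (List.length-map event₃ (below j whole)))))))
              (ℕ.+-monoʳ-≤ r (ℕ.+-monoʳ-≤ r (below-length j whole)))

            good : V r → Bool
            good x = all (λ B → not (B x)) bads

            heavy₂ : 1ℚ ≤ ι 2 * E (λ x → ν 𝒟 x * ⟦ allᶠ (S 𝒟) x ∧ good x ⟧)
            heavy₂ = ≤≡ (0≤⇒≤ (subst (0ℚ ≤_) (sym (heavy-ring _ (ι (length bads) * recip (2 ℕ.* Z))))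
                (0≤+ (0≤* 0≤two (≤⇒0≤ (ℚ.≤-trans (heavy 𝒟) (discard (ν 𝒟) (recip (2 ℕ.* Z)) (allᶠ (S 𝒟)) bads (0≤ν 𝒟) ν-bads))))
                  (≤⇒0≤ (≡≤ (trans (sym (*-assoc _ _ _)) (cong (_* recip (2 ℕ.* Z)) (trans (cong (_* ι (length bads)) (sym ι2≡two)) (sym (ι-* 2 (length bads))))))
                    (≤≡ (*-monoʳ _ (0≤recip (2 ℕ.* Z)) (ι-mono (ℕ.≤-trans (ℕ.*-monoʳ-≤ 2 bads-length) (ℕ.n≤1+n (2 ℕ.* Z))))) (recip* (2 ℕ.* Z))))))))
              (cong (_* E (λ x → ν 𝒟 x * ⟦ allᶠ (S 𝒟) x ∧ good x ⟧)) (sym ι2≡two))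

            κ* : V r → Fin (m ^ length (below j whole))
            κ* = q (b 𝒟) j whole

            -- The points of `sel` all lie in the cells of one point `z`, which serves as the name
            -- of this tuple of cells. From here on every density is that of a fixed set.
            module Cells (sel : V r → Bool) (sel-heavy : 1ℚ ≤ ι (2 ℕ.* Mx) * E (λ x → ν 𝒟 x * ⟦ sel x ⟧)) (z : V r)
                         (sel-κ : ∀ x → sel x ≡ true → κ* x ≡ κ* z) (sel-good : ∀ x → sel x ≡ true → good x ≡ true)
                         (z-S : ∀ i → S 𝒟 i z ≡ true) where

              kC kφ : Fin r → Ix
              kC i = inj₁ (i , κ i z , true)
              kφ i = inj₁ (i , κ i z , false)

              kA : Subset r → Ix
              kA e = inj₂ (e , class (b 𝒟) e z)

              good₁ good₂ : Fin r → V r → Bool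
              good₁ i x = two * ι Θ₁ * P₀ (kφ i) x ≤ᵇ P₀ (kC i) x
              good₂ i x = 1ℚ ≤ᵇ (ι (suc d₁) * P₀ (kC i) x)

              good₃ dense : Subset r → V r → Bool
              good₃ e x = two ≤ᵇ (ι (suc d) * P₀ (kA e) x)
              dense e x = 1ℚ ≤ᵇ (ι (suc d) * P₁ (kA e) x)

              clean : Fin r → V r → Bool
              clean i x = ι Θ₁ * P₁ (kφ i) x ≤ᵇ P₁ (kC i) x

              -- The data for the lower level. `S′` asks for good densities from the coarse
              -- partition, so it is a union of boundedly many cells; `T′` asks for the relaxed
              -- version from the fine one, which is what counting needs. That `T′` nearly contains
              -- `S′` is due to the small energy gap.
              S′ T′ : Fin r → V r → Bool
              S′ i x = good₁ i x ∧ (good₂ i x ∧ all (λ e → good₃ e x) (below j (co i)))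
              T′ i x = clean i x ∧ all (λ e → dense e x) (below j (co i))

              ⊆-whole : ∀ {s : Subset r} → s ⊆ whole
              ⊆-whole _ = Sub.∈⊤

              co⊆below : ∀ {i e} → e ∈ˡ below j (co i) → e ∈ˡ below j whole
              co⊆below {i} {e} m = ∈-below⁺ {s = whole} (proj₁ (∈-below⁻ {j = j} {s = co i} m)) ⊆-whole

              sel-κᵢ : ∀ i x → sel x ≡ true → κ i x ≡ κ i z
              sel-κᵢ i x h = q-⊆ (b 𝒟) j (⊆-whole {co i}) (sel-κ x h)

              sel-class : ∀ x → sel x ≡ true → ∀ {e} → e ∈ˡ below j whole → class (b 𝒟) e x ≡ class (b 𝒟) e z
              sel-class x h = code⁻ (b 𝒟) (below j whole) (sel-κ x h)

              avoid : ∀ x → sel x ≡ true → ∀ {B} → B ∈ˡ bads → not (B x) ≡ true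
              avoid x h = all⁻ (λ B → not (B x)) bads (sel-good x h)

              sel-S′ : ∀ x → sel x ≡ true → allᶠ S′ x ≡ true
              sel-S′ x h = all⁺ (λ i → S′ i x) (allFin r) (λ {i} _ → ∧⁺ (g₁ i) (∧⁺ (g₂ i) (all⁺ (λ e → good₃ e x) (below j (co i)) (λ {e} m → g₃ e (co⊆below {i} m)))))
                where
                g₁ : ∀ i → good₁ i x ≡ true
                g₁ i = not-not (subst (λ β → not (bad₁ i β x) ≡ true) (sel-κᵢ i x h) (avoid x h (∈-++⁺ˡ (∈-map⁺ event₁ (∈-allFin i)))))
                g₂ : ∀ i → good₂ i x ≡ true
                g₂ i = not-not (subst (λ β → not (bad₂ i β x) ≡ true) (sel-κᵢ i x h) (avoid x h (∈-++⁺ʳ bads₁ (∈-++⁺ˡ (∈-map⁺ event₂ (∈-allFin i))))))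
                g₃ : ∀ e → e ∈ˡ below j whole → good₃ e x ≡ true
                g₃ e m = not-not (subst (λ β → not (bad₃ e β x) ≡ true) (sel-class x h m) (avoid x h (∈-++⁺ʳ bads₁ (∈-++⁺ʳ bads₂ (∈-map⁺ event₃ m)))))

              S′-inv : ∀ i {x y} → q b₀ j′ (co i) x ≡ q b₀ j′ (co i) y → S′ i x ≡ S′ i y
              S′-inv i {x} {y} eq = cong₂ _∧_ (cong₂ (λ u v → two * ι Θ₁ * u ≤ᵇ v) (P₀-inv (kφ i) eq) (P₀-inv (kC i) eq))
                (cong₂ _∧_ (cong (λ u → 1ℚ ≤ᵇ (ι (suc d₁) * u)) (P₀-inv (kC i) eq))
                  (bool-ext (half eq) (half (sym eq))))
                where
                half : ∀ {x y} → q b₀ j′ (co i) x ≡ q b₀ j′ (co i) y → all (λ e → good₃ e x) (below j (co i)) ≡ true → all (λ e → good₃ e y) (below j (co i)) ≡ true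
                half {x} {y} eq h = all⁺ (λ e → good₃ e y) (below j (co i)) (λ {e} m → trans
                  (cong (λ u → two ≤ᵇ (ι (suc d) * u)) (P₀-inv (kA e) (q-⊆ b₀ j′ (proj₂ (∈-below⁻ {j = j} {s = co i} m)) (sym eq))))
                  (all⁻ (λ e → good₃ e x) (below j (co i)) h m))

              P₁-dep : ∀ k → Dep (base k) (P₁ k)
              P₁-dep k = Pr-dep b₁ j′ (base k) (fam k)

              dense-dep : ∀ e → Dep e (dense e)
              dense-dep e x y = cong (λ u → 1ℚ ≤ᵇ (ι (suc d) * u)) (P₁-dep (kA e) x y)

              T′-dep : ∀ i → Dep (co i) (T′ i)
              T′-dep i x y = cong₂ _∧_ (cong₂ (λ u v → ι Θ₁ * u ≤ᵇ v) (P₁-dep (kφ i) x y) (P₁-dep (kC i) x y))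
                (bool-ext (half (λ m → at m)) (half (λ m → sym (at m))))
                where
                at : ∀ {e} → e ∈ˡ below j (co i) → dense e (merge (co i) x y) ≡ dense e x
                at {e} m = Dep-⊆ (proj₂ (∈-below⁻ {j = j} {s = co i} m)) (dense-dep e) x y
                half : ∀ {x y} → (∀ {e} → e ∈ˡ below j (co i) → dense e x ≡ dense e y) → all (λ e → dense e x) (below j (co i)) ≡ true → all (λ e → dense e y) (below j (co i)) ≡ true
                half {x} {y} eq h = all⁺ (λ e → dense e y) (below j (co i)) (λ m → trans (sym (eq m)) (all⁻ (λ e → dense e x) (below j (co i)) h m))

              ν′ : V r → ℚ
              ν′ x = ι (2 ℕ.* Mx) * (ν 𝒟 x * ⟦ sel x ⟧)

              0≤ν′ : ∀ x → 0ℚ ≤ ν′ x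
              0≤ν′ x = 0≤* (0≤ι (2 ℕ.* Mx)) (0≤* (0≤ν 𝒟 x) (0≤⟦⟧ (sel x)))

              marginal′ : ∀ i (f : V r → Bool) → Dep (co i) f → E (λ x → ν′ x * ⟦ f x ⟧) ≤ ι K′ * μ f
              marginal′ i f fd = ℚ.≤-trans (E-mono (λ x → ≡≤ (*-assoc _ _ _) (*-monoˡ _ (0≤ι (2 ℕ.* Mx)) (*-monoʳ _ (0≤⟦⟧ (f x))
                  (≤≡ (*-monoˡ (ν 𝒟 x) (0≤ν 𝒟 x) (⟦⟧≤1 (sel x))) (*-identityʳ (ν 𝒟 x)))))))
                (≡≤ (E-* (ι (2 ℕ.* Mx)) (λ x → ν 𝒟 x * ⟦ f x ⟧)) (≤≡ (*-monoˡ _ (0≤ι (2 ℕ.* Mx)) (marginal 𝒟 i f fd))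
                  (trans (sym (*-assoc _ _ _)) (cong (_* μ f) (sym (ι-* (2 ℕ.* Mx) K))))))

              heavy′ : 1ℚ ≤ E (λ x → ν′ x * ⟦ allᶠ S′ x ⟧)
              heavy′ = ≤≡ sel-heavy (sym (trans (E-cong (λ x → trans (*-assoc _ _ _)
                (cong (ι (2 ℕ.* Mx) *_) (⟦⟧-absorb (ν 𝒟 x) (sel x) (allᶠ S′ x) (sel-S′ x))))) (E-* (ι (2 ℕ.* Mx)) (λ x → ν 𝒟 x * ⟦ sel x ⟧))))

              sqgap : Ix → V r → ℚ
              sqgap k x = (P₁ k x - P₀ k x) * (P₁ k x - P₀ k x)

              Kc≡ : ι Kc ≡ four * two * (ι (suc d₁) * ι (suc d₁)) * (ι Θ₁ * ι Θ₁) + ι (suc d) * ι (suc d)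
              Kc≡ = trans (ι-+ (8 ℕ.* (suc d₁ ℕ.* suc d₁) ℕ.* (Θ₁ ℕ.* Θ₁)) (suc d ℕ.* suc d)) (cong₂ _+_
                (trans (ι-* (8 ℕ.* (suc d₁ ℕ.* suc d₁)) (Θ₁ ℕ.* Θ₁)) (cong₂ _*_ (trans (ι-* 8 (suc d₁ ℕ.* suc d₁)) (cong₂ _*_ ι8≡ (ι-* (suc d₁) (suc d₁)))) (ι-* Θ₁ Θ₁)))
                (ι-* (suc d) (suc d)))

              0≤c₁ : 0ℚ ≤ four * two * (ι (suc d₁) * ι (suc d₁)) * (ι Θ₁ * ι Θ₁)
              0≤c₁ = 0≤* (0≤* (0≤* 0≤four 0≤two) (0≤sq (ι (suc d₁)))) (0≤sq (ι Θ₁))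

              1≤Θ₁ : 1ℚ ≤ ι Θ₁
              1≤Θ₁ = 1≤ι {Θ₁} (ℕ.s≤s ℕ.z≤n)

              module Close (i : Fin r) where
                es : List (Subset r)
                es = below j (co i)

                fluct : V r → ℚ
                fluct x = sqgap (kφ i) x + sqgap (kC i) x + sumF (λ k → sqgap (kA (List.lookup es k)) x)

                0≤sums : ∀ x → 0ℚ ≤ sumF (λ k → sqgap (kA (List.lookup es k)) x)
                0≤sums x = sumF-0≤ {f = λ k → sqgap (kA (List.lookup es k)) x} (λ k → 0≤sq _)

                0≤fluct : ∀ x → 0ℚ ≤ fluct x
                0≤fluct x = 0≤+ (0≤+ (0≤sq _) (0≤sq _)) (0≤sums x)

                case₁ : ∀ x → good₁ i x ≡ true → good₂ i x ≡ true → not (clean i x) ≡ true → 1ℚ ≤ ι Kc * fluct x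
                case₁ x h₁ h₂ h₃ = ℚ.≤-trans (cheb₁ (0≤ι (suc d₁)) 1≤Θ₁ (≤ᵇ⇒≤ h₁) (≤ᵇ⇒≤ h₂) (≰ᵇ⇒≥ h₃))
                  (*-mono 0≤c₁ (0≤fluct x) (≤-by (ι (suc d) * ι (suc d)) Kc≡ (0≤sq (ι (suc d)))) (≤-by _ refl (0≤sums x)))

                case₂ : ∀ x → all (λ e → good₃ e x) es ≡ true → Σ (Subset r) (λ e → e ∈ˡ es × not (dense e x) ≡ true) → 1ℚ ≤ ι Kc * fluct x
                case₂ x h (e , e∈ , h′) = ℚ.≤-trans (cheb₂ (≤ᵇ⇒≤ (all⁻ (λ e → good₃ e x) es h e∈)) (≰ᵇ⇒≥ h′))
                  (*-mono (0≤sq (ι (suc d))) (0≤fluct x) (≤-by _ (trans Kc≡ (+-comm _ _)) 0≤c₁)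
                    (ℚ.≤-trans (≡≤ (cong (λ e → sqgap (kA e) x) (lookup-index e∈)) (sumF-term {f = λ k → sqgap (kA (List.lookup es k)) x} (λ k → 0≤sq _) (index e∈)))
                      (≤-by _ (+-comm _ _) (0≤+ (0≤sq _) (0≤sq _)))))

                -- Chebyshev: where `S′ i` holds and `T′ i` fails, some density crosses from the
                -- strict coarse threshold to the relaxed fine one, so the squared gaps sum to at
                -- least 1/Kc. Their average is at most 2 + `cc` times 1/(1+g).
                pointwise : ∀ x → ⟦ S′ i x ∧ not (T′ i x) ⟧ ≤ ι Kc * fluct x
                pointwise x = ⟦⟧-≤ (S′ i x ∧ not (T′ i x)) (0≤* (0≤ι Kc) (0≤fluct x)) (λ h →
                  let (s , nt) = ∧⁻ {S′ i x} h
                      (g₁ , s′) = ∧⁻ {good₁ i x} s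
                      (g₂ , g₃) = ∧⁻ {good₂ i x} s′ in
                  [ case₁ x g₁ g₂ , (λ h′ → case₂ x g₃ (∧-not⁻ (λ e → dense e x) es h′)) ]′ (not-∧ (clean i x) nt))

                E-fluct : E fluct ≤ recip g + recip g + ι (length es) * recip g
                E-fluct = ≡≤ (trans (E-+ _ _) (cong₂ _+_ (E-+ _ _) (E-sumF (λ k x → sqgap (kA (List.lookup es k)) x))))
                  (+-mono (+-mono (gap′ (kφ i)) (gap′ (kC i))) (≤≡ (sumF-mono (λ k → gap′ (kA (List.lookup es k)))) (sumF-const (recip g))))

                close′ : ι (suc η′) * μ (λ x → S′ i x ∧ not (T′ i x)) ≤ 1ℚ
                close′ = ℚ.≤-trans (*-monoˡ _ (0≤ι (suc η′)) (ℚ.≤-trans (E-mono pointwise) (≡≤ (E-* (ι Kc) fluct) (*-monoˡ _ (0≤ι Kc) E-fluct))))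
                  (≡≤ (trans (cong (ι (suc η′) *_) (trans (gaps-ring (ι Kc) (recip g) (ι (length es))) (cong (λ w → ι Kc * w * recip g) (sym (trans (ι-suc (suc (length es))) (cong (1ℚ +_) (ι-suc (length es)))))))) assoc)
                    (≤≡ (*-monoʳ _ (0≤recip g) (ι-mono (ℕ.≤-trans (ℕ.*-monoʳ-≤ (suc η′) (ℕ.*-monoʳ-≤ Kc (ℕ.+-monoʳ-≤ 2 (below-length j (co i))))) (ℕ.n≤1+n g)))) (recip* g)))
                  where
                  assoc : ι (suc η′) * (ι Kc * ι (2 ℕ.+ length es) * recip g) ≡ ι (suc η′ ℕ.* (Kc ℕ.* (2 ℕ.+ length es))) * recip g
                  assoc = trans (sym (*-assoc _ _ _)) (cong (_* recip g) (trans (cong (ι (suc η′) *_) (sym (ι-* Kc (2 ℕ.+ length es)))) (sym (ι-* (suc η′) (Kc ℕ.* (2 ℕ.+ length es))))))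

              𝒟′ : Data j′ K′ η′ m₀
              𝒟′ = record { ν = ν′ ; 0≤ν = 0≤ν′ ; marginal = marginal′ ; b = b₀ ; S = S′ ; T = T′ ; S-inv = S′-inv ; T-dep = T′-dep
                          ; heavy = heavy′ ; close = Close.close′ }

              -- A dense lower-order box L is cut down to the cells of z.
              module Boxes (L : List Factor) (L-small : ∀ {F} → F ∈ˡ L → ∣ set F ∣ ℕ.≤ j′) (L-big : 1ℚ ≤ ι (C′ m₀) * μ (conj L))
                           (L-dense : ι (suc θ′) * μ (λ x → conj L x ∧ not (allᶠ T′ x)) ≤ μ (conj L)) where

                ε₀ X Y Lb : ℚ
                ε₀ = recip (ε m₀)
                Y  = μ (conj L)
                Lb = μ (λ x → conj L x ∧ not (allᶠ T′ x))

                facA facP : Subset r → Factor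
                facA e = factor e (fam (kA e)) (fam-dep (kA e))
                facP e = factor e (dense e) (dense-dep e)

                L′ : List Factor
                L′ = L ++ map facA (below j whole)

                X = μ (conj L′)

                θε≤Y : ι (suc θ′) * ε₀ ≤ Y
                θε≤Y = ℚ.≤-trans (≡≤ (sym (*-identityʳ _)) (*-monoˡ _ (0≤* (0≤ι (suc θ′)) (0≤recip (ε m₀))) L-big))
                  (≡≤ (trans (ring-f (ι (suc θ′)) ε₀ (ι (C′ m₀)) Y) (cong (λ w → w * ε₀ * Y) (sym (ι-* (suc θ′) (C′ m₀)))))
                    (≤≡ (*-monoʳ Y (0≤μ (conj L)) (ℚ.≤-trans (*-monoʳ ε₀ (0≤recip (ε m₀)) (ι-mono (ℕ.n≤1+n (ε m₀)))) (ℚ.≤-reflexive (recip* (ε m₀))))) (*-identityˡ Y)))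

                conj-mono : ∀ {Fs Gs} → (∀ {F} → F ∈ˡ Gs → F ∈ˡ Fs) → ∀ x → conj Fs x ≡ true → conj Gs x ≡ true
                conj-mono {Fs} {Gs} sub x h = all⁺ (λ F → fun F x) Gs (λ m → all⁻ (λ F → fun F x) Fs h (sub m))

                -- Intermediate boxes: the faces in `as` carry the atom of `z`, those in `ps` only
                -- the set where the fine density of that atom is not small.
                fill : List (Subset r) → List (Subset r) → List Factor
                fill as ps = L ++ (map facA as ++ map facP ps)

                ∈L : ∀ {as ps F} → F ∈ˡ L → F ∈ˡ fill as ps
                ∈L = ∈-++⁺ˡ

                ∈A : ∀ {as ps e} → e ∈ˡ as → facA e ∈ˡ fill as ps
                ∈A m = ∈-++⁺ʳ L (∈-++⁺ˡ (∈-map⁺ facA m))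

                ∈P : ∀ {as ps e} → e ∈ˡ ps → facP e ∈ˡ fill as ps
                ∈P {as} m = ∈-++⁺ʳ L (∈-++⁺ʳ (map facA as) (∈-map⁺ facP m))

                fill-elim : ∀ {as ps} (Q : Factor → Set) → (∀ {F} → F ∈ˡ L → Q F) → (∀ {e} → e ∈ˡ as → Q (facA e)) → (∀ {e} → e ∈ˡ ps → Q (facP e)) →
                            ∀ {F} → F ∈ˡ fill as ps → Q F
                fill-elim {as} {ps} Q qL qA qP m = [ qL , (λ m → [ (λ m → let (e , e∈ , eq) = ∈-map⁻ facA m in subst Q (sym eq) (qA e∈))
                                                                , (λ m → let (e , e∈ , eq) = ∈-map⁻ facP m in subst Q (sym eq) (qP e∈)) ]′ (∈-++⁻ (map facA as) m)) ]′ (∈-++⁻ L m)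

                L′-elim : (Q : Factor → Set) → (∀ {F} → F ∈ˡ L → Q F) → (∀ {e} → e ∈ˡ below j whole → Q (facA e)) → ∀ {F} → F ∈ˡ L′ → Q F
                L′-elim Q qL qA m = [ qL , (λ m → let (e , e∈ , eq) = ∈-map⁻ facA m in subst Q (sym eq) (qA e∈)) ]′ (∈-++⁻ L m)

                H : List (Subset r) → List (Subset r) → ℚ
                H as ps = μ (conj (fill as ps))

                distinct-∩ : ∀ {e e′ : Subset r} → ∣ e ∣ ≡ j → ∣ e′ ∣ ≡ j → e′ ≢ e → ∣ e′ ∩ e ∣ ℕ.≤ j′
                distinct-∩ {e} {e′} p p′ ne = ℕ.≤-pred (subst (∣ e′ ∩ e ∣ ℕ.<_) p′ (∩-shrinks e′ e (λ sub → ne (⊆∧∣≡∣⇒≡ sub (trans p′ (sym p))))))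

                module Replace {as ps : List (Subset r)} {e : Subset r} (e-size : ∣ e ∣ ≡ j) (as-size : ∀ {e} → e ∈ˡ as → ∣ e ∣ ≡ j)
                               (ps-size : ∀ {e} → e ∈ˡ ps → ∣ e ∣ ≡ j) (e∉as : ∀ {e′} → e′ ∈ˡ as → e′ ≢ e) (e∉ps : ∀ {e′} → e′ ∈ˡ ps → e′ ≢ e) where
                  small : ∀ {F} → F ∈ˡ fill as ps → ∣ set F ∩ e ∣ ℕ.≤ j′
                  small = fill-elim {as} {ps} (λ F → ∣ set F ∩ e ∣ ℕ.≤ j′) (λ {F} m → ℕ.≤-trans (Sub.∣p∩q∣≤∣p∣ (set F) e) (L-small m))
                    (λ m → distinct-∩ e-size (as-size m) (e∉as m)) (λ m → distinct-∩ e-size (ps-size m) (e∉ps m))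

                  -- On the dense set of `e`, 1 is at most 1+d times the fine density of the atom,
                  -- and the density is then exchanged for the atom. All other factors meet `e` in
                  -- fewer than `j` coordinates, because distinct faces of size `j` do.
                  swap : H as (e ∷ ps) ≤ ι (suc d) * (H (e ∷ as) ps + ε₀)
                  swap = ℚ.≤-trans (E-mono point) (≡≤ (E-* (ι (suc d)) _) (*-monoˡ _ (0≤ι (suc d))
                    (ℚ.≤-trans (replace-≥ j′ e (ℕ.≤-trans (ℕ.n≤1+n j′) (ℕ.≤-reflexive (sym e-size))) b₁ (fam (kA e)) (fam-dep (kA e)) ε₀ (0≤recip (ε m₀)) (uniform′ (kA e)) (fill as ps) small)
                      (+-monoˡ ε₀ (μ-mono (λ x h → let (a , c) = ∧⁻ {fam (kA e) x} h in collect x a c))))))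
                    where
                    point : ∀ x → ⟦ conj (fill as (e ∷ ps)) x ⟧ ≤ ι (suc d) * (P₁ (kA e) x * ⟦ conj (fill as ps) x ⟧)
                    point x = ⟦⟧-≤ (conj (fill as (e ∷ ps)) x) (0≤* (0≤ι (suc d)) (0≤* (0≤Pr b₁ j′ e (fam (kA e)) x) (0≤⟦⟧ (conj (fill as ps) x)))) (λ h →
                      ≤≡ (≤ᵇ⇒≤ (all⁻ (λ F → fun F x) (fill as (e ∷ ps)) h (∈P {as} (here refl))))
                        (cong (ι (suc d) *_) (sym (trans (cong (λ c → P₁ (kA e) x * ⟦ c ⟧) (conj-mono {fill as (e ∷ ps)} {fill as ps}
                          (fill-elim {as} {ps} (_∈ˡ fill as (e ∷ ps)) (∈L {as} {e ∷ ps}) (∈A {as} {e ∷ ps}) (λ m → ∈P {as} {e ∷ ps} (there m))) x h)) (*-identityʳ _)))))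
                    collect : ∀ x → fam (kA e) x ≡ true → conj (fill as ps) x ≡ true → conj (fill (e ∷ as) ps) x ≡ true
                    collect x a c = all⁺ (λ F → fun F x) (fill (e ∷ as) ps) (fill-elim {e ∷ as} {ps} (λ F → fun F x ≡ true)
                      (λ m → all⁻ (λ F → fun F x) (fill as ps) c (∈L {as} {ps} m))
                      (λ { (here refl) → a ; (there m) → all⁻ (λ F → fun F x) (fill as ps) c (∈A {as} {ps} m) })
                      (λ m → all⁻ (λ F → fun F x) (fill as ps) c (∈P {as} {ps} m)))

                -- The atoms of z are traded, one at a time, for the sets where their conditional density is not small.
                chain : ∀ as ps → Unique ps → (∀ {e} → e ∈ˡ as → ∣ e ∣ ≡ j) → (∀ {e} → e ∈ˡ ps → ∣ e ∣ ≡ j) → (∀ {e e′} → e ∈ˡ ps → e′ ∈ˡ as → e′ ≢ e) →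
                        (∀ {e} → e ∈ˡ below j whole → e ∈ˡ as ⊎ e ∈ˡ ps) → H as ps ≤ ι (suc d ^ length ps) * (X + ι (length ps) * ε₀)
                chain as [] _ as-size _ _ cover = ≤≡ (μ-mono (conj-mono {fill as []} {L′} (L′-elim (_∈ˡ fill as []) (∈L {as} {[]}) (λ m → [ ∈A {as} {[]} , (λ ()) ]′ (cover m)))))
                  (sym (trans (cong₂ _*_ (trans (ι-suc 0) (trans (cong (1ℚ +_) ι-zero) (+-identityʳ 1ℚ))) (trans (cong (λ w → X + w * ε₀) ι-zero) (trans (cong (X +_) (*-zeroˡ ε₀)) (+-identityʳ X)))) (*-identityˡ X)))
                chain as (e ∷ ps) (fresh ∷ uniq) as-size ps-size apart cover = ℚ.≤-trans
                  (Replace.swap {as} {ps} {e} (ps-size (here refl)) as-size (λ m → ps-size (there m)) (λ m → apart (here refl) m) (λ m eq → All.lookup fresh m (sym eq)))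
                  (ℚ.≤-trans (*-monoˡ _ (0≤ι (suc d)) (+-monoˡ ε₀ (chain (e ∷ as) ps uniq
                      (λ { (here refl) → ps-size (here refl) ; (there m) → as-size m }) (λ m → ps-size (there m))
                      (λ { m (here refl) → All.lookup fresh m ; m (there m′) → apart (there m) m′ })
                      (λ m → [ (λ m → inj₁ (there m)) , (λ { (here refl) → inj₁ (here refl) ; (there m) → inj₂ m }) ]′ (cover m)))))
                    (0≤⇒≤ (subst (0ℚ ≤_) (trans (sym (chain-ring (ι (suc d)) (ι (suc d ^ length ps)) X (ι (length ps)) ε₀))
                        (cong₂ (λ u v → u * (X + v * ε₀) - ι (suc d) * (ι (suc d ^ length ps) * (X + ι (length ps) * ε₀) + ε₀)) (sym (ι-* (suc d) (suc d ^ length ps))) (sym (ι-suc (length ps)))))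
                      (0≤* (0≤ι (suc d)) (0≤* (≤⇒0≤ (1≤ι (1≤^ d (length ps)))) (0≤recip (ε m₀)))))))

                0≤X : 0ℚ ≤ X
                0≤X = 0≤μ (conj L′)

                0≤Y : 0ℚ ≤ Y
                0≤Y = 0≤μ (conj L)

                Y≤ : Y ≤ ι D * (X + ι cc * ε₀) + Lb
                Y≤ = ℚ.≤-trans (≤≡ (E-mono split) (E-+ _ _)) (+-monoˡ Lb (ℚ.≤-trans (chain [] (below j whole) (below-unique j whole) (λ ()) (λ m → proj₁ (∈-below⁻ {j = j} {s = whole} m)) (λ _ ()) inj₂)
                    (*-mono (0≤ι _) (0≤+ 0≤X (0≤* (0≤ι cc) (0≤recip (ε m₀)))) (ι-mono (ℕ.^-monoʳ-≤ (suc d) (below-length j whole)))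
                      (+-monoʳ X (*-monoʳ ε₀ (0≤recip (ε m₀)) (ι-mono (below-length j whole)))))))
                  where
                  in-T′ : ∀ x → conj L x ≡ true → allᶠ T′ x ≡ true → conj (fill [] (below j whole)) x ≡ true
                  in-T′ x l t = all⁺ (λ F → fun F x) (fill [] (below j whole)) (fill-elim {[]} {below j whole} (λ F → fun F x ≡ true) (all⁻ (λ F → fun F x) L l) (λ ())
                    (λ {e} m → at e (proj₁ (∈-below⁻ {j = j} {s = whole} m)) (missing e (subst (ℕ._< r) (sym (proj₁ (∈-below⁻ {j = j} {s = whole} m))) j<r))))
                    where
                    at : ∀ e → ∣ e ∣ ≡ j → Σ (Fin r) (_∉ e) → dense e x ≡ true
                    at e size (i , i∉e) = all⁻ (λ e → dense e x) (below j (co i)) (proj₂ (∧⁻ {clean i x} (all⁻ (λ i → T′ i x) (allFin r) t (∈-allFin i)))) (∈-below⁺ size (⊆-co i∉e))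
                  split : ∀ x → ⟦ conj L x ⟧ ≤ ⟦ conj (fill [] (below j whole)) x ⟧ + ⟦ conj L x ∧ not (allᶠ T′ x) ⟧
                  split x = split-case (conj L x) (allᶠ T′ x) (conj (fill [] (below j whole)) x) (in-T′ x)

                θ′-large₁ : two * (ι D * ι cc + 1ℚ) ≤ ι (suc θ′)
                θ′-large₁ = ≡≤ (sym (trans (ι-* 2 (D ℕ.* cc ℕ.+ 1)) (cong₂ _*_ ι2≡two (trans (ι-+ (D ℕ.* cc) 1) (cong₂ _+_ (ι-* D cc) (trans (ι-suc 0) (trans (cong (1ℚ +_) ι-zero) (+-identityʳ 1ℚ))))))))
                  (ι-mono (ℕ.≤-trans (ℕ.m≤n+m (2 ℕ.* (D ℕ.* cc ℕ.+ 1)) (12 ℕ.* (Θ ℕ.* (r ℕ.* D)))) (ℕ.n≤1+n θ′)))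

                θ′-large₂ : (four + four + four) * (ι Θ * (ι r * ι D)) ≤ ι (suc θ′)
                θ′-large₂ = ≡≤ (sym (trans (ι-* 12 (Θ ℕ.* (r ℕ.* D))) (cong₂ _*_ ι12≡ (trans (ι-* Θ (r ℕ.* D)) (cong (ι Θ *_) (ι-* r D))))))
                  (ι-mono (ℕ.≤-trans (ℕ.m≤m+n (12 ℕ.* (Θ ℕ.* (r ℕ.* D))) (2 ℕ.* (D ℕ.* cc ℕ.+ 1))) (ℕ.n≤1+n θ′)))

                Θ₁-large : two * (ι r * ι Θ) ≤ ι Θ₁
                Θ₁-large = ≡≤ (sym (trans (ι-* 2 (r ℕ.* Θ)) (cong₂ _*_ ι2≡two (ι-* r Θ)))) (ι-mono (ℕ.n≤1+n (2 ℕ.* (r ℕ.* Θ))))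

                Y≤2DX : Y ≤ two * ι D * X
                Y≤2DX = final₁ (0<ι θ′) (0≤ι D) (0≤ι cc) 0≤Y Y≤ θε≤Y L-dense θ′-large₁

                module Defect (i : Fin r) where

                  outer : List (Subset r)
                  outer = filter (λ e → ¬? (e Sub.⊆? co i)) (below j whole)

                  -- The atoms on faces inside `co i` make up exactly the cell of `z` on `co i`, so
                  -- `L′` is that cell intersected with `G`. The faces kept in `G` meet `co i` in
                  -- fewer than `j` coordinates, so both the cell and its defect can be replaced by
                  -- their fine densities against `G`.
                  G : List Factor
                  G = fill outer []

                  ∈-outer⁻ : ∀ {e} → e ∈ˡ outer → e ∈ˡ below j whole × ¬ (e ⊆ co i)
                  ∈-outer⁻ = ∈-filter⁻ (λ e → ¬? (e Sub.⊆? co i)) {xs = below j whole}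

                  small : ∀ {F} → F ∈ˡ G → ∣ set F ∩ co i ∣ ℕ.≤ j′
                  small = fill-elim {outer} {[]} (λ F → ∣ set F ∩ co i ∣ ℕ.≤ j′) (λ {F} m → ℕ.≤-trans (Sub.∣p∩q∣≤∣p∣ (set F) (co i)) (L-small m))
                    (λ {e} m → ℕ.≤-pred (subst (∣ e ∩ co i ∣ ℕ.<_) (proj₁ (∈-below⁻ {j = j} {s = whole} (proj₁ (∈-outer⁻ m)))) (∩-shrinks e (co i) (proj₂ (∈-outer⁻ m)))))
                    (λ ())

                  j′≤ : j′ ℕ.≤ ∣ co i ∣
                  j′≤ = subst (j′ ℕ.≤_) (sym (∣co∣ i)) (ℕ.≤-trans (ℕ.n≤1+n j′) (ℕ.≤-pred (ℕ.≤-trans j<r (ℕ.≤-reflexive (sym (ℕ.suc-pred r {{ℕ.>-nonZero (ℕ.≤-trans (ℕ.s≤s ℕ.z≤n) j<r)}}))))))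

                  L′⇒cell : ∀ x → conj L′ x ≡ true → κ i x ≡ κ i z
                  L′⇒cell x h = code⁺ (b 𝒟) (below j (co i)) (λ {e} m → ≡ᵇ⇒≡ (all⁻ (λ F → fun F x) L′ h (∈-++⁺ʳ L (∈-map⁺ facA (co⊆below {i} m)))))

                  L′⇒defect : ∀ x → conj L′ x ∧ not (T 𝒟 i x) ≡ true → fam (kφ i) x ∧ conj G x ≡ true
                  L′⇒defect x h = let (l , nt) = ∧⁻ {conj L′ x} h in
                    ∧⁺ (∧⁺ (≡⇒≡ᵇ (L′⇒cell x l)) (∧⁺ (trans (S-inv 𝒟 i (L′⇒cell x l)) (z-S i)) nt))
                       (conj-mono {L′} {G} (fill-elim {outer} {[]} (_∈ˡ L′) ∈-++⁺ˡ (λ m → ∈-++⁺ʳ L (∈-map⁺ facA (proj₁ (∈-outer⁻ m)))) (λ ())) x l)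

                  cell⇒L′ : ∀ x → fam (kC i) x ∧ conj G x ≡ true → conj L′ x ≡ true
                  cell⇒L′ x h = let (c , g) = ∧⁻ {fam (kC i) x} h in
                    all⁺ (λ F → fun F x) L′ (L′-elim (λ F → fun F x ≡ true) (λ m → all⁻ (λ F → fun F x) G g (∈L {outer} {[]} m))
                      (λ {e} m → at c g m (e Sub.⊆? co i)))
                    where
                    at : ∀ {e} → fam (kC i) x ≡ true → conj G x ≡ true → e ∈ˡ below j whole → Dec (e ⊆ co i) → fam (kA e) x ≡ true
                    at {e} c g m (yes sub) = ≡⇒≡ᵇ (code⁻ (b 𝒟) (below j (co i)) (≡ᵇ⇒≡ c) (∈-below⁺ (proj₁ (∈-below⁻ {j = j} {s = whole} m)) sub))
                    at {e} c g m (no ¬sub) = all⁻ (λ F → fun F x) G g (∈A {outer} {[]} (∈-filter⁺ (λ e → ¬? (e Sub.⊆? co i)) m ¬sub))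

                  upper : μ (λ x → fam (kφ i) x ∧ conj G x) ≤ E (λ x → P₁ (kφ i) x * ⟦ conj G x ⟧) + ε₀
                  upper = replace-≤ j′ (co i) j′≤ b₁ (fam (kφ i)) (fam-dep (kφ i)) ε₀ (0≤recip (ε m₀)) (uniform′ (kφ i)) G small

                  lower : E (λ x → P₁ (kC i) x * ⟦ conj G x ⟧) ≤ μ (λ x → fam (kC i) x ∧ conj G x) + ε₀
                  lower = replace-≥ j′ (co i) j′≤ b₁ (fam (kC i)) (fam-dep (kC i)) ε₀ (0≤recip (ε m₀)) (uniform′ (kC i)) G small

                  -- On `T′ i` the fine density of the defect is at most 1/Θ₁ times that of the
                  -- cell; the rest of `G` lies in the part of `L` outside the intersection of the
                  -- `T′`.
                  exchange : ι Θ₁ * E (λ x → P₁ (kφ i) x * ⟦ conj G x ⟧) ≤ E (λ x → P₁ (kC i) x * ⟦ conj G x ⟧) + ι Θ₁ * Lb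
                  exchange = ≡≤ (sym (E-* (ι Θ₁) _)) (≤≡ (E-mono point) (trans (E-+ _ _) (cong (E (λ x → P₁ (kC i) x * ⟦ conj G x ⟧) +_) (E-* (ι Θ₁) _))))
                    where
                    point : ∀ x → ι Θ₁ * (P₁ (kφ i) x * ⟦ conj G x ⟧) ≤ P₁ (kC i) x * ⟦ conj G x ⟧ + ι Θ₁ * ⟦ conj L x ∧ not (allᶠ T′ x) ⟧
                    point x = trade (conj G x) (T′ i x) (conj L x ∧ not (allᶠ T′ x)) (0≤ι Θ₁) (Pr≤1 b₁ j′ (co i) (fam (kφ i)) x)
                      (λ t → ≤ᵇ⇒≤ (proj₁ (∧⁻ {clean i x} t)))
                      (λ g nt → ∧⁺ (conj-mono {G} {L} (∈L {outer} {[]}) x g) (not⁺ (λ t → not⁻ nt (all⁻ (λ i → T′ i x) (allFin r) t (∈-allFin i)))))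
                      (0≤Pr b₁ j′ (co i) (fam (kC i)) x)

                  bound : ι Θ₁ * μ (λ x → conj L′ x ∧ not (T 𝒟 i x)) ≤ X + ε₀ + ι Θ₁ * (Lb + ε₀)
                  bound = ℚ.≤-trans (*-monoˡ _ (0≤ι Θ₁) (ℚ.≤-trans (μ-mono L′⇒defect) upper)) (≡≤ (*-distribˡ-+ (ι Θ₁) _ ε₀)
                    (≤≡ (+-monoˡ (ι Θ₁ * ε₀) (ℚ.≤-trans exchange (+-monoˡ (ι Θ₁ * Lb) (ℚ.≤-trans lower (+-monoˡ ε₀ (μ-mono cell⇒L′)))))) (assemble-ring₂ X ε₀ (ι Θ₁) Lb)))

                defects : Fin r → ℚ
                defects i = μ (λ x → conj L′ x ∧ not (T 𝒟 i x))

                total : ι Θ₁ * sumF defects ≤ ι r * (X + ε₀ + ι Θ₁ * (Lb + ε₀))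
                total = ≡≤ (sym (sumF-* (ι Θ₁) defects)) (≤≡ (sumF-mono (λ i → Defect.bound i)) (sumF-const (X + ε₀ + ι Θ₁ * (Lb + ε₀))))

                L′-dense : ι Θ * μ (λ x → conj L′ x ∧ not (allᶠ (T 𝒟) x)) ≤ X
                L′-dense = ℚ.≤-trans (*-monoˡ _ (0≤ι Θ) (union-bound (conj L′) (T 𝒟)))
                  (final₂ (0<ι θ′) 1≤Θ₁ (0≤ι Θ) (0≤ι r) (0≤ι D) 0≤X total Θ₁-large θε≤Y L-dense Y≤2DX θ′-large₂)

                L′-big : 1ℚ ≤ ι C * X
                L′-big = ℚ.≤-trans L-big (ℚ.≤-trans (*-mono (0≤ι (C′ m₀)) (0≤* (0≤* 0≤two (0≤ι D)) 0≤X) (ι-mono C′≤B) Y≤2DX)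
                  (ℚ.≤-reflexive (trans (ring-c (ι B) (two * ι D) X) (cong (_* X) (sym (trans (ι-* (2 ℕ.* D) B) (cong (_* ι B) (trans (ι-* 2 D) (cong (_* ι D) ι2≡two)))))))))

                L′-small : ∀ {F} → F ∈ˡ L′ → ∣ set F ∣ ℕ.≤ j
                L′-small = L′-elim (λ F → ∣ set F ∣ ℕ.≤ j) (λ m → ℕ.m≤n⇒m≤1+n (L-small m)) (λ m → ℕ.≤-reflexive (proj₁ (∈-below⁻ {j = j} {s = whole} m)))

                absurd : ⊥
                absurd = none L′ L′-small L′-big L′-dense

              absurd : ⊥
              absurd = proj₂ (proj₂ (ih K′ θ′) m₀) n 𝒟′ Boxes.absurd

            absurd : ⊥
            absurd = pigeonhole κ* (λ x → ν 𝒟 x * ⟦ allᶠ (S 𝒟) x ∧ good x ⟧) (M≤Mx whole) heavy₂ (λ β big → choose β big)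
              where
              choose : ∀ β → 1ℚ ≤ ι (2 ℕ.* Mx) * E (λ x → ⟦ κ* x ≡ᵇ β ⟧ * (ν 𝒟 x * ⟦ allᶠ (S 𝒟) x ∧ good x ⟧)) → ⊥
              choose β big = witness sel (ν 𝒟) (ι (2 ℕ.* Mx)) (≤≡ sel-heavy (cong (ι (2 ℕ.* Mx) *_) (E-cong (λ x → *-comm _ _))))
                (λ z h → Cells.absurd sel sel-heavy z (λ x h′ → trans (at x h′) (sym (at z h))) (λ x h′ → proj₂ (∧⁻ {allᶠ (S 𝒟) x} (proj₂ (∧⁻ {κ* x ≡ᵇ β} h′))))
                   (λ i → all⁻ (λ i → S 𝒟 i z) (allFin r) (proj₁ (∧⁻ {allᶠ (S 𝒟) z} (proj₂ (∧⁻ {κ* z ≡ᵇ β} h)))) (∈-allFin i)))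
                where
                sel : V r → Bool
                sel x = (κ* x ≡ᵇ β) ∧ (allᶠ (S 𝒟) x ∧ good x)
                at : ∀ x → sel x ≡ true → κ* x ≡ β
                at x h = ≡ᵇ⇒≡ (proj₁ (∧⁻ {κ* x ≡ᵇ β} h))
                sel-heavy : 1ℚ ≤ ι (2 ℕ.* Mx) * E (λ x → ν 𝒟 x * ⟦ sel x ⟧)
                sel-heavy = ≤≡ big (cong (ι (2 ℕ.* Mx) *_) (E-cong (λ x → trans (*-swap _ (ν 𝒟 x) _) (cong (ν 𝒟 x *_) (sym (⟦∧⟧ (κ* x ≡ᵇ β) (allᶠ (S 𝒟) x ∧ good x)))))))

          absurd : ⊥
          absurd = Reg.regularise u 1 trivial start (λ b₀ b₁ fi c gap uni → Levels.absurd b₀ b₁ fi c gap uni)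
            where
            0≤energy : 0ℚ ≤ Reg.energy trivial
            0≤energy = sumF-0≤ (λ k → E-0≤ (λ x → 0≤sq _))
            start : ι N < Reg.energy trivial + ι u * recip g
            start = ℚ.<-≤-trans (subst₂ _<_ (+-identityˡ (ι N)) (sym (ι-suc N)) (+-monoˡ-< (ι N) 0<1))
              (≡≤ (sym (trans (cong (_* recip g) (ι-* (suc g) (suc N))) (trans (ring-g (ι (suc g)) (ι (suc N)) (recip g)) (trans (cong (_* ι (suc N)) (recip* g)) (*-identityˡ _)))))
                (≤-by (Reg.energy trivial) (+-comm _ _) 0≤energy))

  removal-lemma : ∀ r j → j ℕ.< r → RemovalLemma r j
  removal-lemma r zero    _   = removal-zero r
  removal-lemma r (suc j) j<r K θ = η , λ m → Complexity.C m , λ n 𝒟 none → Complexity.Fixed.WithData.absurd m n 𝒟 none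
    where open Step r j j<r (removal-lemma r j (ℕ.<-trans (ℕ.n<1+n j) j<r)) K θ

  -- A configuration of tuples

  merge-merge : ∀ {X : Set} {r} (e : Subset r) (x y z : Vec X r) → merge e (merge e x y) z ≡ merge e x z
  merge-merge []          []      []      []      = refl
  merge-merge (true  ∷ e) (a ∷ x) (b ∷ y) (c ∷ z) = cong (a ∷_) (merge-merge e x y z)
  merge-merge (false ∷ e) (a ∷ x) (b ∷ y) (c ∷ z) = cong (c ∷_) (merge-merge e x y z)

  merge-self : ∀ {X : Set} {r} (e : Subset r) (x : Vec X r) → merge e x x ≡ x
  merge-self []          []      = refl
  merge-self (true  ∷ e) (a ∷ x) = cong (a ∷_) (merge-self e x)
  merge-self (false ∷ e) (a ∷ x) = cong (a ∷_) (merge-self e x)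

  merge-full : ∀ {X : Set} {r} (x y : Vec X r) → merge (∁ (Subset.⊥)) x y ≡ x
  merge-full []      []      = refl
  merge-full (a ∷ x) (b ∷ y) = cong (a ∷_) (merge-full x y)

  merge-co : ∀ {X : Set} {r} (i : Fin r) (x y : Vec X r) → merge (co i) x y ≡ x [ i ]≔ lookup y i
  merge-co zero    (a ∷ x) (b ∷ y) = cong (b ∷_) (merge-full x y)
  merge-co (suc i) (a ∷ x) (b ∷ y) = cong (a ∷_) (merge-co i x y)

  Dep-co : ∀ {X A : Set} {r} {i : Fin r} {f : Vec X r → A} → Dep (co i) f → ∀ x a → f (x [ i ]≔ a) ≡ f x
  Dep-co {i = i} {f} d x a = trans (cong f (sym (trans (merge-co i x (x [ i ]≔ a)) (cong (x [ i ]≔_) (Vec.lookup∘updateAt i x))))) (d x (x [ i ]≔ a))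

  opaque
    unfolding ℚring

    ring-h : ∀ i w e N m → i * w * (e * (N * m)) ≡ e * (N * w) * (m * i)
    ring-h = solve-∀ ℚring

    half-ring : ∀ Y A B → two * A - Y ≡ two * (A + B - Y) + (Y - two * B)
    half-ring = solve-∀ ℚring

    ring-j : ∀ N w R → N * (R * w * (R * w)) ≡ R * R * w * (N * w)
    ring-j = solve-∀ ℚring

    ring-k : ∀ R w r Q → R * w + r * (r * (Q * w)) ≡ (R + r * (r * Q)) * w
    ring-k = solve-∀ ℚring

    ring-l : ∀ i R w m → i * (R * w * m) ≡ R * (i * w) * m
    ring-l = solve-∀ ℚring

    ring-m : ∀ N C D w → N * (C * (D * w)) ≡ C * D * (N * w)
    ring-m = solve-∀ ℚring

  module Configuration (n r : ℕ) (X : Vec (Fin (suc n)) r → Bool) (R : ℕ) where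
    open Average n
    open Partitions n r
    open Factors n r
    open RemovalData n r

    -- Extendability to a point of `X`, written as a positive average so that it is a Boolean
    -- function of `x`. For facets the extension is recovered by `shadow⇒X`.
    shadow : Subset r → V r → Bool
    shadow e x = not (E (λ y → ⟦ X (merge e x y) ⟧) ≤ᵇ 0ℚ)

    shadow-dep : ∀ e → Dep e (shadow e)
    shadow-dep e x y = cong (λ u → not (u ≤ᵇ 0ℚ)) (E-cong (λ z → cong (λ v → ⟦ X v ⟧) (merge-merge e x y z)))

    X⇒shadow : ∀ e x → X x ≡ true → shadow e x ≡ true
    X⇒shadow e x h = not⁺ (λ le → ℚ.<-irrefl refl (ℚ.<-≤-trans (E-0< (λ y → 0≤⟦⟧ (X (merge e x y))) x
      (subst (0ℚ <_) (cong ⟦_⟧ (sym (trans (cong X (merge-self e x)) h))) 0<1)) (≤ᵇ⇒≤ le)))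

    shadow⇒X : ∀ i x → shadow (co i) x ≡ true → Σ (Fin (suc n)) λ a → X (x [ i ]≔ a) ≡ true
    shadow⇒X i x h with Fin.any? (λ a → X (x [ i ]≔ a) Bool.≟ true)
    ... | yes p = p
    ... | no ¬p = ⊥-elim (not⁻ h (≤⇒≤ᵇ (ℚ.≤-reflexive (trans (E-cong (λ y → cong ⟦_⟧ (none y))) (E-const {r} 0ℚ)))))
      where
      none : ∀ y → X (merge (co i) x y) ≡ false
      none y = trans (cong X (merge-co i x y)) (Bool.¬-not (λ eq → ¬p (lookup y i , eq)))

    module _ (rows : ∀ i x → avg (λ a → ⟦ X (x [ i ]≔ a) ⟧) ≤ ι R * w) where

      0≤Rw : 0ℚ ≤ ι R * w
      0≤Rw = 0≤* (0≤ι R) 0≤w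

      E-rows : ∀ i (f : V r → Bool) → Dep (co i) f → E (λ x → ⟦ X x ⟧ * ⟦ f x ⟧) ≤ ι R * w * μ f
      E-rows i f fd = ≡≤ (E-resample i _) (≤≡ (E-mono (λ x → ≡≤ (trans (avg-cong (λ a → trans (*-comm _ _) (cong (λ c → ⟦ c ⟧ * ⟦ X (x [ i ]≔ a) ⟧) (Dep-co fd x a)))) (avg-* ⟦ f x ⟧ _))
        (*-monoˡ _ (0≤⟦⟧ (f x)) (rows i x)))) (trans (E-cong (λ x → *-comm _ _)) (E-* _ _)))

      μX≤ : Fin r → μ X ≤ ι R * w
      μX≤ i = ≡≤ (E-resample i _) (E-≤ (rows i))

      -- Resampling coordinate `i` leaves the first factor unchanged and costs R/n on the second;
      -- resampling `k` then costs R/n on the first. Over the n values of `c` this makes O(1/n).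
      collision≤ : ∀ i k → i ≢ k → ∀ c → E (λ x → ⟦ X (x [ i ]≔ c) ⟧ * ⟦ X (x [ k ]≔ c) ⟧) ≤ ι R * w * (ι R * w)
      collision≤ i k i≢k c = ≡≤ (E-resample i _) (ℚ.≤-trans (E-mono first) (≡≤ (E-* (ι R * w) (λ x → ⟦ X (x [ i ]≔ c) ⟧)) (*-monoˡ _ 0≤Rw
          (≡≤ (E-resample k _) (E-≤ second)))))
        where
        first : ∀ x → avg (λ a → ⟦ X ((x [ i ]≔ a) [ i ]≔ c) ⟧ * ⟦ X ((x [ i ]≔ a) [ k ]≔ c) ⟧) ≤ ι R * w * ⟦ X (x [ i ]≔ c) ⟧
        first x = ≡≤ (trans (avg-cong (λ a → cong₂ (λ u v → ⟦ X u ⟧ * ⟦ X v ⟧) (Vec.[]≔-idempotent x i) (Vec.[]≔-commutes x i k i≢k))) (avg-* ⟦ X (x [ i ]≔ c) ⟧ _))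
          (≤≡ (*-monoˡ _ (0≤⟦⟧ (X (x [ i ]≔ c))) (rows i (x [ k ]≔ c))) (*-comm _ _))
        second : ∀ x → avg (λ a → ⟦ X ((x [ k ]≔ a) [ i ]≔ c) ⟧) ≤ ι R * w
        second x = ≡≤ (avg-cong (λ a → cong (λ u → ⟦ X u ⟧) (Vec.[]≔-commutes x k i (λ eq → i≢k (sym eq))))) (rows k (x [ i ]≔ c))

      collisions : Fin r → Fin r → V r → ℚ
      collisions i k x with i Fin.≟ k
      ... | yes _ = 0ℚ
      ... | no _  = sumF (λ c → ⟦ X (x [ i ]≔ c) ⟧ * ⟦ X (x [ k ]≔ c) ⟧)

      0≤collisions : ∀ i k x → 0ℚ ≤ collisions i k x
      0≤collisions i k x with i Fin.≟ k
      ... | yes _ = ℚ.≤-refl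
      ... | no _  = sumF-0≤ (λ c → 0≤* (0≤⟦⟧ (X (x [ i ]≔ c))) (0≤⟦⟧ (X (x [ k ]≔ c))))

      1≤collisions : ∀ {i k x c} → i ≢ k → X (x [ i ]≔ c) ≡ true → X (x [ k ]≔ c) ≡ true → 1ℚ ≤ collisions i k x
      1≤collisions {i} {k} {x} {c} i≢k p q with i Fin.≟ k
      ... | yes eq = contradiction eq i≢k
      ... | no _ = ≡≤ (sym (trans (cong₂ (λ u v → ⟦ u ⟧ * ⟦ v ⟧) p q) (*-identityʳ 1ℚ)))
        (sumF-term {f = λ c → ⟦ X (x [ i ]≔ c) ⟧ * ⟦ X (x [ k ]≔ c) ⟧} (λ c → 0≤* (0≤⟦⟧ (X (x [ i ]≔ c))) (0≤⟦⟧ (X (x [ k ]≔ c)))) c)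

      E-collisions : ∀ i k → E (collisions i k) ≤ ι (R ℕ.* R) * w
      E-collisions i k with i Fin.≟ k
      ... | yes _ = ≡≤ (E-const {r} 0ℚ) (0≤* (0≤ι (R ℕ.* R)) 0≤w)
      ... | no i≢k = ≡≤ (E-sumF _) (ℚ.≤-trans (sumF-mono (collision≤ i k i≢k)) (ℚ.≤-reflexive (trans (sumF-const _)
          (trans (ring-j (ι (suc n)) w (ι R)) (trans (cong (λ u → ι R * ι R * w * u) N*w) (trans (*-identityʳ _) (cong (_* w) (sym (ι-* R R)))))))))

      errors : ℕ
      errors = R ℕ.+ r ℕ.* (r ℕ.* (R ℕ.* R))

      -- Outside an event of measure O(1/n), a point all of whose coordinates can be shifted into X is a configuration.
      sparse : Fin r → (∀ x (c : Fin r → Fin (suc n)) → (∀ i → X (x [ i ]≔ c i) ≡ true) → ¬ (X x ≡ true) → (∀ {i k} → c i ≡ c k → i ≡ k) → ⊥) →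
               μ (allᶠ (λ i → shadow (co i))) ≤ ι errors * w
      sparse i₀ none = ℚ.≤-trans (E-mono pointwise) (≡≤ (trans (E-+ _ _) (cong (μ X +_) (trans (E-sumF _) (sumF-cong (λ i → E-sumF (collisions i))))))
          (≤≡ (+-mono (μX≤ i₀) (sumF-mono (λ i → ℚ.≤-trans (sumF-mono (E-collisions i)) (ℚ.≤-reflexive (sumF-const {r} (ι (R ℕ.* R) * w)))))) total))
        where
        total : ι R * w + sumF {r} (λ i → ι r * (ι (R ℕ.* R) * w)) ≡ ι errors * w
        total = trans (cong (ι R * w +_) (sumF-const {r} _)) (trans (ring-k (ι R) w (ι r) (ι (R ℕ.* R)))
          (cong (_* w) (sym (trans (ι-+ R _) (cong (ι R +_) (trans (ι-* r _) (cong (ι r *_) (ι-* r (R ℕ.* R)))))))))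
        Σcoll : V r → ℚ
        Σcoll x = sumF (λ i → sumF (λ k → collisions i k x))
        0≤Σcoll : ∀ x → 0ℚ ≤ Σcoll x
        0≤Σcoll x = sumF-0≤ (λ i → sumF-0≤ (λ k → 0≤collisions i k x))
        pointwise : ∀ x → ⟦ allᶠ (λ i → shadow (co i)) x ⟧ ≤ ⟦ X x ⟧ + Σcoll x
        pointwise x = ⟦⟧-≤ _ (0≤+ (0≤⟦⟧ (X x)) (0≤Σcoll x)) found
          where
          found : allᶠ (λ i → shadow (co i)) x ≡ true → 1ℚ ≤ ⟦ X x ⟧ + Σcoll x
          found h with X x Bool.≟ true
          ... | yes p = ≤-by (Σcoll x) (cong (λ u → ⟦ u ⟧ + Σcoll x) p) (0≤Σcoll x)
          ... | no ¬p with Fin.any? (λ i → Fin.any? (λ k → ¬? (i Fin.≟ k) ×-dec (c i Fin.≟ c k)))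
            where
            c : Fin r → Fin (suc n)
            c i = proj₁ (shadow⇒X i x (all⁻ (λ i → shadow (co i) x) (allFin r) h (∈-allFin i)))
          ...   | yes (i , k , i≢k , ci≡ck) = ℚ.≤-trans (ℚ.≤-trans (1≤collisions {i} {k} {x} {c k} i≢k
                    (subst (λ u → X (x [ i ]≔ u) ≡ true) ci≡ck (c-X i)) (c-X k))
                    (ℚ.≤-trans (sumF-term {f = λ k → collisions i k x} (λ k → 0≤collisions i k x) k) (sumF-term {f = λ i → sumF (λ k → collisions i k x)} (λ i → sumF-0≤ (λ k → 0≤collisions i k x)) i)))
                    (≤-by ⟦ X x ⟧ (+-comm _ _) (0≤⟦⟧ (X x)))
            where
            c : Fin r → Fin (suc n)
            c i = proj₁ (shadow⇒X i x (all⁻ (λ i → shadow (co i) x) (allFin r) h (∈-allFin i)))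
            c-X : ∀ i → X (x [ i ]≔ c i) ≡ true
            c-X i = proj₂ (shadow⇒X i x (all⁻ (λ i → shadow (co i) x) (allFin r) h (∈-allFin i)))
          ...   | no ¬q = ⊥-elim (none x (λ i → proj₁ (sh i)) (λ i → proj₂ (sh i)) ¬p inj)
            where
            sh : ∀ i → Σ (Fin (suc n)) λ a → X (x [ i ]≔ a) ≡ true
            sh i = shadow⇒X i x (all⁻ (λ i → shadow (co i) x) (allFin r) h (∈-allFin i))
            inj : ∀ {i k} → proj₁ (sh i) ≡ proj₁ (sh k) → i ≡ k
            inj {i} {k} eq with i Fin.≟ k
            ... | yes p = p
            ... | no ne = contradiction (i , k , ne , eq) ¬q

      module _ (e : ℕ) (dense : 1ℚ ≤ ι e * (ι (suc n) * μ X)) where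

        0<μX : 0ℚ < μ X
        0<μX with 0ℚ ℚ.<? μ X
        ... | yes p = p
        ... | no ¬p = ⊥-elim (ℚ.<-irrefl refl (ℚ.<-≤-trans 0<1 (≤≡ dense (trans (cong (λ u → ι e * (ι (suc n) * u)) (ℚ.≤-antisym (ℚ.≮⇒≥ ¬p) (0≤μ X)))
                         (trans (cong (ι e *_) (*-zeroʳ _)) (*-zeroʳ _))))))

        normal : inv (μ X) * w ≤ ι e
        normal = ≡≤ (sym (*-identityʳ _)) (≤≡ (*-monoˡ _ (0≤* (0≤inv 0<μX) 0≤w) dense) (trans (ring-h (inv (μ X)) w (ι e) (ι (suc n)) (μ X))
          (trans (cong₂ (λ u v → ι e * u * v) N*w (*-inv 0<μX)) (trans (*-identityʳ _) (*-identityʳ _)))))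

        system : Sys 2
        system = record { class = λ e x → bit (shadow e x) ; dep = λ e x y → cong bit (shadow-dep e x y) }

        S₀ : Fin r → V r → Bool
        S₀ i = shadow (co i)

        -- ν is the uniform density on `X`; by `normal` its marginals are at most R·e. Two classes
        -- per face, in the shadow or not, suffice at level r-1, and with `S` and `T` equal there is
        -- no defect, whatever `η` is.
        start : ∀ η → Data (r ℕ.∸ 1) (R ℕ.* e) η 2
        start η = record
          { ν = λ x → inv (μ X) * ⟦ X x ⟧
          ; 0≤ν = λ x → 0≤* (0≤inv 0<μX) (0≤⟦⟧ (X x))
          ; marginal = λ i f fd → ≡≤ (trans (E-cong (λ x → *-assoc _ _ _)) (E-* (inv (μ X)) _)) (ℚ.≤-trans (*-monoˡ _ (0≤inv 0<μX) (E-rows i f fd))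
              (≡≤ (ring-l (inv (μ X)) (ι R) w (μ f)) (≤≡ (*-monoʳ (μ f) (0≤μ f) (*-monoˡ (ι R) (0≤ι R) normal)) (cong (_* μ f) (sym (ι-* R e))))))
          ; b = system
          ; S = S₀
          ; T = S₀
          ; S-inv = λ i eq → bit-injective (code⁻ system (below (r ℕ.∸ 1) (co i)) eq (∈-below⁺ (∣co∣ i) (λ x∈ → x∈)))
          ; T-dep = λ i → shadow-dep (co i)
          ; heavy = ℚ.≤-reflexive (sym (trans (E-cong (λ x → ⟦⟧-absorb (inv (μ X)) (X x) (allᶠ S₀ x) (λ h → all⁺ (λ i → S₀ i x) (allFin r) (λ {i} _ → X⇒shadow (co i) x h))))
              (trans (E-* _ _) (trans (*-comm _ _) (*-inv 0<μX)))))
          ; close = λ i → ≡≤ (trans (cong (ι (suc η) *_) (trans (E-cong (λ x → cong ⟦_⟧ (Bool.∧-inverseʳ (S₀ i x)))) (E-const {r} 0ℚ))) (*-zeroʳ _)) 0≤1 }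

        -- With θ = 1 at least half of a dense box lies in the intersection of the shadows, so that
        -- intersection has measure at least 1/(2C).
        extract : ∀ {C} → NoDenseBox (r ℕ.∸ 1) 1 C S₀ ⊎ 1ℚ ≤ ι (2 ℕ.* C) * μ (allᶠ S₀)
        extract {C} with 1ℚ ℚ.≤? ι (2 ℕ.* C) * μ (allᶠ S₀)
        ... | yes p = inj₂ p
        ... | no ¬p = inj₁ (λ L _ big dense′ → ¬p (ℚ.≤-trans big (ℚ.≤-trans (*-monoˡ _ (0≤ι C) (half L dense′))
                        (ℚ.≤-reflexive (trans (ring-c (ι C) two (μ (allᶠ S₀))) (cong (_* μ (allᶠ S₀)) (trans (cong (_* ι C) (sym ι2≡two)) (sym (ι-* 2 C)))))))))
          where
          half : ∀ L → ι 2 * μ (λ x → conj L x ∧ not (allᶠ S₀ x)) ≤ μ (conj L) → μ (conj L) ≤ two * μ (allᶠ S₀)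
          half L dense′ = 0≤⇒≤ (subst (0ℚ ≤_) (sym (half-ring (μ (conj L)) (μ (allᶠ S₀)) (μ (λ x → conj L x ∧ not (allᶠ S₀ x)))))
            (0≤+ (0≤* 0≤two (≤⇒0≤ (≤≡ (E-mono (λ x → split-case (conj L x) (allᶠ S₀ x) (allᶠ S₀ x) (λ _ t → t))) (E-+ _ _))))
                 (≤⇒0≤ (≡≤ (cong (_* μ (λ x → conj L x ∧ not (allᶠ S₀ x))) (sym ι2≡two)) dense′))))

  -- The intersection of the shadows would have measure at least 1/(2C) by the removal lemma, but
  -- only O(1/n) by `sparse` if no configuration existed; `n₀` is where the two bounds conflict.
  configuration : ∀ r′ R e → Σ ℕ λ n₀ → ∀ n → n₀ ℕ.≤ n → let open Average n in
    (X : V (suc r′) → Bool) → (∀ i x → avg (λ a → ⟦ X (x [ i ]≔ a) ⟧) ≤ ι R * w) → 1ℚ ≤ ι e * (ι (suc n) * μ X) →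
    (∀ x (c : Fin (suc r′) → Fin (suc n)) → (∀ i → X (x [ i ]≔ c i) ≡ true) → ¬ (X x ≡ true) → (∀ {i k} → c i ≡ c k → i ≡ k) → ⊥) → ⊥
  configuration r′ R e = 2 ℕ.* C ℕ.* errs , λ n n₀≤n X rows dense none →
      let open Configuration n r X R in
      [ proj₂ (proj₂ (removal-lemma r r′ ℕ.≤-refl (R ℕ.* e) 1) 2) n (start rows e dense η)
      , (λ big → impossible n n₀≤n (ℚ.≤-trans big (*-monoˡ _ (0≤ι (2 ℕ.* C)) (sparse rows zero none)))) ]′ (extract rows e dense {C})
    where
    r = suc r′
    η = proj₁ (removal-lemma r r′ ℕ.≤-refl (R ℕ.* e) 1)
    C = proj₁ (proj₂ (removal-lemma r r′ ℕ.≤-refl (R ℕ.* e) 1) 2)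
    errs = R ℕ.+ r ℕ.* (r ℕ.* (R ℕ.* R))
    impossible : ∀ n → 2 ℕ.* C ℕ.* errs ℕ.≤ n → let open Average n in 1ℚ ≤ ι (2 ℕ.* C) * (ι errs * w) → ⊥
    impossible n n₀≤n big = ℕ.<-irrefl refl (ℕ.<-≤-trans (ℕ.s≤s n₀≤n) (ι-cancel
        (≡≤ (sym (*-identityʳ (ι (suc n)))) (≤≡ (*-monoˡ _ (0≤ι (suc n)) big) (trans (ring-m (ι (suc n)) (ι (2 ℕ.* C)) (ι errs) w)
          (trans (cong (ι (2 ℕ.* C) * ι errs *_) N*w) (trans (*-identityʳ _) (sym (ι-* (2 ℕ.* C) errs)))))))))
      where open Average n

  open import Defs

  -- Tuples and their underlying sets

  module _ {n : ℕ} where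

    setOf : ∀ {m} → Vec (Fin n) m → Subset n
    setOf []      = Subset.⊥
    setOf (a ∷ x) = ⁅ a ⁆ ∪ setOf x

    setOf⁺ : ∀ {m} (x : Vec (Fin n) m) i → lookup x i ∈ setOf x
    setOf⁺ (a ∷ x) zero    = Sub.x∈p∪q⁺ (inj₁ (Sub.x∈⁅x⁆ a))
    setOf⁺ (a ∷ x) (suc i) = Sub.x∈p∪q⁺ (inj₂ (setOf⁺ x i))

    setOf⁻ : ∀ {m} (x : Vec (Fin n) m) {v} → v ∈ setOf x → Σ (Fin m) λ i → lookup x i ≡ v
    setOf⁻ []      v∈ = ⊥-elim (Sub.∉⊥ v∈)
    setOf⁻ (a ∷ x) v∈ with Sub.x∈p∪q⁻ ⁅ a ⁆ (setOf x) v∈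
    ... | inj₁ p = zero , sym (Sub.x∈⁅y⁆⇒x≡y a p)
    ... | inj₂ p with setOf⁻ x p
    ...   | i , eq = suc i , eq

    Distinct : ∀ {m} → Vec (Fin n) m → Set
    Distinct x = ∀ {i j} → lookup x i ≡ lookup x j → i ≡ j

    ∣⁅a⁆∪p∣≤ : ∀ a (p : Subset n) → ∣ ⁅ a ⁆ ∪ p ∣ ℕ.≤ suc ∣ p ∣
    ∣⁅a⁆∪p∣≤ a p = ℕ.≤-trans (∣∪∣≤ ⁅ a ⁆ p) (ℕ.≤-reflexive (cong (ℕ._+ ∣ p ∣) (Sub.∣⁅x⁆∣≡1 a)))
      where
      ∣∪∣≤ : ∀ {n} (p q : Subset n) → ∣ p ∪ q ∣ ℕ.≤ ∣ p ∣ ℕ.+ ∣ q ∣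
      ∣∪∣≤ []          []          = ℕ.z≤n
      ∣∪∣≤ (true ∷ p)  (true ∷ q)  = ℕ.s≤s (ℕ.≤-trans (∣∪∣≤ p q) (ℕ.+-monoʳ-≤ ∣ p ∣ (ℕ.n≤1+n ∣ q ∣)))
      ∣∪∣≤ (true ∷ p)  (false ∷ q) = ℕ.s≤s (∣∪∣≤ p q)
      ∣∪∣≤ (false ∷ p) (true ∷ q)  = ℕ.≤-trans (ℕ.s≤s (∣∪∣≤ p q)) (ℕ.≤-reflexive (sym (ℕ.+-suc ∣ p ∣ ∣ q ∣)))
      ∣∪∣≤ (false ∷ p) (false ∷ q) = ∣∪∣≤ p q

    ∣setOf∣≤ : ∀ {m} (x : Vec (Fin n) m) → ∣ setOf x ∣ ℕ.≤ m
    ∣setOf∣≤ []      = ℕ.≤-reflexive (Sub.∣⊥∣≡0 n)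
    ∣setOf∣≤ (a ∷ x) = ℕ.≤-trans (∣⁅a⁆∪p∣≤ a (setOf x)) (ℕ.s≤s (∣setOf∣≤ x))

    absorb : ∀ {a} {p : Subset n} → a ∈ p → ⁅ a ⁆ ∪ p ≡ p
    absorb {a} {p} a∈p = Sub.⊆-antisym (λ v∈ → [ (λ v∈a → subst (_∈ p) (sym (Sub.x∈⁅y⁆⇒x≡y a v∈a)) a∈p) , (λ z → z) ]′ (Sub.x∈p∪q⁻ ⁅ a ⁆ p v∈)) (Sub.q⊆p∪q ⁅ a ⁆ p)

    ∣setOf∣≡⇒Distinct : ∀ {m} (x : Vec (Fin n) m) → ∣ setOf x ∣ ≡ m → Distinct x
    ∣setOf∣≡⇒Distinct {suc m} (a ∷ x) eq = dist
      where
      tight : ∣ setOf x ∣ ≡ m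
      tight = ℕ.≤-antisym (∣setOf∣≤ x) (ℕ.≤-pred (subst (ℕ._≤ suc ∣ setOf x ∣) eq (∣⁅a⁆∪p∣≤ a (setOf x))))
      fresh : ∀ i → a ≢ lookup x i
      fresh i refl = ℕ.<-irrefl (trans (sym tight) (trans (cong ∣_∣ (sym (absorb (setOf⁺ x i)))) eq)) (ℕ.n<1+n m)
      dist : Distinct (a ∷ x)
      dist {zero}  {zero}  _ = refl
      dist {zero}  {suc j} e = contradiction e (fresh j)
      dist {suc i} {zero}  e = contradiction (sym e) (fresh i)
      dist {suc i} {suc j} e = cong suc (∣setOf∣≡⇒Distinct x tight e)

    setOf-update : ∀ {m} (x : Vec (Fin n) m) → Distinct x → ∀ i a → setOf (x [ i ]≔ a) ≡ (setOf x ∖ lookup x i) ∪ ⁅ a ⁆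
    setOf-update x dx i a = Sub.⊆-antisym to from
      where
      to : setOf (x [ i ]≔ a) ⊆ (setOf x ∖ lookup x i) ∪ ⁅ a ⁆
      to v∈ with setOf⁻ (x [ i ]≔ a) v∈
      ... | l , refl with l Fin.≟ i
      ...   | yes refl = Sub.x∈p∪q⁺ (inj₂ (subst (_∈ ⁅ a ⁆) (sym (Vec.lookup∘updateAt i x)) (Sub.x∈⁅x⁆ a)))
      ...   | no l≢i = Sub.x∈p∪q⁺ (inj₁ (subst (_∈ (setOf x ∖ lookup x i)) (sym (Vec.lookup∘updateAt′ l i l≢i x))
                         (Sub.x∈p∧x≢y⇒x∈p-y (setOf⁺ x l) (λ eq → l≢i (dx eq)))))
      from : (setOf x ∖ lookup x i) ∪ ⁅ a ⁆ ⊆ setOf (x [ i ]≔ a)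
      from v∈ with Sub.x∈p∪q⁻ (setOf x ∖ lookup x i) ⁅ a ⁆ v∈
      ... | inj₂ v∈a with refl ← Sub.x∈⁅y⁆⇒x≡y a v∈a = subst (_∈ setOf (x [ i ]≔ a)) (Vec.lookup∘updateAt i x) (setOf⁺ (x [ i ]≔ a) i)
      ... | inj₁ v∈ with setOf⁻ x (Sub.p─q⊆p (setOf x) ⁅ lookup x i ⁆ v∈)
      ...   | l , refl with l Fin.≟ i
      ...     | no l≢i = subst (_∈ setOf (x [ i ]≔ a)) (Vec.lookup∘updateAt′ l i l≢i x) (setOf⁺ (x [ i ]≔ a) l)
      ...     | yes refl = ⊥-elim (x∉p-x (setOf x) v∈)
        where
        x∉p-x : ∀ {n} (p : Subset n) {x} → x ∉ (p ∖ x)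
        x∉p-x (true ∷ p)  {zero}  ()
        x∉p-x (false ∷ p) {zero}  ()
        x∉p-x (b ∷ p)     {suc x} (there h) = x∉p-x p h

    image⁺ : ∀ {m} (f : Fin m → Fin n) (e : Subset m) {u} → u ∈ e → f u ∈ image f e
    image⁺ f (true ∷ e)  here      = Sub.x∈p∪q⁺ (inj₁ (Sub.x∈⁅x⁆ (f zero)))
    image⁺ f (b ∷ e)     (there p) = Sub.x∈p∪q⁺ (inj₂ (image⁺ (λ i → f (suc i)) e p))

    image⁻ : ∀ {m} (f : Fin m → Fin n) (e : Subset m) {v} → v ∈ image f e → Σ (Fin m) λ u → u ∈ e × f u ≡ v
    image⁻ f [] v∈ = ⊥-elim (Sub.∉⊥ v∈)
    image⁻ f (false ∷ e) v∈ with Sub.x∈p∪q⁻ Subset.⊥ (image (λ i → f (suc i)) e) v∈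
    ... | inj₁ p = ⊥-elim (Sub.∉⊥ p)
    ... | inj₂ p with image⁻ (λ i → f (suc i)) e p
    ...   | u , u∈ , eq = suc u , there u∈ , eq
    image⁻ f (true ∷ e) v∈ with Sub.x∈p∪q⁻ ⁅ f zero ⁆ (image (λ i → f (suc i)) e) v∈
    ... | inj₁ p = zero , here , sym (Sub.x∈⁅y⁆⇒x≡y (f zero) p)
    ... | inj₂ p with image⁻ (λ i → f (suc i)) e p
    ...   | u , u∈ , eq = suc u , there u∈ , eq

  -- The vertices of Q_k(r)

  ↑ˡ≢↑ʳ : ∀ {m n} (i : Fin m) (j : Fin n) → i ↑ˡ n ≢ m ↑ʳ j
  ↑ˡ≢↑ʳ zero    j ()
  ↑ˡ≢↑ʳ (suc i) j eq = ↑ˡ≢↑ʳ i j (Fin.suc-injective eq)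

  module Vertices (k r : ℕ) where

    vA : Fin (k ℕ.∸ r) → Fin ((k ℕ.∸ r) ℕ.+ r ℕ.+ r)
    vA a = (a ↑ˡ r) ↑ˡ r

    vB vC : Fin r → Fin ((k ℕ.∸ r) ℕ.+ r ℕ.+ r)
    vB j = ((k ℕ.∸ r) ↑ʳ j) ↑ˡ r
    vC j = ((k ℕ.∸ r) ℕ.+ r) ↑ʳ j

    data View : Fin ((k ℕ.∸ r) ℕ.+ r ℕ.+ r) → Set where
      isA : ∀ a → View (vA a)
      isB : ∀ j → View (vB j)
      isC : ∀ j → View (vC j)

    view : ∀ u → View u
    view u with splitAt ((k ℕ.∸ r) ℕ.+ r) u in eq
    ... | inj₂ j with refl ← trans (sym (Fin.join-splitAt ((k ℕ.∸ r) ℕ.+ r) r u)) (cong (join ((k ℕ.∸ r) ℕ.+ r) r) eq) = isC j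
    ... | inj₁ v with splitAt (k ℕ.∸ r) v in eq′
    ...   | inj₁ a with refl ← trans (sym (Fin.join-splitAt (k ℕ.∸ r) r v)) (cong (join (k ℕ.∸ r) r) eq′)
                   with refl ← trans (sym (Fin.join-splitAt ((k ℕ.∸ r) ℕ.+ r) r u)) (cong (join ((k ℕ.∸ r) ℕ.+ r) r) eq) = isA a
    ...   | inj₂ j with refl ← trans (sym (Fin.join-splitAt (k ℕ.∸ r) r v)) (cong (join (k ℕ.∸ r) r) eq′)
                   with refl ← trans (sym (Fin.join-splitAt ((k ℕ.∸ r) ℕ.+ r) r u)) (cong (join ((k ℕ.∸ r) ℕ.+ r) r) eq) = isB j

    module _ (i : Fin r) where

      -- The function tabulated by `QEdge` is local to that definition; unification recovers it here
      -- so that its values can be computed by rewriting.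
      entries : Σ (Fin ((k ℕ.∸ r) ℕ.+ r ℕ.+ r) → Bool) λ f → QEdge k r i ≡ Vec.tabulate f
      entries = _ , refl

      QEdge-lookup : ∀ u → lookup (QEdge k r i) u ≡ proj₁ entries u
      QEdge-lookup u = Vec.lookup∘tabulate _ u

      entry-A : ∀ a → proj₁ entries (vA a) ≡ true
      entry-A a rewrite Fin.splitAt-↑ˡ ((k ℕ.∸ r) ℕ.+ r) (a ↑ˡ r) r | Fin.splitAt-↑ˡ (k ℕ.∸ r) a r = refl

      entry-B : ∀ j → proj₁ entries (vB j) ≡ not ⌊ j Fin.≟ i ⌋
      entry-B j rewrite Fin.splitAt-↑ˡ ((k ℕ.∸ r) ℕ.+ r) ((k ℕ.∸ r) ↑ʳ j) r | Fin.splitAt-↑ʳ (k ℕ.∸ r) r j = refl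

      entry-C : ∀ j → proj₁ entries (vC j) ≡ ⌊ j Fin.≟ i ⌋
      entry-C j rewrite Fin.splitAt-↑ʳ ((k ℕ.∸ r) ℕ.+ r) r j = refl

      A∈ : ∀ a → vA a ∈ QEdge k r i
      A∈ a = Vec.lookup⇒[]= (vA a) (QEdge k r i) (trans (QEdge-lookup (vA a)) (entry-A a))

      B∈ : ∀ {j} → j ≢ i → vB j ∈ QEdge k r i
      B∈ {j} j≢i = Vec.lookup⇒[]= (vB j) (QEdge k r i) (trans (QEdge-lookup (vB j)) (trans (entry-B j) (not⁺ (λ eq → j≢i (≡ᵇ⇒≡ eq)))))

      C∈ : vC i ∈ QEdge k r i
      C∈ = Vec.lookup⇒[]= (vC i) (QEdge k r i) (trans (QEdge-lookup (vC i)) (trans (entry-C i) (≡⇒≡ᵇ refl)))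

      B∈⁻ : ∀ {j} → vB j ∈ QEdge k r i → j ≢ i
      B∈⁻ {j} h eq = not⁻ (trans (sym (entry-B j)) (trans (sym (QEdge-lookup (vB j))) (Vec.[]=⇒lookup h))) (≡⇒≡ᵇ eq)

      C∈⁻ : ∀ {j} → vC j ∈ QEdge k r i → j ≡ i
      C∈⁻ {j} h = ≡ᵇ⇒≡ (trans (sym (entry-C j)) (trans (sym (QEdge-lookup (vC j))) (Vec.[]=⇒lookup h)))

    -- The tuple `x` plays B, `y` plays A and `c` plays C; replacing entry `i` of `x` by `c i` is
    -- exactly the exchange of b_i for c_i.
    module Embed {n : ℕ} (H : KGraph k n) (x : Vec (Fin n) r) (y : Vec (Fin n) (k ℕ.∸ r)) (c : Fin r → Fin n)
      (dist : Distinct (x Vec.++ y)) (fresh : ∀ i u → c i ≢ lookup (x Vec.++ y) u) (c-inj : ∀ {i j} → c i ≡ c j → i ≡ j)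
      (edge : ∀ i → setOf ((x [ i ]≔ c i) Vec.++ y) ∈ˡ edges H) where

      place : Fin (k ℕ.∸ r) ⊎ Fin r → Fin n
      place (inj₁ a) = lookup y a
      place (inj₂ j) = lookup x j

      φ′ : Fin ((k ℕ.∸ r) ℕ.+ r) ⊎ Fin r → Fin n
      φ′ (inj₁ v) = place (splitAt (k ℕ.∸ r) v)
      φ′ (inj₂ j) = c j

      φ : Fin ((k ℕ.∸ r) ℕ.+ r ℕ.+ r) → Fin n
      φ u = φ′ (splitAt ((k ℕ.∸ r) ℕ.+ r) u)

      lookup-x : ∀ j → lookup (x Vec.++ y) (j ↑ˡ (k ℕ.∸ r)) ≡ lookup x j
      lookup-x j = Vec.lookup-++ˡ x y j

      lookup-y : ∀ a → lookup (x Vec.++ y) (r ↑ʳ a) ≡ lookup y a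
      lookup-y a = Vec.lookup-++ʳ x y a

      φA : ∀ a → φ (vA a) ≡ lookup (x Vec.++ y) (r ↑ʳ a)
      φA a = trans (cong φ′ (Fin.splitAt-↑ˡ ((k ℕ.∸ r) ℕ.+ r) (a ↑ˡ r) r)) (trans (cong place (Fin.splitAt-↑ˡ (k ℕ.∸ r) a r)) (sym (lookup-y a)))

      φB : ∀ j → φ (vB j) ≡ lookup (x Vec.++ y) (j ↑ˡ (k ℕ.∸ r))
      φB j = trans (cong φ′ (Fin.splitAt-↑ˡ ((k ℕ.∸ r) ℕ.+ r) ((k ℕ.∸ r) ↑ʳ j) r)) (trans (cong place (Fin.splitAt-↑ʳ (k ℕ.∸ r) r j)) (sym (lookup-x j)))

      φC : ∀ j → φ (vC j) ≡ c j
      φC j = cong φ′ (Fin.splitAt-↑ʳ ((k ℕ.∸ r) ℕ.+ r) r j)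

      φ-inj : ∀ u v → View u → View v → φ u ≡ φ v → u ≡ v
      φ-inj _ _ (isA a) (isA a′) eq = cong vA (Fin.↑ʳ-injective r a a′ (dist (trans (sym (φA a)) (trans eq (φA a′)))))
      φ-inj _ _ (isA a) (isB j)  eq = ⊥-elim (↑ˡ≢↑ʳ j a (sym (dist (trans (sym (φA a)) (trans eq (φB j))))))
      φ-inj _ _ (isA a) (isC j)  eq = ⊥-elim (fresh j (r ↑ʳ a) (trans (sym (φC j)) (trans (sym eq) (φA a))))
      φ-inj _ _ (isB j) (isA a)  eq = sym (φ-inj _ _ (isA a) (isB j) (sym eq))
      φ-inj _ _ (isB j) (isB j′) eq = cong vB (Fin.↑ˡ-injective (k ℕ.∸ r) j j′ (dist (trans (sym (φB j)) (trans eq (φB j′)))))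
      φ-inj _ _ (isB j) (isC j′) eq = ⊥-elim (fresh j′ (j ↑ˡ (k ℕ.∸ r)) (trans (sym (φC j′)) (trans (sym eq) (φB j))))
      φ-inj _ _ (isC j) (isA a)  eq = sym (φ-inj _ _ (isA a) (isC j) (sym eq))
      φ-inj _ _ (isC j) (isB j′) eq = sym (φ-inj _ _ (isB j′) (isC j) (sym eq))
      φ-inj _ _ (isC j) (isC j′) eq = cong vC (c-inj (trans (sym (φC j)) (trans eq (φC j′))))

      tuple : Fin r → Vec (Fin n) (r ℕ.+ (k ℕ.∸ r))
      tuple i = (x [ i ]≔ c i) Vec.++ y

      tuple≡ : ∀ i → tuple i ≡ (x Vec.++ y) [ i ↑ˡ (k ℕ.∸ r) ]≔ c i
      tuple≡ i = sym (Vec.[]≔-++-↑ˡ x y i)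

      image≡ : ∀ i → image φ (QEdge k r i) ≡ setOf (tuple i)
      image≡ i = Sub.⊆-antisym to from
        where
        at : ∀ u → u ≢ i ↑ˡ (k ℕ.∸ r) → lookup (x Vec.++ y) u ∈ setOf (tuple i)
        at u ne = subst (_∈ setOf (tuple i)) (trans (cong (λ t → lookup t u) (tuple≡ i)) (Vec.lookup∘updateAt′ u _ ne (x Vec.++ y))) (setOf⁺ (tuple i) u)
        elem : ∀ {u} → View u → u ∈ QEdge k r i → φ u ∈ setOf (tuple i)
        elem (isA a) _ = subst (_∈ setOf (tuple i)) (sym (φA a)) (at (r ↑ʳ a) (λ eq → ↑ˡ≢↑ʳ i a (sym eq)))
        elem (isB j) h = subst (_∈ setOf (tuple i)) (sym (φB j)) (at (j ↑ˡ (k ℕ.∸ r)) (λ eq → B∈⁻ i h (Fin.↑ˡ-injective (k ℕ.∸ r) j i eq)))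
        elem (isC j) h with refl ← C∈⁻ i h = subst (_∈ setOf (tuple i)) (trans (cong (λ t → lookup t (i ↑ˡ (k ℕ.∸ r))) (tuple≡ i))
          (trans (Vec.lookup∘updateAt (i ↑ˡ (k ℕ.∸ r)) (x Vec.++ y)) (sym (φC i)))) (setOf⁺ (tuple i) (i ↑ˡ (k ℕ.∸ r)))
        to : image φ (QEdge k r i) ⊆ setOf (tuple i)
        to v∈ with image⁻ φ (QEdge k r i) v∈
        ... | u , u∈ , refl = elem (view u) u∈
        back : ∀ u → (s : Fin r ⊎ Fin (k ℕ.∸ r)) → splitAt r u ≡ s → lookup (tuple i) u ∈ image φ (QEdge k r i)
        back u (inj₂ a) eq with refl ← trans (sym (Fin.join-splitAt r (k ℕ.∸ r) u)) (cong (join r (k ℕ.∸ r)) eq) =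
          subst (_∈ image φ (QEdge k r i)) (trans (φA a) (trans (lookup-y a) (sym (Vec.lookup-++ʳ (x [ i ]≔ c i) y a)))) (image⁺ φ (QEdge k r i) (A∈ i a))
        back u (inj₁ j) eq with refl ← trans (sym (Fin.join-splitAt r (k ℕ.∸ r) u)) (cong (join r (k ℕ.∸ r)) eq) with j Fin.≟ i
        ... | yes refl = subst (_∈ image φ (QEdge k r i)) (trans (φC i) (sym (trans (Vec.lookup-++ˡ (x [ i ]≔ c i) y i) (Vec.lookup∘updateAt i x)))) (image⁺ φ (QEdge k r i) (C∈ i))
        ... | no j≢i = subst (_∈ image φ (QEdge k r i)) (trans (φB j) (trans (lookup-x j) (sym (trans (Vec.lookup-++ˡ (x [ i ]≔ c i) y j) (Vec.lookup∘updateAt′ j i j≢i x)))))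
                         (image⁺ φ (QEdge k r i) (B∈ i j≢i))
        from : setOf (tuple i) ⊆ image φ (QEdge k r i)
        from v∈ with setOf⁻ (tuple i) v∈
        ... | u , refl = back u (splitAt r u) refl

      containsQ : ContainsQ k r H
      containsQ = φ , (λ {u} {v} → φ-inj u v (view u) (view v)) , All.map⁺ (All.tabulate⁺ (λ i → subst (_∈ˡ edges H) (sym (image≡ i)) (edge i)))

  -- Upper bounds

  vecOf : ∀ {A : Set} m (l : List A) → length l ≡ m → Vec A m
  vecOf zero    []      _  = []
  vecOf (suc m) (a ∷ l) eq = a ∷ vecOf m l (ℕ.suc-injective eq)

  vecOf-prefix : ∀ {A : Set} m (l l′ : List A) (eq : length (l ++ l′) ≡ m) i → toℕ i ℕ.< length l → lookup (vecOf m (l ++ l′) eq) i ∈ˡ l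
  vecOf-prefix (suc m) (a ∷ l) l′ eq zero    _           = here refl
  vecOf-prefix (suc m) (a ∷ l) l′ eq (suc i) (ℕ.s≤s i<l) = there (vecOf-prefix m l l′ (ℕ.suc-injective eq) i i<l)

  setOf-vecOf⁺ : ∀ {n} m (l : List (Fin n)) eq {v} → v ∈ˡ l → v ∈ setOf (vecOf m l eq)
  setOf-vecOf⁺ (suc m) (a ∷ l) eq (here refl) = Sub.x∈p∪q⁺ (inj₁ (Sub.x∈⁅x⁆ a))
  setOf-vecOf⁺ (suc m) (a ∷ l) eq (there p)   = Sub.x∈p∪q⁺ (inj₂ (setOf-vecOf⁺ m l (ℕ.suc-injective eq) p))

  setOf-vecOf⁻ : ∀ {n} m (l : List (Fin n)) eq {v} → v ∈ setOf (vecOf m l eq) → v ∈ˡ l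
  setOf-vecOf⁻ zero    []      eq v∈ = ⊥-elim (Sub.∉⊥ v∈)
  setOf-vecOf⁻ (suc m) (a ∷ l) eq v∈ with Sub.x∈p∪q⁻ ⁅ a ⁆ (setOf (vecOf m l (ℕ.suc-injective eq))) v∈
  ... | inj₁ p = here (Sub.x∈⁅y⁆⇒x≡y a p)
  ... | inj₂ p = there (setOf-vecOf⁻ m l (ℕ.suc-injective eq) p)

  elements : ∀ {n} → Subset n → List (Fin n)
  elements []          = []
  elements (true ∷ e)  = zero ∷ map suc (elements e)
  elements (false ∷ e) = map suc (elements e)

  elements-length : ∀ {n} (e : Subset n) → length (elements e) ≡ ∣ e ∣
  elements-length []          = refl
  elements-length (true ∷ e)  = cong suc (trans (List.length-map suc (elements e)) (elements-length e))
  elements-length (false ∷ e) = trans (List.length-map suc (elements e)) (elements-length e)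

  ∈-elements⁺ : ∀ {n} {e : Subset n} {v} → v ∈ e → v ∈ˡ elements e
  ∈-elements⁺ {e = true ∷ e}  here      = here refl
  ∈-elements⁺ {e = true ∷ e}  (there p) = there (∈-map⁺ suc (∈-elements⁺ p))
  ∈-elements⁺ {e = false ∷ e} (there p) = ∈-map⁺ suc (∈-elements⁺ p)

  ∈-elements⁻ : ∀ {n} {e : Subset n} {v} → v ∈ˡ elements e → v ∈ e
  ∈-elements⁻ {e = true ∷ e}  (here refl) = here
  ∈-elements⁻ {e = true ∷ e}  (there p) with ∈-map⁻ suc p
  ... | _ , q , refl = there (∈-elements⁻ q)
  ∈-elements⁻ {e = false ∷ e} p with ∈-map⁻ suc p
  ... | _ , q , refl = there (∈-elements⁻ q)

  length-split : ∀ {A : Set} (p : A → Bool) l → length (filter (λ a → p a Bool.≟ true) l) ℕ.+ length (filter (λ a → ¬? (p a Bool.≟ true)) l) ≡ length l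
  length-split p []      = refl
  length-split p (a ∷ l) with p a
  ... | true  = cong suc (length-split p l)
  ... | false = trans (ℕ.+-suc _ _) (cong suc (length-split p l))

  -- Three distinct values against two. It is one of the places where r ≥ 3 enters, both in the
  -- upper and in the lower bounds.
  avoid₂ : ∀ {A : Set} → (∀ (a b : A) → Dec (a ≡ b)) → ∀ z₀ z₁ z₂ → z₀ ≢ z₁ → z₀ ≢ z₂ → z₁ ≢ z₂ → ∀ (u v : A) →
           (z₀ ≢ u × z₀ ≢ v) ⊎ (z₁ ≢ u × z₁ ≢ v) ⊎ (z₂ ≢ u × z₂ ≢ v)
  avoid₂ _≟_ z₀ z₁ z₂ d₁ d₂ d₃ u v with z₀ ≟ u | z₀ ≟ v | z₁ ≟ u | z₁ ≟ v
  ... | no a     | no b     | _        | _        = inj₁ (a , b)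
  ... | _        | _        | no a     | no b     = inj₂ (inj₁ (a , b))
  ... | yes refl | _        | yes refl | _        = contradiction refl d₁
  ... | yes refl | _        | _        | yes refl = inj₂ (inj₂ ((λ eq → d₂ (sym eq)) , (λ eq → d₃ (sym eq))))
  ... | _        | yes refl | yes refl | _        = inj₂ (inj₂ ((λ eq → d₃ (sym eq)) , (λ eq → d₂ (sym eq))))
  ... | _        | yes refl | _        | yes refl = contradiction refl d₁

  opaque
    unfolding ℚring

    ring-n : ∀ M a b → M * (a * b) ≡ a * (M * b)
    ring-n = solve-∀ ℚring

    ring-o : ∀ N P R w → N * P * (R * w) ≡ R * P * (N * w)
    ring-o = solve-∀ ℚring

  -- From edges to ordered tuples

  module Counting (n : ℕ) where
    open Average n

    wpow : ℕ → ℚ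
    wpow zero    = 1ℚ
    wpow (suc m) = w * wpow m

    0≤wpow : ∀ m → 0ℚ ≤ wpow m
    0≤wpow zero    = 0≤1
    0≤wpow (suc m) = 0≤* 0≤w (0≤wpow m)

    N^*wpow : ∀ m → ι (suc n ^ m) * wpow m ≡ 1ℚ
    N^*wpow zero    = trans (*-identityʳ _) (trans (ι-suc 0) (trans (cong (1ℚ +_) ι-zero) (+-identityʳ 1ℚ)))
    N^*wpow (suc m) = trans (cong (_* (w * wpow m)) (ι-* (suc n) (suc n ^ m))) (trans (ring-r (ι (suc n)) (ι (suc n ^ m)) w (wpow m))
      (trans (cong₂ _*_ N*w (N^*wpow m)) (*-identityʳ 1ℚ)))
      where
      opaque
        unfolding ℚring
        ring-r : ∀ a b c d → a * b * (c * d) ≡ (a * c) * (b * d)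
        ring-r = solve-∀ ℚring

    _≡ᵛ_ : ∀ {m} → V m → V m → Bool
    []      ≡ᵛ []      = true
    (a ∷ t) ≡ᵛ (b ∷ x) = (a ≡ᵇ b) ∧ (t ≡ᵛ x)

    ≡ᵛ⇒≡ : ∀ {m} (t x : V m) → (t ≡ᵛ x) ≡ true → t ≡ x
    ≡ᵛ⇒≡ []      []      _ = refl
    ≡ᵛ⇒≡ (a ∷ t) (b ∷ x) h = let (p , q) = ∧⁻ {a ≡ᵇ b} h in cong₂ _∷_ (≡ᵇ⇒≡ p) (≡ᵛ⇒≡ t x q)

    E-point : ∀ {m} (t : V m) → E (λ x → ⟦ t ≡ᵛ x ⟧) ≡ wpow m
    E-point []      = E-zero _
    E-point {suc m} (a ∷ t) = trans (E-suc _) (trans (avg-cong (λ b → trans (E-cong (λ x → ⟦∧⟧ (a ≡ᵇ b) (t ≡ᵛ x))) (trans (E-* _ _) (cong (⟦ a ≡ᵇ b ⟧ *_) (E-point t)))))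
      (trans (avg-def _) (cong (w *_) (sumF-δ a (λ _ → wpow m)))))

    hits : ∀ {m} → List (V m) → V m → ℚ
    hits []       x = 0ℚ
    hits (t ∷ ts) x = ⟦ t ≡ᵛ x ⟧ + hits ts x

    E-hits : ∀ {m} (ts : List (V m)) → E (hits ts) ≡ ι (length ts) * wpow m
    E-hits {m} []       = trans (E-const {m} 0ℚ) (sym (trans (cong (_* wpow m) ι-zero) (*-zeroˡ _)))
    E-hits {m} (t ∷ ts) = trans (E-+ _ _) (trans (cong₂ _+_ (E-point t) (E-hits ts)) (sym (trans (cong (_* wpow m) (ι-suc (length ts))) (suc*-expand (ι (length ts)) (wpow m)))))

    hits≤ : ∀ {m} (X : V m → Bool) (ts : List (V m)) → Unique ts → All (λ t → X t ≡ true) ts → ∀ x → hits ts x ≤ ⟦ X x ⟧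
    hits≤ X [] _ _ x = 0≤⟦⟧ (X x)
    hits≤ X (t ∷ ts) (fresh ∷ uniq) (Xt ∷ Xts) x with t ≡ᵛ x in eq
    ... | false = ≡≤ (+-identityˡ _) (hits≤ X ts uniq Xts x)
    ... | true with refl ← ≡ᵛ⇒≡ t x eq = ≡≤ (trans (cong (1ℚ +_) (zero-hits ts fresh)) (+-identityʳ 1ℚ)) (ℚ.≤-reflexive (cong ⟦_⟧ (sym Xt)))
      where
      zero-hits : ∀ ts → All (t ≢_) ts → hits ts t ≡ 0ℚ
      zero-hits []       []        = refl
      zero-hits (s ∷ ts) (p ∷ ps) with s ≡ᵛ t in eq′
      ... | true  = contradiction (sym (≡ᵛ⇒≡ s t eq′)) p
      ... | false = trans (+-identityˡ _) (zero-hits ts ps)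

    count≤μ : ∀ {m} (X : V m → Bool) (ts : List (V m)) → Unique ts → All (λ t → X t ≡ true) ts → ι (length ts) * wpow m ≤ μ X
    count≤μ X ts uniq Xts = ≡≤ (sym (E-hits ts)) (E-mono (hits≤ X ts uniq Xts))

    E-++ : ∀ {r s} (F : V (r ℕ.+ s) → ℚ) → E F ≡ E {r} (λ x → E {s} (λ y → F (x Vec.++ y)))
    E-++ {zero}  F = sym (E-zero _)
    E-++ {suc r} F = trans (E-suc F) (trans (avg-cong (λ a → E-++ {r} (λ t → F (a ∷ t)))) (sym (E-suc _)))

    occ : List (Fin (suc n)) → Fin (suc n) → ℚ
    occ []       a = 0ℚ
    occ (y ∷ ys) a = ⟦ y ≡ᵇ a ⟧ * 1ℚ + occ ys a

    0≤occ : ∀ ys a → 0ℚ ≤ occ ys a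
    0≤occ []       a = ℚ.≤-refl
    0≤occ (y ∷ ys) a = 0≤+ (0≤* (0≤⟦⟧ (y ≡ᵇ a)) 0≤1) (0≤occ ys a)

    1≤occ : ∀ {ys a} → a ∈ˡ ys → 1ℚ ≤ occ ys a
    1≤occ {y ∷ ys} {a} (here refl) = ≤-by (occ ys a) (cong (_+ occ ys a) (trans (*-identityʳ _) (cong ⟦_⟧ (≡⇒≡ᵇ {i = a} refl)))) (0≤occ ys a)
    1≤occ {y ∷ ys} {a} (there p) = ℚ.≤-trans (1≤occ p) (≤-by (⟦ y ≡ᵇ a ⟧ * 1ℚ) (+-comm _ _) (0≤* (0≤⟦⟧ (y ≡ᵇ a)) 0≤1))

    sum-occ : ∀ ys → sumF (occ ys) ≡ ι (length ys)
    sum-occ []       = trans (sumF-const {suc n} 0ℚ) (trans (*-zeroʳ _) (sym ι-zero))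
    sum-occ (y ∷ ys) = trans (sumF-+ _ _) (trans (cong₂ _+_ (sumF-δ y (λ _ → 1ℚ)) (sum-occ ys)) (sym (ι-suc (length ys))))

    -- More than `R` values satisfy `p` and at most `R` are forbidden; this is the single step of
    -- the greedy choice.
    pick : ∀ {R} (p : Fin (suc n) → Bool) ys → length ys ℕ.≤ R → ι R * w < avg (λ a → ⟦ p a ⟧) → Σ (Fin (suc n)) λ a → p a ≡ true × a ∉ˡ ys
    pick {R} p ys len big with Fin.any? (λ a → (p a Bool.≟ true) ×-dec ¬? (∈?-with Fin._≟_ a ys))
    ... | yes found = found
    ... | no none = ⊥-elim (ℚ.<-irrefl refl (ℚ.<-≤-trans big (≡≤ (avg-def _) (ℚ.≤-trans (*-monoˡ w 0≤w (sumF-mono each))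
            (≡≤ (cong (w *_) (sum-occ ys)) (≡≤ (*-comm w (ι (length ys))) (*-monoʳ w 0≤w (ι-mono len))))))))
      where
      each : ∀ a → ⟦ p a ⟧ ≤ occ ys a
      each a = ⟦⟧-≤ (p a) (0≤occ ys a) (λ pa → within pa (∈?-with Fin._≟_ a ys))
        where
        within : p a ≡ true → Dec (a ∈ˡ ys) → 1ℚ ≤ occ ys a
        within pa (yes a∈) = 1≤occ a∈
        within pa (no a∉)  = contradiction (a , pa , a∉) none

    choose : ∀ {R} r (p : Fin r → Fin (suc n) → Bool) ys → length ys ℕ.+ r ℕ.≤ R → (∀ i → ι R * w < avg (λ a → ⟦ p i a ⟧)) →
      Σ (Fin r → Fin (suc n)) λ c → (∀ i → p i (c i) ≡ true) × (∀ i → c i ∉ˡ ys) × (∀ {i j} → c i ≡ c j → i ≡ j)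
    choose zero p ys len big = (λ ()) , (λ ()) , (λ ()) , λ {i} → ⊥-elim (¬Fin0 i)
      where
      ¬Fin0 : ¬ Fin 0
      ¬Fin0 ()
    choose {R} (suc r) p ys len big with pick {R} (p zero) ys (ℕ.≤-trans (ℕ.m≤m+n _ _) len) (big zero)
    ... | a , pa , a∉ with choose {R} r (λ i → p (suc i)) (a ∷ ys) (ℕ.≤-trans (ℕ.≤-reflexive (sym (ℕ.+-suc (length ys) r))) len) (λ i → big (suc i))
    ...   | c , pc , c∉ , inj = c′ , pc′ , c′∉ , inj′
      where
      c′ : Fin (suc r) → Fin (suc n)
      c′ zero    = a
      c′ (suc i) = c i
      pc′ : ∀ i → p i (c′ i) ≡ true
      pc′ zero    = pa
      pc′ (suc i) = pc i
      c′∉ : ∀ i → c′ i ∉ˡ ys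
      c′∉ zero    = a∉
      c′∉ (suc i) m = c∉ i (there m)
      inj′ : ∀ {i j} → c′ i ≡ c′ j → i ≡ j
      inj′ {zero}  {zero}  _  = refl
      inj′ {zero}  {suc j} eq = ⊥-elim (c∉ j (here (sym eq)))
      inj′ {suc i} {zero}  eq = ⊥-elim (c∉ i (here eq))
      inj′ {suc i} {suc j} eq = cong suc (inj eq)

  module Upper (n k : ℕ) (H : KGraph k (suc n)) where
    open Average n
    open Counting n

    inH : Subset (suc n) → Bool
    inH e = ⌊ ∈?-with _≟ˢ_ e (edges H) ⌋

    inH⁻ : ∀ {e} → inH e ≡ true → e ∈ˡ edges H
    inH⁻ {e} h with ∈?-with _≟ˢ_ e (edges H)
    ... | yes p = p

    inH⁺ : ∀ {e} → e ∈ˡ edges H → inH e ≡ true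
    inH⁺ {e} p with ∈?-with _≟ˢ_ e (edges H)
    ... | yes _ = refl
    ... | no ¬p = contradiction p ¬p

    edge-size : ∀ {e} → e ∈ˡ edges H → ∣ e ∣ ≡ k
    edge-size = All.lookup (uniform H)

    degree : Subset (suc n) → Fin (suc n) → ℚ
    degree e v = avg (λ a → ⟦ inH ((e ∖ v) ∪ ⁅ a ⁆) ⟧)

    poor : ℕ → Subset (suc n) → Fin (suc n) → Bool
    poor R e v = degree e v ≤ᵇ (ι R * w)

    -- The c_i are chosen greedily. They must avoid the `k` vertices of the edge and at most `r`
    -- earlier choices, hence the degree threshold k + r.
    rich⇒ContainsQ : ∀ r → r ℕ.≤ k → ∀ x y → let t = x Vec.++ y in setOf t ∈ˡ edges H →
      (∀ i → ι (k ℕ.+ r) * w < degree (setOf t) (lookup t (i ↑ˡ (k ℕ.∸ r)))) → ContainsQ k r H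
    rich⇒ContainsQ r r≤k x y t∈ rich = Vertices.Embed.containsQ k r H x y (proj₁ chosen) dist
        (λ i u eq → proj₁ (proj₂ (proj₂ chosen)) i (∈-elements⁺ (subst (_∈ setOf t) (sym eq) (setOf⁺ t u))))
        (proj₂ (proj₂ (proj₂ chosen)))
        (λ i → subst (λ s → setOf s ∈ˡ edges H) (Vec.[]≔-++-↑ˡ x y i) (subst (_∈ˡ edges H) (sym (setOf-update t dist (i ↑ˡ (k ℕ.∸ r)) _)) (inH⁻ (proj₁ (proj₂ chosen) i))))
      where
      t = x Vec.++ y
      dist : Distinct t
      dist = ∣setOf∣≡⇒Distinct t (trans (edge-size t∈) (sym (ℕ.m+[n∸m]≡n r≤k)))
      chosen = choose {k ℕ.+ r} r (λ i a → inH ((setOf t ∖ lookup t (i ↑ˡ (k ℕ.∸ r))) ∪ ⁅ a ⁆)) (elements (setOf t))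
        (ℕ.≤-reflexive (cong (ℕ._+ r) (trans (elements-length (setOf t)) (edge-size t∈)))) rich

    module Tuples (r₀ s₀ R : ℕ) (r₀+s₀ : r₀ ℕ.+ s₀ ≡ k) where

      X : V (r₀ ℕ.+ s₀) → Bool
      X t = inH (setOf t) ∧ all (λ i → poor R (setOf t) (lookup t (i ↑ˡ s₀))) (allFin r₀)

      X-edge : ∀ {t} → X t ≡ true → setOf t ∈ˡ edges H
      X-edge {t} h = inH⁻ (proj₁ (∧⁻ {inH (setOf t)} h))

      X-distinct : ∀ {t} → X t ≡ true → Distinct t
      X-distinct {t} h = ∣setOf∣≡⇒Distinct t (trans (edge-size (X-edge {t} h)) (sym r₀+s₀))

      -- A line without points of `X` is trivial. Otherwise the degree at one of its points, which
      -- is poor in this direction, counts all edges on the line.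
      rows : ∀ i t → avg (λ a → ⟦ X (t [ i ↑ˡ s₀ ]≔ a) ⟧) ≤ ι R * w
      rows i t with Fin.any? (λ a → X (t [ i ↑ˡ s₀ ]≔ a) Bool.≟ true)
      ... | no none = ≡≤ (trans (avg-cong (λ a → cong ⟦_⟧ (Bool.¬-not (λ eq → none (a , eq))))) (avg-const 0ℚ)) (0≤* (0≤ι R) 0≤w)
      ... | yes (a₀ , h) = ℚ.≤-trans (avg-mono (λ a → ⟦⟧-mono (λ Xa → trans (cong inH (same a)) (proj₁ (∧⁻ {inH (setOf (t [ i ↑ˡ s₀ ]≔ a))} Xa)))))
          (≤ᵇ⇒≤ (all⁻ (λ i → poor R (setOf t₀) (lookup t₀ (i ↑ˡ s₀))) (allFin r₀) (proj₂ (∧⁻ {inH (setOf t₀)} h)) (∈-allFin i)))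
        where
        t₀ = t [ i ↑ˡ s₀ ]≔ a₀
        same : ∀ a → (setOf t₀ ∖ lookup t₀ (i ↑ˡ s₀)) ∪ ⁅ a ⁆ ≡ setOf (t [ i ↑ˡ s₀ ]≔ a)
        same a = trans (sym (setOf-update t₀ (X-distinct {t₀} h) (i ↑ˡ s₀) a)) (cong setOf (Vec.[]≔-idempotent t (i ↑ˡ s₀)))

    module Free (r : ℕ) (r≤k : r ℕ.≤ k) (free : ¬ ContainsQ k r H) (r₀ s₀ : ℕ) (r₀+s₀ : r₀ ℕ.+ s₀ ≡ k) (r₀+r : r₀ ℕ.+ r ℕ.≤ suc k) where

      open Tuples r₀ s₀ (k ℕ.+ r) r₀+s₀

      module Order {e : Subset (suc n)} (e∈ : e ∈ˡ edges H) where

        test : Fin (suc n) → Bool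
        test = poor (k ℕ.+ r) e
        poors richs : List (Fin (suc n))
        poors = filter (λ v → test v Bool.≟ true) (elements e)
        richs = filter (λ v → ¬? (test v Bool.≟ true)) (elements e)
        sizes : length poors ℕ.+ length richs ≡ k
        sizes = trans (length-split test (elements e)) (trans (elements-length e) (edge-size e∈))
        is-poor : ∀ {v} → v ∈ˡ poors → test v ≡ true
        is-poor v∈ = proj₂ (∈-filter⁻ (λ v → test v Bool.≟ true) {xs = elements e} v∈)
        cover : ∀ {v} → v ∈ e → v ∈ˡ poors ⊎ v ∈ˡ richs
        cover {v} v∈ = decide (test v Bool.≟ true)
          where
          decide : Dec (test v ≡ true) → v ∈ˡ poors ⊎ v ∈ˡ richs
          decide (yes p) = inj₁ (∈-filter⁺ (λ v → test v Bool.≟ true) (∈-elements⁺ v∈) p)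
          decide (no ¬p) = inj₂ (∈-filter⁺ (λ v → ¬? (test v Bool.≟ true)) (∈-elements⁺ v∈) ¬p)
        in-e : ∀ {v} → v ∈ˡ poors ⊎ v ∈ˡ richs → v ∈ e
        in-e (inj₁ p) = ∈-elements⁻ (proj₁ (∈-filter⁻ (λ v → test v Bool.≟ true) {xs = elements e} p))
        in-e (inj₂ p) = ∈-elements⁻ (proj₁ (∈-filter⁻ (λ v → ¬? (test v Bool.≟ true)) {xs = elements e} p))
        many-rich : ¬ (r ℕ.≤ length richs)
        many-rich r≤ = free (rich⇒ContainsQ r r≤k x y (subst (_∈ˡ edges H) (sym xy≡e) e∈) (λ i → ℚ.≰⇒> (λ le → is-rich i (subst (λ s → (degree s (lookup (x Vec.++ y) (i ↑ˡ (k ℕ.∸ r))) ≤ᵇ (ι (k ℕ.+ r) * w)) ≡ true) xy≡e (≤⇒≤ᵇ le)))))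
          where
          len₂ : length (richs ++ poors) ≡ r ℕ.+ (k ℕ.∸ r)
          len₂ = trans (List.length-++ richs) (trans (ℕ.+-comm (length richs) (length poors)) (trans sizes (sym (ℕ.m+[n∸m]≡n r≤k))))
          t₂ : V (r ℕ.+ (k ℕ.∸ r))
          t₂ = vecOf (r ℕ.+ (k ℕ.∸ r)) (richs ++ poors) len₂
          x : V r
          x = Vec.take r t₂
          y : V (k ℕ.∸ r)
          y = Vec.drop r t₂
          xy≡t : x Vec.++ y ≡ t₂
          xy≡t = Vec.take++drop≡id r t₂
          xy≡e : setOf (x Vec.++ y) ≡ e
          xy≡e = trans (cong setOf xy≡t) (Sub.⊆-antisym (λ v∈ → in-e ([ inj₂ , inj₁ ]′ (∈-++⁻ richs (setOf-vecOf⁻ _ (richs ++ poors) len₂ v∈))))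
            (λ v∈ → setOf-vecOf⁺ _ (richs ++ poors) len₂ ([ ∈-++⁺ʳ richs , ∈-++⁺ˡ ]′ (cover v∈))))
          is-rich : ∀ i → ¬ (test (lookup (x Vec.++ y) (i ↑ˡ (k ℕ.∸ r))) ≡ true)
          is-rich i = proj₂ (∈-filter⁻ (λ v → ¬? (test v Bool.≟ true)) {xs = elements e} (subst (λ t → lookup t (i ↑ˡ (k ℕ.∸ r)) ∈ˡ richs) (sym xy≡t)
            (vecOf-prefix _ richs poors len₂ (i ↑ˡ (k ℕ.∸ r)) (ℕ.<-≤-trans (subst (ℕ._< r) (sym (Fin.toℕ-↑ˡ i (k ℕ.∸ r))) (Fin.toℕ<n i)) r≤))))
        few-rich : length richs ℕ.< r
        few-rich = ℕ.≰⇒> many-rich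
        -- At most r - 1 vertices of the edge are rich, so at least k + 1 - r are poor, and `r₀+r`
        -- says that this is at least `r₀`.
        enough : r₀ ℕ.≤ length poors
        enough = ℕ.+-cancelʳ-≤ r r₀ (length poors) (ℕ.≤-trans r₀+r (ℕ.≤-trans (ℕ.≤-reflexive (cong suc (sym sizes)))
          (ℕ.≤-trans (ℕ.≤-reflexive (sym (ℕ.+-suc (length poors) (length richs)))) (ℕ.+-monoʳ-≤ (length poors) few-rich))))
        len : length (poors ++ richs) ≡ r₀ ℕ.+ s₀
        len = trans (List.length-++ poors) (trans sizes (sym r₀+s₀))
        t : V (r₀ ℕ.+ s₀)
        t = vecOf (r₀ ℕ.+ s₀) (poors ++ richs) len
        set≡ : setOf t ≡ e
        set≡ = Sub.⊆-antisym (λ v∈ → in-e (∈-++⁻ poors (setOf-vecOf⁻ _ (poors ++ richs) len v∈)))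
          (λ v∈ → setOf-vecOf⁺ _ (poors ++ richs) len ([ ∈-++⁺ˡ , ∈-++⁺ʳ poors ]′ (cover v∈)))

        poors-first : ∀ i → test (lookup t (i ↑ˡ s₀)) ≡ true
        poors-first i = is-poor (vecOf-prefix (r₀ ℕ.+ s₀) poors richs len (i ↑ˡ s₀)
            (ℕ.<-≤-trans (subst (ℕ._< r₀) (sym (Fin.toℕ-↑ˡ i s₀)) (Fin.toℕ<n i)) enough))

        Xt : X t ≡ true
        Xt = ∧⁺ {inH (setOf t)} (inH⁺ (subst (_∈ˡ edges H) (sym set≡) e∈))
          (all⁺ (λ i → poor (k ℕ.+ r) (setOf t) (lookup t (i ↑ˡ s₀))) (allFin r₀) (λ {i} _ → subst (λ s → poor (k ℕ.+ r) s (lookup t (i ↑ˡ s₀)) ≡ true) (sym set≡) (poors-first i)))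

      order : ∀ {e} → e ∈ˡ edges H → Σ (V (r₀ ℕ.+ s₀)) λ t → setOf t ≡ e × X t ≡ true
      order e∈ = Order.t e∈ , Order.set≡ e∈ , Order.Xt e∈

      Ordered : List (Subset (suc n)) → Set
      Ordered es = Σ (List (V (r₀ ℕ.+ s₀))) λ ts → map setOf ts ≡ es × All (λ t → X t ≡ true) ts

      tuples : ∀ es → (∀ {e} → e ∈ˡ es → e ∈ˡ edges H) → Ordered es
      tuples []       sub = [] , refl , []
      tuples (e ∷ es) sub = extend (order (sub (here refl))) (tuples es (λ m → sub (there m)))
        where
        extend : (Σ (V (r₀ ℕ.+ s₀)) λ t → setOf t ≡ e × X t ≡ true) → Ordered es → Ordered (e ∷ es)
        extend (t , set≡ , Xt) (ts , map≡ , Xts) = t ∷ ts , cong₂ _∷_ set≡ map≡ , Xt ∷ Xts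

      edges≤ : ι e[ H ] * wpow (r₀ ℕ.+ s₀) ≤ μ X
      edges≤ = count (tuples (edges H) (λ m → m))
        where
        count : Ordered (edges H) → ι e[ H ] * wpow (r₀ ℕ.+ s₀) ≤ μ X
        count (ts , map≡ , Xts) = ≡≤ (cong (λ l → ι l * wpow (r₀ ℕ.+ s₀)) (trans (cong length (sym map≡)) (List.length-map setOf ts)))
          (count≤μ X ts (Unique.map⁻ (subst Unique (sym map≡) (unique H))) Xts)

  opaque
    unfolding ℚring

    ring-s : ∀ d N M p → two * d * (N * (M * p)) ≡ two * (d * M * (N * p))
    ring-s = solve-∀ ℚring

    ring-t : ∀ P N p → P * (N * p) ≡ N * P * p
    ring-t = solve-∀ ℚring

  -- One poor vertex, available for every r ≤ k, is placed first; resampling that coordinate alone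
  -- already gives measure O(1/n).
  edges≤n^[k-1] : ∀ k r → r ℕ.≤ suc k → ∀ n (H : KGraph (suc k) (suc n)) → ¬ ContainsQ (suc k) r H → e[ H ] ℕ.≤ (suc k ℕ.+ r) ℕ.* suc n ^ k
  edges≤n^[k-1] k r r≤k n H free = ι-cancel (≡≤ (trans (sym unit) (ring-n (ι e[ H ]) (ι (suc n ^ suc k)) (wpow (suc k))))
      (≤≡ (*-monoˡ (ι (suc n ^ suc k)) (0≤ι (suc n ^ suc k)) bound) collect))
    where
    open Average n
    open Counting n
    open Upper n (suc k) H
    open Tuples 1 k (suc k ℕ.+ r) refl
    unit : ι e[ H ] * (ι (suc n ^ suc k) * wpow (suc k)) ≡ ι e[ H ]
    unit = trans (cong (ι e[ H ] *_) (N^*wpow (suc k))) (*-identityʳ _)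
    bound : ι e[ H ] * wpow (suc k) ≤ ι (suc k ℕ.+ r) * w
    bound = ℚ.≤-trans (Free.edges≤ r r≤k free 1 k refl (ℕ.s≤s r≤k)) (≡≤ (E-resample zero _) (E-≤ (rows zero)))
    collect : ι (suc n ^ suc k) * (ι (suc k ℕ.+ r) * w) ≡ ι ((suc k ℕ.+ r) ℕ.* suc n ^ k)
    collect = trans (cong (_* (ι (suc k ℕ.+ r) * w)) (ι-* (suc n) (suc n ^ k))) (trans (ring-o (ι (suc n)) (ι (suc n ^ k)) (ι (suc k ℕ.+ r)) w)
      (trans (cong (ι (suc k ℕ.+ r) * ι (suc n ^ k) *_) N*w) (trans (*-identityʳ _) (sym (ι-* (suc k ℕ.+ r) (suc n ^ k))))))

  module Sparse (k r′ : ℕ) (3≤r : 3 ℕ.≤ suc r′) (r≤k : suc r′ ℕ.≤ suc k) (2r≤k+1 : suc r′ ℕ.+ suc r′ ℕ.≤ suc (suc k)) (d : ℕ) where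

    r s R : ℕ
    r = suc r′
    s = suc k ℕ.∸ r
    R = suc k ℕ.+ r

    threshold : ℕ
    threshold = proj₁ (configuration r′ R (2 ℕ.* suc d))

    r+s : r ℕ.+ s ≡ suc k
    r+s = ℕ.m+[n∸m]≡n r≤k

    module _ (n : ℕ) (n₀≤n : threshold ℕ.≤ n) (H : KGraph (suc k) (suc n)) (free : ¬ ContainsQ (suc k) r H) where
      open Average n
      open Counting n
      open Upper n (suc k) H
      open Tuples r s R r+s
      open Free r r≤k free r s r+s 2r≤k+1 using (edges≤)

      slice : V s → V r → Bool
      slice y x = X (x Vec.++ y)

      slice-rows : ∀ y i x → avg (λ a → ⟦ slice y (x [ i ]≔ a) ⟧) ≤ ι R * w
      slice-rows y i x = ≡≤ (avg-cong (λ a → cong (λ t → ⟦ X t ⟧) (sym (Vec.[]≔-++-↑ˡ x y i)))) (rows i (x Vec.++ y))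

      module Found (y : V s) (x : V r) (c : Fin r → Fin (suc n)) (hit : ∀ i → slice y (x [ i ]≔ c i) ≡ true)
                   (miss : ¬ (slice y x ≡ true)) (c-inj : ∀ {i j} → c i ≡ c j → i ≡ j) where

        t : V (r ℕ.+ s)
        t = x Vec.++ y

        shifted : Fin r → V (r ℕ.+ s)
        shifted i = t [ i ↑ˡ s ]≔ c i

        shifted≡ : ∀ i → shifted i ≡ (x [ i ]≔ c i) Vec.++ y
        shifted≡ i = Vec.[]≔-++-↑ˡ x y i

        shifted-distinct : ∀ i → Distinct (shifted i)
        shifted-distinct i = X-distinct {shifted i} (trans (cong X (shifted≡ i)) (hit i))

        shifted-at : ∀ i → lookup (shifted i) (i ↑ˡ s) ≡ c i
        shifted-at i = Vec.lookup∘updateAt (i ↑ˡ s) t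

        shifted-off : ∀ i u → u ≢ i ↑ˡ s → lookup (shifted i) u ≡ lookup t u
        shifted-off i u ne = Vec.lookup∘updateAt′ u (i ↑ˡ s) ne t

        dist-via : ∀ i u v → i ↑ˡ s ≢ u × i ↑ˡ s ≢ v → lookup t u ≡ lookup t v → u ≡ v
        dist-via i u v (i≢u , i≢v) eq = shifted-distinct i (trans (shifted-off i u (λ e → i≢u (sym e))) (trans eq (sym (shifted-off i v (λ e → i≢v (sym e))))))

        -- Two coordinates of t avoid some position l, so they are also coordinates of the edge shifted l.
        dist : Distinct t
        dist {u} {v} eq = [ (λ p → dist-via z₀ u v p eq) , [ (λ p → dist-via z₁ u v p eq) , (λ p → dist-via z₂ u v p eq) ]′ ]′
            (avoid₂ Fin._≟_ (z₀ ↑ˡ s) (z₁ ↑ˡ s) (z₂ ↑ˡ s) (differ zero (suc zero) λ ()) (differ zero (suc (suc zero)) λ ()) (differ (suc zero) (suc (suc zero)) λ ()) u v)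
          where
          z₀ z₁ z₂ : Fin r
          z₀ = Fin.inject≤ {3} zero 3≤r
          z₁ = Fin.inject≤ {3} (suc zero) 3≤r
          z₂ = Fin.inject≤ {3} (suc (suc zero)) 3≤r
          differ : ∀ (a b : Fin 3) → a ≢ b → Fin.inject≤ a 3≤r ↑ˡ s ≢ Fin.inject≤ b 3≤r ↑ˡ s
          differ a b ne eq = ne (Fin.inject≤-injective 3≤r 3≤r a b (Fin.↑ˡ-injective s _ _ eq))

        -- A coincidence at the shifted position itself would make the shift trivial and put `x` in
        -- the slice; a coincidence elsewhere would repeat a vertex in the shifted edge.
        fresh : ∀ i u → c i ≢ lookup t u
        fresh i u eq = decide (u Fin.≟ (i ↑ˡ s))
          where
          decide : Dec (u ≡ i ↑ˡ s) → ⊥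
          decide (yes refl) = miss (trans (cong (slice y) (sym (trans (cong (x [ i ]≔_) (trans eq (Vec.lookup-++ˡ x y i))) (Vec.[]≔-lookup x i)))) (hit i))
          decide (no ne)    = ne (shifted-distinct i (trans (shifted-off i u ne) (trans (sym eq) (sym (shifted-at i)))))

        contains : ContainsQ (suc k) r H
        contains = Vertices.Embed.containsQ (suc k) r H x y c dist fresh c-inj (λ i → X-edge {(x [ i ]≔ c i) Vec.++ y} (hit i))

      slice-small : ∀ y → ι (2 ℕ.* suc d) * (ι (suc n) * μ (slice y)) ≤ 1ℚ
      slice-small y = [ (λ le → le) , (λ big → ⊥-elim (proj₂ (configuration r′ R (2 ℕ.* suc d)) n n₀≤n (slice y) (slice-rows y) big
        (λ x c hit miss inj → free (Found.contains y x c hit miss inj)))) ]′ (ℚ.≤-total _ 1ℚ)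

      X-small : ι (2 ℕ.* suc d) * (ι (suc n) * μ X) ≤ 1ℚ
      X-small = ≡≤ (trans (cong (λ m → ι (2 ℕ.* suc d) * (ι (suc n) * m)) (trans (E-++ {r} {s} _) (E-swap _)))
          (trans (cong (ι (2 ℕ.* suc d) *_) (sym (E-* (ι (suc n)) (λ y → μ (slice y))))) (sym (E-* (ι (2 ℕ.* suc d)) _))))
        (E-≤ slice-small)

      -- The slices are bounded with 2(d+1) in place of d+1, so that too many edges would give 2 ≤ 1
      -- from weak inequalities.
      few-edges : suc d ℕ.* e[ H ] ℕ.≤ suc n ^ k
      few-edges = ℕ.≮⇒≥ (λ many → ℚ.<-irrefl refl (ℚ.<-≤-trans 1<2 (ℚ.≤-trans (lower (ℕ.<⇒≤ many)) X-small)))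
        where
        1<2 : 1ℚ < two
        1<2 = subst (_< two) (+-identityˡ 1ℚ) (+-monoˡ-< 1ℚ 0<1)
        unit : ι (suc n ^ k) * (ι (suc n) * wpow (r ℕ.+ s)) ≡ 1ℚ
        unit = trans (ring-t _ _ _) (trans (cong₂ _*_ (sym (ι-* (suc n) (suc n ^ k))) (cong wpow r+s)) (N^*wpow (suc k)))
        lower : suc n ^ k ℕ.≤ suc d ℕ.* e[ H ] → two ≤ ι (2 ℕ.* suc d) * (ι (suc n) * μ X)
        lower many = ℚ.≤-trans (≡≤ (trans (sym (*-identityʳ two)) (cong (two *_) (sym unit)))
            (*-monoˡ two 0≤two (*-monoʳ _ (0≤* (0≤ι (suc n)) (0≤wpow (r ℕ.+ s))) (ι-mono many))))
          (≡≤ (trans (cong (λ z → two * (z * (ι (suc n) * wpow (r ℕ.+ s)))) (ι-* (suc d) e[ H ])) (sym (ring-s (ι (suc d)) (ι (suc n)) (ι e[ H ]) (wpow (r ℕ.+ s)))))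
            (≤≡ (*-monoˡ _ (0≤* 0≤two (0≤ι (suc d))) (*-monoˡ _ (0≤ι (suc n)) edges≤)) (cong (_* (ι (suc n) * μ X)) (trans (cong (_* ι (suc d)) (sym ι2≡two)) (sym (ι-* 2 (suc d)))))))

open import Defs
open import Data.Nat using (_+_; _*_; _∸_; _≤_; _<_; s≤s; z≤n)
open UpperBounds using (setOf; setOf⁺; setOf⁻; Distinct; image⁺; image⁻; module Vertices; ↑ˡ≢↑ʳ; avoid₂; subsets; ∈-subsets; edges≤n^[k-1]; module Sparse)

-- Partite hypergraphs

lookup-ext : ∀ {A : Set} {m} {x y : Vec A m} → (∀ p → lookup x p ≡ lookup y p) → x ≡ y
lookup-ext {x = []}    {[]}    h = refl
lookup-ext {x = a ∷ x} {b ∷ y} h = cong₂ _∷_ (h zero) (lookup-ext (λ p → h (suc p)))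

Distinct⇒∣setOf∣≡ : ∀ {n m} (x : Vec (Fin n) m) → Distinct x → ∣ setOf x ∣ ≡ m
Distinct⇒∣setOf∣≡ {n} []      _ = Sub.∣⊥∣≡0 n
Distinct⇒∣setOf∣≡ (a ∷ x) d = trans (∣insert∣ a (setOf x) (λ a∈ → apart (setOf⁻ x a∈))) (cong suc (Distinct⇒∣setOf∣≡ x (λ e → Fin.suc-injective (d e))))
  where
  apart : (Σ _ λ i → lookup x i ≡ a) → ⊥
  apart (i , eq) with () ← d {zero} {suc i} (sym eq)
  ∣⊥∪∣ : ∀ {n} (p : Subset n) → ∣ Subset.⊥ ∪ p ∣ ≡ ∣ p ∣
  ∣⊥∪∣ []          = refl
  ∣⊥∪∣ (true ∷ p)  = cong suc (∣⊥∪∣ p)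
  ∣⊥∪∣ (false ∷ p) = ∣⊥∪∣ p
  ∣insert∣ : ∀ {n} (a : Fin n) (p : Subset n) → a ∉ p → ∣ ⁅ a ⁆ ∪ p ∣ ≡ suc ∣ p ∣
  ∣insert∣ zero    (true ∷ p)  a∉ = ⊥-elim (a∉ here)
  ∣insert∣ zero    (false ∷ p) a∉ = cong suc (∣⊥∪∣ p)
  ∣insert∣ (suc a) (true ∷ p)  a∉ = cong suc (∣insert∣ a p (λ h → a∉ (there h)))
  ∣insert∣ (suc a) (false ∷ p) a∉ = ∣insert∣ a p (λ h → a∉ (there h))

-- What a copy of Q_k(r) looks like in a k-partite hypergraph given by a list of k-tuples.
record QConfig {k : ℕ} (r : ℕ) (𝒳 : List (Vec ℕ k)) : Set where
  field
    tup     : Fin r → Vec ℕ k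
    loc     : Fin r → Fin k
    tup∈    : ∀ i → tup i ∈ˡ 𝒳
    loc-inj : ∀ {i j} → loc i ≡ loc j → i ≡ j
    agree   : ∀ {i j p} → p ≢ loc i → p ≢ loc j → lookup (tup i) p ≡ lookup (tup j) p
    differ  : ∀ {i j} → i ≢ j → lookup (tup i) (loc i) ≢ lookup (tup j) (loc i)

module Partite (k W n : ℕ) (kW≤n : k * suc W ≤ n) (𝒳 : List (Vec ℕ k)) (uniq : Unique 𝒳)
               (bounded : ∀ {x} → x ∈ˡ 𝒳 → ∀ p → lookup x p < suc W) where

  -- Reduction modulo the size of a part keeps `vtx` total; on tuples of the family, whose entries
  -- are below that size, it changes nothing.
  value : ℕ → Fin (suc W)
  value v = Fin.fromℕ< (m%n<n v (suc W))

  opaque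
    vtx : Fin k → ℕ → Fin n
    vtx p v = Fin.inject≤ (combine p (value v)) kW≤n

    vtx-part : ∀ {p p′ v v′} → vtx p v ≡ vtx p′ v′ → p ≡ p′
    vtx-part {p} {p′} {v} {v′} eq = Fin.combine-injectiveˡ p (value v) p′ (value v′) (Fin.inject≤-injective kW≤n kW≤n _ _ eq)

    vtx-value : ∀ {p p′ v v′} → v < suc W → v′ < suc W → vtx p v ≡ vtx p′ v′ → v ≡ v′
    vtx-value {p} {p′} {v} {v′} b b′ eq = trans (sym (m<n⇒m%n≡m b)) (trans (sym (Fin.toℕ-fromℕ< (m%n<n v (suc W))))
      (trans (cong toℕ (Fin.combine-injectiveʳ p (value v) p′ (value v′) (Fin.inject≤-injective kW≤n kW≤n _ _ eq)))
        (trans (Fin.toℕ-fromℕ< (m%n<n v′ (suc W))) (m<n⇒m%n≡m b′))))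

  vertices : Vec ℕ k → Vec (Fin n) k
  vertices x = Vec.tabulate (λ p → vtx p (lookup x p))

  lookup-vertices : ∀ x p → lookup (vertices x) p ≡ vtx p (lookup x p)
  lookup-vertices x p = Vec.lookup∘tabulate _ p

  edgeOf : Vec ℕ k → Subset n
  edgeOf x = setOf (vertices x)

  edgeOf⁻ : ∀ x {v} → v ∈ edgeOf x → Σ (Fin k) λ p → vtx p (lookup x p) ≡ v
  edgeOf⁻ x v∈ = let (p , eq) = setOf⁻ (vertices x) v∈ in p , trans (sym (lookup-vertices x p)) eq

  edgeOf⁺ : ∀ x p → vtx p (lookup x p) ∈ edgeOf x
  edgeOf⁺ x p = subst (_∈ edgeOf x) (lookup-vertices x p) (setOf⁺ (vertices x) p)

  edgeOf-size : ∀ x → ∣ edgeOf x ∣ ≡ k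
  edgeOf-size x = Distinct⇒∣setOf∣≡ (vertices x) (λ {p} {p′} eq → vtx-part (trans (sym (lookup-vertices x p)) (trans eq (lookup-vertices x p′))))

  edgeOf-injective : ∀ {x y} → x ∈ˡ 𝒳 → y ∈ˡ 𝒳 → edgeOf x ≡ edgeOf y → x ≡ y
  edgeOf-injective {x} {y} x∈ y∈ eq = lookup-ext at
    where
    at : ∀ p → lookup x p ≡ lookup y p
    at p with edgeOf⁻ y (subst (vtx p (lookup x p) ∈_) eq (edgeOf⁺ x p))
    ... | p′ , e with refl ← vtx-part {p′} {p} e = sym (vtx-value {p} {p} (bounded y∈ p) (bounded x∈ p) e)

  edgeList-unique : ∀ xs → Unique xs → (∀ {x} → x ∈ˡ xs → x ∈ˡ 𝒳) → Unique (map edgeOf xs)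
  edgeList-unique []       _            sub = []
  edgeList-unique (x ∷ xs) (fresh ∷ uq) sub = All.map⁺ (All.tabulate (λ {y} y∈ eq → All.lookup fresh y∈ (edgeOf-injective (sub (here refl)) (sub (there y∈)) eq)))
    ∷ edgeList-unique xs uq (λ m → sub (there m))

  graph : KGraph k n
  graph = record { edges = map edgeOf 𝒳 ; unique = edgeList-unique 𝒳 uniq (λ m → m) ; uniform = All.map⁺ (All.tabulate (λ {x} _ → edgeOf-size x)) }

  graph-size : e[ graph ] ≡ length 𝒳
  graph-size = List.length-map edgeOf 𝒳

  module FromQ (r : ℕ) (3≤r : 3 ≤ r) (φ : Fin ((k ∸ r) + r + r) → Fin n) (φ-inj : Injective _≡_ _≡_ φ)
               (inE : All (λ e → image φ e ∈ˡ edges graph) (QEdges k r)) where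
    open Vertices k r

    third : ∀ (i j : Fin r) → Σ (Fin r) λ l → l ≢ i × l ≢ j
    third i j = [ (λ p → z zero , p) , [ (λ p → z (suc zero) , p) , (λ p → z (suc (suc zero)) , p) ]′ ]′
        (avoid₂ Fin._≟_ (z zero) (z (suc zero)) (z (suc (suc zero))) (ne λ ()) (ne λ ()) (ne λ ()) i j)
      where
      z : Fin 3 → Fin r
      z a = Fin.inject≤ a 3≤r
      ne : ∀ {a b : Fin 3} → a ≢ b → z a ≢ z b
      ne {a} {b} h eq = h (Fin.inject≤-injective 3≤r 3≤r a b eq)

    opaque
      preimage : ∀ i → Σ (Vec ℕ k) λ x → x ∈ˡ 𝒳 × image φ (QEdge k r i) ≡ edgeOf x
      preimage i = ∈-map⁻ edgeOf (All.lookup inE (∈-map⁺ (QEdge k r) (∈-allFin i)))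

    tup : Fin r → Vec ℕ k
    tup i = proj₁ (preimage i)

    tup∈ : ∀ i → tup i ∈ˡ 𝒳
    tup∈ i = proj₁ (proj₂ (preimage i))

    locate : ∀ i {u} → u ∈ QEdge k r i → Σ (Fin k) λ p → vtx p (lookup (tup i) p) ≡ φ u
    locate i {u} u∈ = edgeOf⁻ (tup i) (subst (φ u ∈_) (proj₂ (proj₂ (preimage i))) (image⁺ φ (QEdge k r i) u∈))

    occupant : ∀ i p → Σ _ λ u → u ∈ QEdge k r i × φ u ≡ vtx p (lookup (tup i) p)
    occupant i p = image⁻ φ (QEdge k r i) (subst (vtx p (lookup (tup i) p) ∈_) (sym (proj₂ (proj₂ (preimage i)))) (edgeOf⁺ (tup i) p))

    same-part : ∀ {i u p v} → u ∈ QEdge k r i → φ u ≡ vtx p v → vtx p (lookup (tup i) p) ≡ φ u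
    same-part {i} {u} {p} {v} u∈ eq = let (p′ , e) = locate i u∈ in subst (λ p → vtx p (lookup (tup i) p) ≡ φ u) (vtx-part {p′} {p} (trans e eq)) e

    other : Fin r → Fin r
    other j = proj₁ (third j j)

    other≢ : ∀ j → j ≢ other j
    other≢ j eq = proj₁ (proj₂ (third j j)) (sym eq)

    -- The part that contains b_j. It is read off from another edge because edge `j` omits b_j;
    -- `same-part` makes the choice of edge irrelevant.
    loc : Fin r → Fin k
    loc j = proj₁ (locate (other j) (B∈ (other j) (other≢ j)))

    at-B : ∀ {i j} → j ≢ i → vtx (loc j) (lookup (tup i) (loc j)) ≡ φ (vB j)
    at-B {i} {j} j≢i = same-part (B∈ i j≢i) (sym (proj₂ (locate (other j) (B∈ (other j) (other≢ j)))))

    vB-injective : ∀ {i j} → vB i ≡ vB j → i ≡ j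
    vB-injective {i} {j} eq = Fin.↑ʳ-injective (k ∸ r) i j (Fin.↑ˡ-injective r _ _ eq)

    loc-inj : ∀ {i j} → loc i ≡ loc j → i ≡ j
    loc-inj {i} {j} eq = let (l , l≢i , l≢j) = third i j in
      vB-injective (φ-inj (trans (sym (at-B (λ e → l≢i (sym e)))) (trans (cong (λ p → vtx p (lookup (tup l) p)) eq) (at-B (λ e → l≢j (sym e))))))

    -- An edge has one vertex in each part. The occupant of the part of b_i in edge `i` cannot be in
    -- A, which would meet b_i in another edge, nor another b_j, whose part is different; only c_i
    -- remains.
    at-C : ∀ i → vtx (loc i) (lookup (tup i) (loc i)) ≡ φ (vC i)
    at-C i = let (u , u∈ , e) = occupant i (loc i) in which (view u) u∈ e
      where
      which : ∀ {u} → View u → u ∈ QEdge k r i → φ u ≡ vtx (loc i) (lookup (tup i) (loc i)) → vtx (loc i) (lookup (tup i) (loc i)) ≡ φ (vC i)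
      which (isA a) u∈ e = ⊥-elim (↑ˡ≢↑ʳ a i (Fin.↑ˡ-injective r _ _ (φ-inj (trans (sym (same-part (A∈ (other i) a) e)) (at-B (other≢ i))))))
      which (isB j) u∈ e = ⊥-elim (B∈⁻ i u∈ (sym (loc-inj (vtx-part (trans (sym e) (sym (at-B (B∈⁻ i u∈))))))))
      which (isC j) u∈ e with refl ← C∈⁻ i u∈ = sym e

    agree : ∀ {i j p} → p ≢ loc i → p ≢ loc j → lookup (tup i) p ≡ lookup (tup j) p
    agree {i} {j} {p} p≢i p≢j = let (u , u∈ , e) = occupant i p in which (view u) u∈ e
      where
      conclude : ∀ {u} → vtx p (lookup (tup j) p) ≡ φ u → φ u ≡ vtx p (lookup (tup i) p) → lookup (tup i) p ≡ lookup (tup j) p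
      conclude e′ e = vtx-value {p} {p} (bounded (tup∈ i) p) (bounded (tup∈ j) p) (sym (trans e′ e))
      which : ∀ {u} → View u → u ∈ QEdge k r i → φ u ≡ vtx p (lookup (tup i) p) → lookup (tup i) p ≡ lookup (tup j) p
      which (isA a) u∈ e = conclude (same-part (A∈ j a) e) e
      which (isB l) u∈ e = conclude (same-part (B∈ j (λ { refl → p≢j (vtx-part (trans (sym e) (sym (at-B (B∈⁻ i u∈))))) })) e) e
      which (isC l) u∈ e with refl ← C∈⁻ i u∈ = ⊥-elim (p≢i (vtx-part (trans (sym e) (sym (at-C i)))))

    differ : ∀ {i j} → i ≢ j → lookup (tup i) (loc i) ≢ lookup (tup j) (loc i)
    differ {i} {j} i≢j eq = ↑ˡ≢↑ʳ ((k ∸ r) ↑ʳ i) i (φ-inj (sym (trans (sym (at-C i)) (trans (cong (vtx (loc i)) eq) (at-B i≢j)))))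

    config : QConfig r 𝒳
    config = record { tup = tup ; loc = loc ; tup∈ = tup∈ ; loc-inj = loc-inj ; agree = agree ; differ = differ }

  graph-free : ∀ r → 3 ≤ r → ¬ QConfig r 𝒳 → ¬ ContainsQ k r graph
  graph-free r 3≤r none (φ , φ-inj , inE) = none (FromQ.config r 3≤r φ φ-inj inE)

-- Integer linear forms

sumℕ : ∀ {m} → (Fin m → ℕ) → ℕ
sumℕ {zero}  f = 0
sumℕ {suc m} f = f zero + sumℕ (λ a → f (suc a))

sumℤ : ∀ {m} → (Fin m → ℤ) → ℤ
sumℤ {zero}  f = 0ℤ
sumℤ {suc m} f = f zero ℤ.+ sumℤ (λ a → f (suc a))

sumℤ-cong : ∀ {m} {f g : Fin m → ℤ} → (∀ a → f a ≡ g a) → sumℤ f ≡ sumℤ g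
sumℤ-cong {zero}  h = refl
sumℤ-cong {suc m} h = cong₂ ℤ._+_ (h zero) (sumℤ-cong (λ a → h (suc a)))

pos-sumℕ : ∀ {m} (f : Fin m → ℕ) → pos (sumℕ f) ≡ sumℤ (λ a → pos (f a))
pos-sumℕ {zero}  f = refl
pos-sumℕ {suc m} f = trans (ℤ.pos-+ (f zero) (sumℕ (λ a → f (suc a)))) (cong (ℤ._+_ (pos (f zero))) (pos-sumℕ (λ a → f (suc a))))

sumℕ-≤ : ∀ {m} (f : Fin m → ℕ) {c} → (∀ a → f a ≤ c) → sumℕ f ≤ m * c
sumℕ-≤ {zero}  f h = z≤n
sumℕ-≤ {suc m} f h = ℕ.+-mono-≤ (h zero) (sumℕ-≤ (λ a → f (suc a)) (λ a → h (suc a)))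

sumℤ-+ : ∀ {m} (f g : Fin m → ℤ) → sumℤ (λ a → f a ℤ.+ g a) ≡ sumℤ f ℤ.+ sumℤ g
sumℤ-+ {zero}  f g = refl
sumℤ-+ {suc m} f g = trans (cong (ℤ._+_ (f zero ℤ.+ g zero)) (sumℤ-+ (λ a → f (suc a)) (λ a → g (suc a)))) (lem (f zero) (g zero) _ _)
  where
  lem : ∀ a b c d → a ℤ.+ b ℤ.+ (c ℤ.+ d) ≡ a ℤ.+ c ℤ.+ (b ℤ.+ d)
  lem = solve-∀ ℤring

sumℤ-* : ∀ {m} c (f : Fin m → ℤ) → sumℤ (λ a → c ℤ.* f a) ≡ c ℤ.* sumℤ f
sumℤ-* {zero}  c f = sym (ℤ.*-zeroʳ c)
sumℤ-* {suc m} c f = trans (cong (ℤ._+_ (c ℤ.* f zero)) (sumℤ-* c (λ a → f (suc a)))) (sym (ℤ.*-distribˡ-+ c (f zero) _))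

sumℤ-change : ∀ {m} (f g : Fin m → ℤ) a₀ → (∀ a → a ≢ a₀ → f a ≡ g a) → sumℤ f ≡ sumℤ g ℤ.+ (f a₀ ℤ.- g a₀)
sumℤ-change {suc m} f g zero h = trans (cong (ℤ._+_ (f zero)) (sumℤ-cong (λ a → h (suc a) λ ()))) (lem (f zero) (g zero) _)
  where
  lem : ∀ a b c → a ℤ.+ c ≡ b ℤ.+ c ℤ.+ (a ℤ.- b)
  lem = solve-∀ ℤring
sumℤ-change {suc m} f g (suc a₀) h = trans (cong₂ ℤ._+_ (h zero λ ()) (sumℤ-change (λ a → f (suc a)) (λ a → g (suc a)) a₀ (λ a ne → h (suc a) (λ eq → ne (Fin.suc-injective eq)))))
  (sym (ℤ.+-assoc (g zero) _ _))

i*j≡0⇒ : ∀ {i j} → i ≢ 0ℤ → i ℤ.* j ≡ 0ℤ → j ≡ 0ℤ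
i*j≡0⇒ {i} {j} i≢0 eq = [ (λ p → contradiction p i≢0) , (λ p → p) ]′ (ℤ.i*j≡0⇒i≡0∨j≡0 i eq)

sgn : ∀ {m} → Fin m → ℤ
sgn zero    = ℤ.- 1ℤ
sgn (suc _) = 1ℤ

sgn≢0 : ∀ {m} (a : Fin m) → sgn a ≢ 0ℤ
sgn≢0 zero    ()
sgn≢0 (suc _) ()

-- The forms −f₀ + f₁ + f₂ + ⋯ and f₁ + 2 f₂ + 3 f₃ + ⋯; their coefficients have ratio p at position p.
Λ Ω : ∀ {m} → (Fin m → ℤ) → ℤ
Λ f = sumℤ (λ a → sgn a ℤ.* f a)
Ω f = sumℤ (λ a → pos (toℕ a) ℤ.* (sgn a ℤ.* f a))

private
  collect-diff : ∀ c x y → c ℤ.* x ℤ.- c ℤ.* y ≡ c ℤ.* (x ℤ.- y)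
  collect-diff = solve-∀ ℤring

  collect-diff₂ : ∀ n c x y → n ℤ.* (c ℤ.* x) ℤ.- n ℤ.* (c ℤ.* y) ≡ n ℤ.* (c ℤ.* (x ℤ.- y))
  collect-diff₂ = solve-∀ ℤring

Λ-change : ∀ {m} (f g : Fin m → ℤ) a₀ → (∀ a → a ≢ a₀ → f a ≡ g a) → Λ f ≡ Λ g ℤ.+ sgn a₀ ℤ.* (f a₀ ℤ.- g a₀)
Λ-change f g a₀ h = trans (sumℤ-change _ _ a₀ (λ a ne → cong (λ z → sgn a ℤ.* z) (h a ne))) (cong (λ z → Λ g ℤ.+ z) (collect-diff (sgn a₀) (f a₀) (g a₀)))

Ω-change : ∀ {m} (f g : Fin m → ℤ) a₀ → (∀ a → a ≢ a₀ → f a ≡ g a) → Ω f ≡ Ω g ℤ.+ pos (toℕ a₀) ℤ.* (sgn a₀ ℤ.* (f a₀ ℤ.- g a₀))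
Ω-change f g a₀ h = trans (sumℤ-change _ _ a₀ (λ a ne → cong (λ z → pos (toℕ a) ℤ.* (sgn a ℤ.* z)) (h a ne))) (cong (λ z → Ω g ℤ.+ z) (collect-diff₂ (pos (toℕ a₀)) (sgn a₀) (f a₀) (g a₀)))

Λ-determines : ∀ {m} (f g : Fin m → ℤ) a₀ → (∀ a → a ≢ a₀ → f a ≡ g a) → Λ f ≡ Λ g → f a₀ ≡ g a₀
Λ-determines f g a₀ h eq = ℤ.i-j≡0⇒i≡j (f a₀) (g a₀) (i*j≡0⇒ (sgn≢0 a₀) (trans (lem (Λ g) _) (trans (cong (ℤ._- Λ g) (trans (sym (Λ-change f g a₀ h)) eq)) (ℤ.+-inverseʳ (Λ g)))))
  where
  lem : ∀ a b → b ≡ a ℤ.+ b ℤ.- a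
  lem = solve-∀ ℤring

-- Copies of Q_k(r) among tuples satisfying a linear equation

module LinearConfig (t₁ r′ : ℕ) (2≤r′ : 2 ≤ r′) (𝒳 : List (Vec ℕ (suc t₁ + r′))) where

  t : ℕ
  t = suc t₁

  part : Vec ℕ (t + r′) → Fin t → ℤ
  part x a = pos (lookup x (a ↑ˡ r′))

  module _ (lin : ∀ {x} → x ∈ˡ 𝒳 → Λ (part x) ≡ 0ℤ) (cfg : QConfig (suc r′) 𝒳) where
    open QConfig cfg

    Λ≡ : ∀ i j → Λ (part (tup i)) ≡ Λ (part (tup j))
    Λ≡ i j = trans (lin (tup∈ i)) (sym (lin (tup∈ j)))

    -- If one position is linear and another free, the two tuples agree on all linear coordinates
    -- except `a`. The equation has a nonzero coefficient there and determines it, against `differ`.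
    mixed : ∀ {i j a b} → loc i ≡ a ↑ˡ r′ → loc j ≡ t ↑ʳ b → ⊥
    mixed {i} {j} {a} {b} pi pj = differ i≢j (subst (λ p → lookup (tup i) p ≡ lookup (tup j) p) (sym pi) (ℤ.+-injective
        (Λ-determines (part (tup i)) (part (tup j)) a (λ a′ ne → cong pos (agree (λ e → ne (Fin.↑ˡ-injective r′ a′ a (trans e pi))) (λ e → ↑ˡ≢↑ʳ a′ b (trans e pj)))) (Λ≡ i j))))
      where
      i≢j : i ≢ j
      i≢j refl = ↑ˡ≢↑ʳ a b (trans (sym pi) pj)

    data Where (i : Fin (suc r′)) : Set where
      inT : ∀ a → loc i ≡ a ↑ˡ r′ → Where i
      inS : ∀ b → loc i ≡ t ↑ʳ b → Where i

    locate : ∀ i → Where i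
    locate i with splitAt t (loc i) in eq
    ... | inj₁ a = inT a (trans (sym (Fin.join-splitAt t r′ (loc i))) (cong (join t r′) eq))
    ... | inj₂ b = inS b (trans (sym (Fin.join-splitAt t r′ (loc i))) (cong (join t r′) eq))

    S-index : ∀ {i} → Where i → Fin r′
    S-index (inT a _) = Fin.inject≤ {2} zero 2≤r′
    S-index (inS b _) = b

    -- There are r positions but only r - 1 free coordinates. Linear positions receive a dummy
    -- index, so a collision is either between two free positions, which `loc-inj` forbids, or
    -- exhibits a linear one.
    someT : Σ (Fin (suc r′)) λ i → Σ (Fin t) λ a → loc i ≡ a ↑ˡ r′
    someT with Fin.pigeonhole (ℕ.n<1+n r′) (λ i → S-index (locate i))
    ... | i , j , i<j , eq with locate i | locate j
    ...   | inT a p | _       = i , a , p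
    ...   | inS b p | inT a q = j , a , q
    ...   | inS b p | inS c q with refl ← eq = ⊥-elim (Fin.<⇒≢ i<j (loc-inj (trans p (sym q))))

    allT : ∀ j → Σ (Fin t) λ a → loc j ≡ a ↑ˡ r′
    allT j with locate j
    ... | inT a p = a , p
    ... | inS b p = ⊥-elim (mixed (proj₂ (proj₂ someT)) p)

    -- All r positions lie among the t linear ones.
    few-T : t < suc r′ → ⊥
    few-T t<r = let (i , j , i<j , eq) = Fin.pigeonhole t<r (λ i → proj₁ (allT i)) in
      Fin.<⇒≢ i<j (loc-inj (trans (proj₂ (allT i)) (trans (cong (_↑ˡ r′) eq) (sym (proj₂ (allT j))))))

    module Three (κ : ℤ) (σ : ∀ {x} → x ∈ˡ 𝒳 → ℤ) (Ω≡ : ∀ {x} (m : x ∈ˡ 𝒳) → Ω (part x) ≡ σ m ℤ.+ κ) where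

      i₁ i₂ i₃ : Fin (suc r′)
      i₁ = zero
      i₂ = suc (Fin.inject≤ {2} zero 2≤r′)
      i₃ = suc (Fin.inject≤ {2} (suc zero) 2≤r′)

      2≢3 : i₂ ≢ i₃
      2≢3 eq with () ← Fin.inject≤-injective 2≤r′ 2≤r′ zero (suc zero) (Fin.suc-injective eq)

      at : Fin (suc r′) → Fin t
      at i = proj₁ (allT i)

      f : Fin (suc r′) → Fin t → ℤ
      f i = part (tup i)

      at-inj : ∀ {i j} → at i ≡ at j → i ≡ j
      at-inj {i} {j} eq = loc-inj (trans (proj₂ (allT i)) (trans (cong (_↑ˡ r′) eq) (sym (proj₂ (allT j)))))

      f-agree : ∀ i j a → a ≢ at i → a ≢ at j → f i a ≡ f j a
      f-agree i j a ne ne′ = cong pos (agree (λ e → ne (Fin.↑ˡ-injective r′ a (at i) (trans e (proj₂ (allT i))))) (λ e → ne′ (Fin.↑ˡ-injective r′ a (at j) (trans e (proj₂ (allT j))))))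

      -- The tuple that plays A together with B: the first edge with its exchanged coordinate
      -- restored from the second. Each of the three edges differs from it in one position only.
      base : Fin t → ℤ
      base a with a Fin.≟ at i₁
      ... | yes _ = f i₂ a
      ... | no _  = f i₁ a

      base-at₁ : base (at i₁) ≡ f i₂ (at i₁)
      base-at₁ with at i₁ Fin.≟ at i₁
      ... | yes _ = refl
      ... | no ne = contradiction refl ne

      base₁ : ∀ a → a ≢ at i₁ → f i₁ a ≡ base a
      base₁ a ne with a Fin.≟ at i₁
      ... | yes eq = contradiction eq ne
      ... | no _   = refl

      base₂ : ∀ a → a ≢ at i₂ → f i₂ a ≡ base a
      base₂ a ne with a Fin.≟ at i₁
      ... | yes _  = refl
      ... | no ne′ = f-agree i₂ i₁ a ne ne′

      base₃ : ∀ a → a ≢ at i₃ → f i₃ a ≡ base a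
      base₃ a ne with a Fin.≟ at i₁ | a Fin.≟ at i₂
      ... | no ne′   | _        = f-agree i₃ i₁ a ne ne′
      ... | yes refl | yes eq   = contradiction (at-inj eq) λ ()
      ... | yes refl | no ne′   = f-agree i₃ i₂ a ne ne′

      s : Fin (suc r′) → ℤ
      s i = σ (tup∈ i)

      pt : Fin (suc r′) → ℤ
      pt i = pos (toℕ (at i))

      -- Membership in the family forces the single change from `base` to contribute -Λ(base) to Λ.
      -- At position p it contributes p times as much to Ω, so the three values of `s` are collinear
      -- as a function of the positions.
      on-line : ∀ i → (∀ a → a ≢ at i → f i a ≡ base a) → s i ≡ Ω base ℤ.- κ ℤ.- pt i ℤ.* Λ base
      on-line i h = trans (lem₁ (s i) κ) (trans (cong (ℤ._- κ) (trans (sym (Ω≡ (tup∈ i))) (Ω-change (f i) base (at i) h)))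
          (trans (cong (λ z → Ω base ℤ.+ pt i ℤ.* z ℤ.- κ) step) (lem₂ (Ω base) (pt i) (Λ base) κ)))
        where
        lem₁ : ∀ s k → s ≡ s ℤ.+ k ℤ.- k
        lem₁ = solve-∀ ℤring
        lem₂ : ∀ o p l k → o ℤ.+ p ℤ.* (ℤ.- l) ℤ.- k ≡ o ℤ.- k ℤ.- p ℤ.* l
        lem₂ = solve-∀ ℤring
        lem₃ : ∀ a b → b ≡ a ℤ.+ b ℤ.+ ℤ.- a
        lem₃ = solve-∀ ℤring
        step : sgn (at i) ℤ.* (f i (at i) ℤ.- base (at i)) ≡ ℤ.- Λ base
        step = trans (lem₃ (Λ base) _) (trans (cong (ℤ._+ (ℤ.- Λ base)) (trans (sym (Λ-change (f i) base (at i) h)) (lin (tup∈ i)))) (ℤ.+-identityˡ _))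

      relation : pt i₂ ℤ.* s i₁ ℤ.+ pt i₃ ℤ.* s i₂ ℤ.+ pt i₁ ℤ.* s i₃ ≡ pt i₃ ℤ.* s i₁ ℤ.+ pt i₁ ℤ.* s i₂ ℤ.+ pt i₂ ℤ.* s i₃
      relation = combine₃ {pt i₁} {pt i₂} {pt i₃} {Ω base ℤ.- κ} {Λ base} (on-line i₁ base₁) (on-line i₂ base₂) (on-line i₃ base₃)
        where
        combine₃ : ∀ {a b c k u x y z : ℤ} → x ≡ k ℤ.- a ℤ.* u → y ≡ k ℤ.- b ℤ.* u → z ≡ k ℤ.- c ℤ.* u →
                   b ℤ.* x ℤ.+ c ℤ.* y ℤ.+ a ℤ.* z ≡ c ℤ.* x ℤ.+ a ℤ.* y ℤ.+ b ℤ.* z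
        combine₃ {a} {b} {c} {k} {u} refl refl refl = lem a b c k u
          where
          lem : ∀ a b c k u → b ℤ.* (k ℤ.- a ℤ.* u) ℤ.+ c ℤ.* (k ℤ.- b ℤ.* u) ℤ.+ a ℤ.* (k ℤ.- c ℤ.* u)
                            ≡ c ℤ.* (k ℤ.- a ℤ.* u) ℤ.+ a ℤ.* (k ℤ.- b ℤ.* u) ℤ.+ b ℤ.* (k ℤ.- c ℤ.* u)
          lem = solve-∀ ℤring

      -- Equal values at distinct positions force slope Λ(base) = 0. Then `base` satisfies the
      -- equation itself, so the first edge equals `base` at its own position, against `differ`.
      separated : s i₁ ≢ s i₂
      separated eq = differ {i₁} {i₂} (λ ()) (subst (λ p → lookup (tup i₁) p ≡ lookup (tup i₂) p) (sym (proj₂ (allT i₁))) (ℤ.+-injective f≡))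
        where
        lem : ∀ k a b u → (b ℤ.- a) ℤ.* u ≡ (k ℤ.- a ℤ.* u) ℤ.- (k ℤ.- b ℤ.* u)
        lem = solve-∀ ℤring
        pt≢ : pt i₂ ℤ.- pt i₁ ≢ 0ℤ
        pt≢ e with () ← at-inj {i₂} {i₁} (Fin.toℕ-injective (ℤ.+-injective (ℤ.i-j≡0⇒i≡j (pt i₂) (pt i₁) e)))
        Λ≡0 : Λ base ≡ 0ℤ
        Λ≡0 = i*j≡0⇒ pt≢ (trans (lem (Ω base ℤ.- κ) (pt i₁) (pt i₂) (Λ base)) (trans (cong₂ ℤ._-_ (sym (on-line i₁ base₁)) (trans (sym (on-line i₂ base₂)) (sym eq))) (ℤ.+-inverseʳ (s i₁))))
        f≡ : f i₁ (at i₁) ≡ f i₂ (at i₁)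
        f≡ = trans (Λ-determines (f i₁) base (at i₁) base₁ (trans (lin (tup∈ i₁)) (sym Λ≡0))) base-at₁

      at-distinct : at i₁ ≢ at i₂ × at i₂ ≢ at i₃ × at i₁ ≢ at i₃
      at-distinct = (λ e → contradiction (at-inj e) λ ()) , (λ e → 2≢3 (at-inj e)) , (λ e → contradiction (at-inj e) λ ())

-- Sets without solutions of convex equations

digit : ∀ B {a a′ A A′} → a < suc B → a′ < suc B → a + suc B * A ≡ a′ + suc B * A′ → a ≡ a′ × A ≡ A′
digit B {a} {a′} {A} {A′} a<B a′<B eq = a≡ , ℕ.*-cancelˡ-≡ A A′ (suc B) (ℕ.+-cancelˡ-≡ a _ _ (trans eq (cong (_+ suc B * A′) (sym a≡))))
  where
  low : ∀ a A → a < suc B → (a + suc B * A) % suc B ≡ a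
  low a A a<B = trans (cong (λ z → (a + z) % suc B) (ℕ.*-comm (suc B) A)) (trans ([m+kn]%n≡m%n a A (suc B)) (m<n⇒m%n≡m a<B))
  a≡ : a ≡ a′
  a≡ = trans (sym (low a A a<B)) (trans (cong (_% suc B) eq) (low a′ A′ a′<B))

enc : ℕ → ∀ D → (Fin D → ℕ) → ℕ → ℕ
enc B zero    f top = top
enc B (suc D) f top = f zero + suc B * enc B D (λ i → f (suc i)) top

enc-< : ∀ B D f {top c} → (∀ i → f i < suc B) → top < c → enc B D f top < suc B ^ D * c
enc-< B zero    f {top} {c} h p = subst (top <_) (sym (ℕ.+-identityʳ c)) p
enc-< B (suc D) f {top} {c} h p = ℕ.<-≤-trans (ℕ.+-monoˡ-< (suc B * X) (h zero)) (ℕ.≤-trans (ℕ.≤-reflexive (sym (ℕ.*-suc (suc B) X)))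
    (ℕ.≤-trans (ℕ.*-monoʳ-≤ (suc B) (enc-< B D (λ i → f (suc i)) (λ i → h (suc i)) p)) (ℕ.≤-reflexive (sym (ℕ.*-assoc (suc B) (suc B ^ D) c)))))
  where X = enc B D (λ i → f (suc i)) top

enc-injective : ∀ B D f g {s t} → (∀ i → f i < suc B) → (∀ i → g i < suc B) → enc B D f s ≡ enc B D g t → ∀ i → f i ≡ g i
enc-injective B (suc D) f g hf hg eq zero    = proj₁ (digit B (hf zero) (hg zero) eq)
enc-injective B (suc D) f g hf hg eq (suc i) = enc-injective B D (λ i → f (suc i)) (λ i → g (suc i)) (λ i → hf (suc i)) (λ i → hg (suc i))
  (proj₂ (digit B (hf zero) (hg zero) eq)) i

norm : ∀ {D} → (Fin D → ℕ) → ℕ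
norm f = sumℕ (λ i → f i * f i)

i*i≡pos : ∀ i → i ℤ.* i ≡ pos (ℤ.∣ i ∣ * ℤ.∣ i ∣)
i*i≡pos (pos m)             = sym (ℤ.pos-* m m)
i*i≡pos (ℤ.-[1+ m ])        = refl

sumℕ≡0 : ∀ {D} (f : Fin D → ℕ) → sumℕ f ≡ 0 → ∀ i → f i ≡ 0
sumℕ≡0 f eq zero    = ℕ.m+n≡0⇒m≡0 (f zero) eq
sumℕ≡0 f eq (suc i) = sumℕ≡0 (λ i → f (suc i)) (ℕ.m+n≡0⇒n≡0 (f zero) eq) i

pos-norm : ∀ {D} (f : Fin D → ℕ) → pos (norm f) ≡ sumℤ (λ i → pos (f i) ℤ.* pos (f i))
pos-norm f = trans (pos-sumℕ (λ i → f i * f i)) (sumℤ-cong (λ i → ℤ.pos-* (f i) (f i)))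

module Convex (n₁ n₂ n₃ : ℕ) where

  -- (n₂ − n₃) x + (n₃ − n₁) y + (n₁ − n₂) z = 0, without subtraction.
  Rel : ℕ → ℕ → ℕ → Set
  Rel x y z = n₂ * x + n₃ * y + n₁ * z ≡ n₃ * x + n₁ * y + n₂ * z

  private
    expand : ∀ p q r b x x′ y y′ z z′ → p * (x + b * x′) + q * (y + b * y′) + r * (z + b * z′)
             ≡ (p * x + q * y + r * z) + b * (p * x′ + q * y′ + r * z′)
    expand = solve-∀ ℕring

    bound : ∀ p q r {t h x y z} → p ≤ t → q ≤ t → r ≤ t → x < h → y < h → z < h → p * x + q * y + r * z < suc (3 * (t * h))
    bound p q r {t} {h} pt qt rt xh yh zh = s≤s (ℕ.≤-trans (ℕ.+-mono-≤ (ℕ.+-mono-≤ (ℕ.*-mono-≤ pt (ℕ.<⇒≤ xh)) (ℕ.*-mono-≤ qt (ℕ.<⇒≤ yh))) (ℕ.*-mono-≤ rt (ℕ.<⇒≤ zh))) (ℕ.≤-reflexive (three (t * h))))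
      where
      three : ∀ a → a + a + a ≡ 3 * a
      three = solve-∀ ℕring

  -- The base 3th + 1 exceeds both sides of the relation on single digits, so there are no carries
  -- and the relation holds digit by digit, including for the leading entry.
  enc-Rel : ∀ {t h} → n₁ ≤ t → n₂ ≤ t → n₃ ≤ t → ∀ D (f g k : Fin D → ℕ) {a b c} → (∀ i → f i < h) → (∀ i → g i < h) → (∀ i → k i < h) →
    let B = 3 * (t * h) in Rel (enc B D f a) (enc B D g b) (enc B D k c) → (∀ i → Rel (f i) (g i) (k i)) × Rel a b c
  enc-Rel t₁ t₂ t₃ zero f g k hf hg hk rel = (λ ()) , rel
  enc-Rel {t} {h} t₁ t₂ t₃ (suc D) f g k {a} {b} {c} hf hg hk rel = digits , proj₂ rec
    where
    B = 3 * (t * h)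
    F = enc B D (λ i → f (suc i)) a
    G = enc B D (λ i → g (suc i)) b
    K = enc B D (λ i → k (suc i)) c
    both : Rel (f zero) (g zero) (k zero) × Rel F G K
    both = digit B (bound n₂ n₃ n₁ t₂ t₃ t₁ (hf zero) (hg zero) (hk zero)) (bound n₃ n₁ n₂ t₃ t₁ t₂ (hf zero) (hg zero) (hk zero))
      (trans (sym (expand n₂ n₃ n₁ (suc B) (f zero) F (g zero) G (k zero) K)) (trans rel (expand n₃ n₁ n₂ (suc B) (f zero) F (g zero) G (k zero) K)))
    rec : (∀ i → Rel (f (suc i)) (g (suc i)) (k (suc i))) × Rel a b c
    rec = enc-Rel t₁ t₂ t₃ D (λ i → f (suc i)) (λ i → g (suc i)) (λ i → k (suc i)) (λ i → hf (suc i)) (λ i → hg (suc i)) (λ i → hk (suc i)) (proj₂ both)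
    digits : ∀ i → Rel (f i) (g i) (k i)
    digits zero    = proj₁ both
    digits (suc i) = proj₁ rec i

  α β γ : ℤ
  α = pos n₂ ℤ.- pos n₃
  β = pos n₃ ℤ.- pos n₁
  γ = pos n₁ ℤ.- pos n₂

  form : ℤ → ℤ → ℤ → ℤ
  form x y z = α ℤ.* x ℤ.+ β ℤ.* y ℤ.+ γ ℤ.* z

  pos-lin : ∀ p q r x y z → pos (p * x + q * y + r * z) ≡ pos p ℤ.* pos x ℤ.+ pos q ℤ.* pos y ℤ.+ pos r ℤ.* pos z
  pos-lin p q r x y z = trans (ℤ.pos-+ (p * x + q * y) (r * z)) (cong₂ ℤ._+_ (trans (ℤ.pos-+ (p * x) (q * y)) (cong₂ ℤ._+_ (ℤ.pos-* p x) (ℤ.pos-* q y))) (ℤ.pos-* r z))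

  Rel⇒form : ∀ {x y z} → Rel x y z → form (pos x) (pos y) (pos z) ≡ 0ℤ
  Rel⇒form {x} {y} {z} rel = trans (lem (pos n₁) (pos n₂) (pos n₃) (pos x) (pos y) (pos z))
      (ℤ.i≡j⇒i-j≡0 {i = pos n₂ ℤ.* pos x ℤ.+ pos n₃ ℤ.* pos y ℤ.+ pos n₁ ℤ.* pos z} {j = pos n₃ ℤ.* pos x ℤ.+ pos n₁ ℤ.* pos y ℤ.+ pos n₂ ℤ.* pos z}
        (trans (sym (pos-lin n₂ n₃ n₁ x y z)) (trans (cong pos rel) (pos-lin n₃ n₁ n₂ x y z))))
    where
    lem : ∀ a b c x y z → (b ℤ.- c) ℤ.* x ℤ.+ (c ℤ.- a) ℤ.* y ℤ.+ (a ℤ.- b) ℤ.* z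
          ≡ (b ℤ.* x ℤ.+ c ℤ.* y ℤ.+ a ℤ.* z) ℤ.- (c ℤ.* x ℤ.+ a ℤ.* y ℤ.+ b ℤ.* z)
    lem = solve-∀ ℤring

  -- Strict convexity of the square, in the form of an identity.
  square-form : ∀ x y z → form x y z ≡ 0ℤ → γ ℤ.* form (x ℤ.* x) (y ℤ.* y) (z ℤ.* z) ≡ ℤ.- (α ℤ.* β) ℤ.* ((x ℤ.- y) ℤ.* (x ℤ.- y))
  square-form x y z e≡0 = trans (lem (pos n₁) (pos n₂) (pos n₃) x y z) (trans (cong (λ e → e ℤ.* rest ℤ.+ ℤ.- (α ℤ.* β) ℤ.* ((x ℤ.- y) ℤ.* (x ℤ.- y))) e≡0)
      (trans (cong (ℤ._+ ℤ.- (α ℤ.* β) ℤ.* ((x ℤ.- y) ℤ.* (x ℤ.- y))) (ℤ.*-zeroˡ rest)) (ℤ.+-identityˡ _)))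
    where
    rest : ℤ
    rest = form x y z ℤ.- (α ℤ.* x ℤ.+ β ℤ.* y) ℤ.- (α ℤ.* x ℤ.+ β ℤ.* y)
    lem : ∀ a b c x y z → (a ℤ.- b) ℤ.* ((b ℤ.- c) ℤ.* (x ℤ.* x) ℤ.+ (c ℤ.- a) ℤ.* (y ℤ.* y) ℤ.+ (a ℤ.- b) ℤ.* (z ℤ.* z)) ≡
          ((b ℤ.- c) ℤ.* x ℤ.+ (c ℤ.- a) ℤ.* y ℤ.+ (a ℤ.- b) ℤ.* z) ℤ.*
          (((b ℤ.- c) ℤ.* x ℤ.+ (c ℤ.- a) ℤ.* y ℤ.+ (a ℤ.- b) ℤ.* z) ℤ.- ((b ℤ.- c) ℤ.* x ℤ.+ (c ℤ.- a) ℤ.* y) ℤ.- ((b ℤ.- c) ℤ.* x ℤ.+ (c ℤ.- a) ℤ.* y))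
          ℤ.+ ℤ.- ((b ℤ.- c) ℤ.* (c ℤ.- a)) ℤ.* ((x ℤ.- y) ℤ.* (x ℤ.- y))
    lem = solve-∀ ℤring

  sum-form : ∀ {D} (f g k : Fin D → ℤ) → sumℤ (λ i → form (f i) (g i) (k i)) ≡ form (sumℤ f) (sumℤ g) (sumℤ k)
  sum-form f g k = trans (sumℤ-+ (λ i → α ℤ.* f i ℤ.+ β ℤ.* g i) (λ i → γ ℤ.* k i)) (cong₂ ℤ._+_ (trans (sumℤ-+ (λ i → α ℤ.* f i) (λ i → β ℤ.* g i)) (cong₂ ℤ._+_ (sumℤ-* α f) (sumℤ-* β g))) (sumℤ-* γ k))

  -- Sum `square-form` over the coordinates. The left side vanishes by the relation between the
  -- norms, so the sum of the squares of the differences of `f` and `g` is zero.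
  collapse : n₂ ≢ n₃ → n₃ ≢ n₁ → ∀ {D} (f g k : Fin D → ℕ) → (∀ i → Rel (f i) (g i) (k i)) → Rel (norm f) (norm g) (norm k) → ∀ i → f i ≡ g i
  collapse 2≢3 3≢1 f g k rel rel-norm i = ℤ.+-injective (ℤ.i-j≡0⇒i≡j (pos (f i)) (pos (g i)) (ℤ.∣i∣≡0⇒i≡0 (sq≡0 (sumℕ≡0 (λ i → ℤ.∣ δ i ∣ * ℤ.∣ δ i ∣) (ℤ.+-injective (trans (pos-sumℕ (λ i → ℤ.∣ δ i ∣ * ℤ.∣ δ i ∣)) (trans (sumℤ-cong (λ i → sym (i*i≡pos (δ i)))) Σ≡0))) i))))
    where
    δ : Fin _ → ℤ
    δ i = pos (f i) ℤ.- pos (g i)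
    sq≡0 : ∀ {m} → m * m ≡ 0 → m ≡ 0
    sq≡0 {zero} _ = refl
    nz : ∀ {a b} → a ≢ b → pos a ℤ.- pos b ≢ 0ℤ
    nz {a} {b} ne e = ne (ℤ.+-injective (ℤ.i-j≡0⇒i≡j (pos a) (pos b) e))
    c : ℤ
    c = ℤ.- (α ℤ.* β)
    c≢0 : c ≢ 0ℤ
    c≢0 e = nz 3≢1 (i*j≡0⇒ (nz 2≢3) (trans (sym (ℤ.neg-involutive (α ℤ.* β))) (cong ℤ.-_ e)))
    sq : (Fin _ → ℕ) → Fin _ → ℤ
    sq f i = pos (f i) ℤ.* pos (f i)
    form-norm : form (sumℤ (sq f)) (sumℤ (sq g)) (sumℤ (sq k)) ≡ 0ℤ
    form-norm = trans (cong₃ form (sym (pos-norm f)) (sym (pos-norm g)) (sym (pos-norm k))) (Rel⇒form {norm f} {norm g} {norm k} rel-norm)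
      where
      cong₃ : ∀ (F : ℤ → ℤ → ℤ → ℤ) {a a′ b b′ c c′} → a ≡ a′ → b ≡ b′ → c ≡ c′ → F a b c ≡ F a′ b′ c′
      cong₃ F refl refl refl = refl
    Σ≡0 : sumℤ (λ i → δ i ℤ.* δ i) ≡ 0ℤ
    Σ≡0 = i*j≡0⇒ c≢0 (trans (sym (sumℤ-* c (λ i → δ i ℤ.* δ i))) (trans (sumℤ-cong (λ i → sym (square-form (pos (f i)) (pos (g i)) (pos (k i)) (Rel⇒form {f i} {g i} {k i} (rel i)))))
      (trans (sumℤ-* γ (λ i → form (sq f i) (sq g i) (sq k i))) (trans (cong (λ z → γ ℤ.* z) (trans (sum-form (sq f) (sq g) (sq k)) form-norm)) (ℤ.*-zeroʳ γ)))))

-- Families of tuples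

allVec : ℕ → ∀ m → List (Vec ℕ m)
allVec L zero    = [] ∷ []
allVec L (suc m) = cartesianProductWith _∷_ (upTo L) (allVec L m)

length-product : ∀ {A B C : Set} (f : A → B → C) xs ys → length (cartesianProductWith f xs ys) ≡ length xs * length ys
length-product f []       ys = refl
length-product f (x ∷ xs) ys = trans (List.length-++ (map (f x) ys)) (cong₂ _+_ (List.length-map (f x) ys) (length-product f xs ys))

length-allVec : ∀ L m → length (allVec L m) ≡ L ^ m
length-allVec L zero    = refl
length-allVec L (suc m) = trans (length-product _∷_ (upTo L) (allVec L m)) (cong₂ _*_ (List.length-upTo L) (length-allVec L m))

allVec-unique : ∀ L m → Unique (allVec L m)
allVec-unique L zero    = [] ∷ []
allVec-unique L (suc m) = Unique.cartesianProductWith⁺ _∷_ Vec.∷-injective (Unique.upTo⁺ L) (allVec-unique L m)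

allVec-< : ∀ {L m x} → x ∈ˡ allVec L m → ∀ p → lookup x p < L
allVec-< {L} {suc m} x∈ p with ∈-cartesianProductWith⁻ _∷_ (upTo L) (allVec L m) x∈
allVec-< {L} {suc m} x∈ zero    | a , y , a∈ , y∈ , refl = ∈-upTo⁻ a∈
allVec-< {L} {suc m} x∈ (suc p) | a , y , a∈ , y∈ , refl = allVec-< y∈ p

++-bounded : ∀ {m s W} (x : Vec ℕ m) (y : Vec ℕ s) → (∀ p → lookup x p < W) → (∀ p → lookup y p < W) → ∀ p → lookup (x Vec.++ y) p < W
++-bounded []      y hx hy p       = hy p
++-bounded (a ∷ x) y hx hy zero    = hx zero
++-bounded (a ∷ x) y hx hy (suc p) = ++-bounded x y (λ p → hx (suc p)) hy p

module Family₁ (t₁ r′ L : ℕ) where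

  Params : Set
  Params = Vec ℕ t₁ × Vec ℕ r′

  params : List Params
  params = cartesianProduct (allVec L t₁) (allVec L r′)

  mk : Params → Vec ℕ (suc t₁ + r′)
  mk (z , y) = (sumℕ (lookup z) ∷ z) Vec.++ y

  mk-injective : ∀ {a b} → mk a ≡ mk b → a ≡ b
  mk-injective {z , y} {z′ , y′} eq = cong₂ _,_ (Vec.++-injectiveˡ z z′ (Vec.∷-injectiveʳ eq)) (Vec.++-injectiveʳ z z′ (Vec.∷-injectiveʳ eq))

  𝒳 : List (Vec ℕ (suc t₁ + r′))
  𝒳 = map mk params

  unique′ : Unique 𝒳
  unique′ = Unique.map⁺ mk-injective (Unique.cartesianProduct⁺ (allVec-unique L t₁) (allVec-unique L r′))

  size : length 𝒳 ≡ L ^ (t₁ + r′)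
  size = trans (List.length-map mk params) (trans (length-product _,_ (allVec L t₁) (allVec L r′)) (trans (cong₂ _*_ (length-allVec L t₁) (length-allVec L r′)) (sym (ℕ.^-distribˡ-+-* L t₁ r′))))

  W : ℕ
  W = suc t₁ * L

  L≤W : L ≤ W
  L≤W = ℕ.m≤m+n L (t₁ * L)

  bounded : ∀ {x} → x ∈ˡ 𝒳 → ∀ p → lookup x p < suc W
  bounded x∈ with ∈-map⁻ mk x∈
  ... | (z , y) , zy∈ , refl = let (z∈ , y∈) = ∈-cartesianProduct⁻ (allVec L t₁) (allVec L r′) zy∈ in
    ++-bounded (sumℕ (lookup z) ∷ z) y (first z z∈) (λ p → ℕ.≤-trans (allVec-< y∈ p) (ℕ.≤-trans L≤W (ℕ.n≤1+n W)))
    where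
    first : ∀ z → z ∈ˡ allVec L t₁ → ∀ p → lookup (sumℕ (lookup z) ∷ z) p < suc W
    first z z∈ zero    = s≤s (ℕ.≤-trans (sumℕ-≤ (lookup z) (λ a → ℕ.<⇒≤ (allVec-< z∈ a))) (ℕ.m≤n+m (t₁ * L) L))
    first z z∈ (suc p) = ℕ.≤-trans (allVec-< z∈ p) (ℕ.≤-trans L≤W (ℕ.n≤1+n W))

  module _ (2≤r′ : 2 ≤ r′) where
    open LinearConfig t₁ r′ 2≤r′ 𝒳

    lin : ∀ {x} → x ∈ˡ 𝒳 → Λ (part x) ≡ 0ℤ
    lin x∈ with ∈-map⁻ mk x∈
    ... | (z , y) , _ , refl = trans (cong₂ (λ u v → ℤ.- 1ℤ ℤ.* u ℤ.+ v) (pos-sumℕ (lookup z)) (sumℤ-cong (λ a → trans (ℤ.*-identityˡ _) (cong pos (Vec.lookup-++ˡ z y a))))) (lem (sumℤ (λ a → pos (lookup z a))))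
      where
      lem : ∀ u → ℤ.- 1ℤ ℤ.* u ℤ.+ u ≡ 0ℤ
      lem = solve-∀ ℤring

    no-config : suc t₁ < suc r′ → ¬ QConfig (suc r′) 𝒳
    no-config t<r cfg = few-T lin cfg t<r

module Family₂ (t₂ r′ D h : ℕ) where

  -- `B` is the carry-free bound of `enc-Rel`. `L` bounds the codes `s v`, whose leading entry is at
  -- most Dh², and it is also the side of the box for the free coordinates.
  t B L : ℕ
  t = suc (suc t₂)
  B = 3 * (t * h)
  L = suc B ^ D * suc (D * (h * h))

  -- Instead of restricting to vectors of one popular norm, the norm is recorded as the leading
  -- entry. All h^D vectors are kept, at the price of a factor Dh² + 1 in the range.
  s : Vec ℕ D → ℕ
  s v = enc B D (lookup v) (norm (lookup v))

  h≤B : h ≤ suc B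
  h≤B = ℕ.≤-trans (ℕ.m≤m+n h (suc t₂ * h)) (ℕ.≤-trans (ℕ.m≤m+n (t * h) _) (ℕ.n≤1+n B))

  module _ {v : Vec ℕ D} (v∈ : v ∈ˡ allVec h D) where

    v<B : ∀ i → lookup v i < suc B
    v<B i = ℕ.≤-trans (allVec-< v∈ i) h≤B

    s<L : s v < L
    s<L = enc-< B D (lookup v) v<B (s≤s (sumℕ-≤ _ (λ i → ℕ.*-mono-≤ (ℕ.<⇒≤ (allVec-< v∈ i)) (ℕ.<⇒≤ (allVec-< v∈ i)))))

  s-injective : ∀ {v v′} → v ∈ˡ allVec h D → v′ ∈ˡ allVec h D → s v ≡ s v′ → v ≡ v′
  s-injective {v} {v′} v∈ v′∈ eq = lookup-ext (enc-injective B D (lookup v) (lookup v′) (v<B v∈) (v<B v′∈) eq)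

  s-convex : ∀ {n₁ n₂ n₃} → n₁ ≤ t → n₂ ≤ t → n₃ ≤ t → n₂ ≢ n₃ → n₃ ≢ n₁ → ∀ {v₁ v₂ v₃} → v₁ ∈ˡ allVec h D → v₂ ∈ˡ allVec h D → v₃ ∈ˡ allVec h D →
             Convex.Rel n₁ n₂ n₃ (s v₁) (s v₂) (s v₃) → v₁ ≡ v₂
  s-convex {n₁} {n₂} {n₃} p₁ p₂ p₃ 2≢3 3≢1 {v₁} {v₂} {v₃} m₁ m₂ m₃ rel =
    let (digits , tops) = Convex.enc-Rel n₁ n₂ n₃ {t} {h} p₁ p₂ p₃ D (lookup v₁) (lookup v₂) (lookup v₃) (allVec-< m₁) (allVec-< m₂) (allVec-< m₃) rel in
    lookup-ext (Convex.collapse n₁ n₂ n₃ 2≢3 3≢1 (lookup v₁) (lookup v₂) (lookup v₃) digits tops)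

  -- A shift that dominates `weight` on the box, so that the truncated subtraction in `x₁` is exact;
  -- it is the constant `κ` of `Three`.
  κ : ℕ
  κ = t * (t * L)

  Params : Set
  Params = Vec ℕ D × (Vec ℕ t₂ × Vec ℕ r′)

  params : List Params
  params = cartesianProduct (allVec h D) (cartesianProduct (allVec L t₂) (allVec L r′))

  weight : Vec ℕ t₂ → ℕ
  weight z = sumℕ (λ a → suc (suc (toℕ a)) * lookup z a)

  x₁ : Vec ℕ D → Vec ℕ t₂ → ℕ
  x₁ v z = s v + κ ∸ weight z

  mk : Params → Vec ℕ (t + r′)
  mk (v , z , y) = (x₁ v z + sumℕ (lookup z) ∷ x₁ v z ∷ z) Vec.++ y

  𝒳 : List (Vec ℕ (t + r′))
  𝒳 = map mk params

  params⁻ : ∀ {v z y} → (v , z , y) ∈ˡ params → v ∈ˡ allVec h D × z ∈ˡ allVec L t₂ × y ∈ˡ allVec L r′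
  params⁻ m = let (v∈ , m′) = ∈-cartesianProduct⁻ (allVec h D) (cartesianProduct (allVec L t₂) (allVec L r′)) m in v∈ , ∈-cartesianProduct⁻ (allVec L t₂) (allVec L r′) m′

  weight≤κ : ∀ {z} → z ∈ˡ allVec L t₂ → weight z ≤ κ
  weight≤κ {z} z∈ = ℕ.≤-trans (sumℕ-≤ _ (λ a → ℕ.*-mono-≤ (s≤s (s≤s (ℕ.<⇒≤ (Fin.toℕ<n a)))) (ℕ.<⇒≤ (allVec-< z∈ a)))) (ℕ.*-monoˡ-≤ (t * L) (ℕ.≤-trans (ℕ.n≤1+n t₂) (ℕ.n≤1+n (suc t₂))))

  x₁+weight : ∀ v {z} → z ∈ˡ allVec L t₂ → x₁ v z + weight z ≡ s v + κ
  x₁+weight v z∈ = ℕ.m∸n+n≡m (ℕ.≤-trans (weight≤κ z∈) (ℕ.m≤n+m κ (s v)))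

  mk-injective : ∀ {a b} → a ∈ˡ params → b ∈ˡ params → mk a ≡ mk b → a ≡ b
  mk-injective {v , z , y} {v′ , z′ , y′} a∈ b∈ eq = same (Vec.++-injectiveˡ z z′ tail≡) (Vec.++-injectiveʳ z z′ tail≡)
    where
    tail≡ : z Vec.++ y ≡ z′ Vec.++ y′
    tail≡ = Vec.∷-injectiveʳ (Vec.∷-injectiveʳ eq)
    same : z ≡ z′ → y ≡ y′ → (v , z , y) ≡ (v′ , z′ , y′)
    same refl refl = cong (_, (z , y)) (s-injective (proj₁ (params⁻ a∈)) (proj₁ (params⁻ b∈)) (ℕ.+-cancelʳ-≡ κ (s v) (s v′)
      (trans (sym (x₁+weight v z∈)) (trans (cong (_+ weight z) (Vec.∷-injectiveˡ (Vec.∷-injectiveʳ eq))) (x₁+weight v′ z∈)))))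
      where
      z∈ : z ∈ˡ allVec L t₂
      z∈ = proj₁ (proj₂ (params⁻ a∈))

  unique-map : ∀ ps → Unique ps → (∀ {a} → a ∈ˡ ps → a ∈ˡ params) → Unique (map mk ps)
  unique-map []       _            sub = []
  unique-map (a ∷ ps) (fresh ∷ uq) sub = All.map⁺ (All.tabulate (λ {b} b∈ eq → All.lookup fresh b∈ (mk-injective (sub (here refl)) (sub (there b∈)) eq))) ∷ unique-map ps uq (λ m → sub (there m))

  unique′ : Unique 𝒳
  unique′ = unique-map params (Unique.cartesianProduct⁺ (allVec-unique h D) (Unique.cartesianProduct⁺ (allVec-unique L t₂) (allVec-unique L r′))) (λ m → m)

  size : length 𝒳 ≡ h ^ D * L ^ (t₂ + r′)
  size = trans (List.length-map mk params) (trans (length-product _,_ (allVec h D) _) (cong₂ _*_ (length-allVec h D)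
    (trans (length-product _,_ (allVec L t₂) (allVec L r′)) (trans (cong₂ _*_ (length-allVec L t₂) (length-allVec L r′)) (sym (ℕ.^-distribˡ-+-* L t₂ r′))))))

  W : ℕ
  W = L + κ + t * L

  L≤W : L ≤ W
  L≤W = ℕ.≤-trans (ℕ.m≤m+n L κ) (ℕ.m≤m+n (L + κ) (t * L))

  bounded : ∀ {x} → x ∈ˡ 𝒳 → ∀ p → lookup x p < suc W
  bounded x∈ = let ((v , z , y) , m , eq) = ∈-map⁻ mk x∈ ; (v∈ , z∈ , y∈) = params⁻ m in
    subst (λ x → ∀ p → lookup x p < suc W) (sym eq) (++-bounded (x₁ v z + sumℕ (lookup z) ∷ x₁ v z ∷ z) y (first v∈ z∈) (λ p → ℕ.≤-trans (allVec-< y∈ p) (ℕ.≤-trans L≤W (ℕ.n≤1+n W))))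
    where
    x₁≤ : ∀ {v z} → v ∈ˡ allVec h D → x₁ v z ≤ L + κ
    x₁≤ {v} {z} v∈ = ℕ.≤-trans (ℕ.m∸n≤m (s v + κ) (weight z)) (ℕ.+-monoˡ-≤ κ (ℕ.<⇒≤ (s<L v∈)))
    first : ∀ {v z} → v ∈ˡ allVec h D → z ∈ˡ allVec L t₂ → ∀ p → lookup (x₁ v z + sumℕ (lookup z) ∷ x₁ v z ∷ z) p < suc W
    first {v} {z} v∈ z∈ zero = s≤s (ℕ.+-mono-≤ (x₁≤ {v} {z} v∈) (ℕ.≤-trans (sumℕ-≤ (lookup z) (λ a → ℕ.<⇒≤ (allVec-< z∈ a))) (ℕ.*-monoˡ-≤ L (ℕ.≤-trans (ℕ.n≤1+n t₂) (ℕ.n≤1+n (suc t₂))))))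
    first {v} {z} v∈ z∈ (suc zero) = s≤s (ℕ.≤-trans (x₁≤ {v} {z} v∈) (ℕ.m≤m+n (L + κ) (t * L)))
    first v∈ z∈ (suc (suc p)) = ℕ.≤-trans (allVec-< z∈ p) (ℕ.≤-trans L≤W (ℕ.n≤1+n W))

  module _ (2≤r′ : 2 ≤ r′) where
    open LinearConfig (suc t₂) r′ 2≤r′ 𝒳 hiding (t)

    lin-mk : ∀ v z y → Λ (part (mk (v , z , y))) ≡ 0ℤ
    lin-mk v z y = trans (cong₂ (λ u w → ℤ.- 1ℤ ℤ.* u ℤ.+ (1ℤ ℤ.* pos (x₁ v z) ℤ.+ w)) (trans (ℤ.pos-+ (x₁ v z) (sumℕ (lookup z))) (cong (λ w → pos (x₁ v z) ℤ.+ w) (pos-sumℕ (lookup z))))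
        (sumℤ-cong (λ a → trans (ℤ.*-identityˡ _) (cong pos (Vec.lookup-++ˡ z y a))))) (lem (pos (x₁ v z)) (sumℤ (λ a → pos (lookup z a))))
      where
      lem : ∀ u w → ℤ.- 1ℤ ℤ.* (u ℤ.+ w) ℤ.+ (1ℤ ℤ.* u ℤ.+ w) ≡ 0ℤ
      lem = solve-∀ ℤring

    Ω-mk : ∀ v {z} → z ∈ˡ allVec L t₂ → ∀ y → Ω (part (mk (v , z , y))) ≡ pos (s v) ℤ.+ pos κ
    Ω-mk v {z} z∈ y = trans (cong (λ w → 0ℤ ℤ.* (ℤ.- 1ℤ ℤ.* pos (x₁ v z + sumℕ (lookup z))) ℤ.+ (1ℤ ℤ.* (1ℤ ℤ.* pos (x₁ v z)) ℤ.+ w)) tail)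
        (trans (lem (pos (x₁ v z + sumℕ (lookup z))) (pos (x₁ v z)) (pos (weight z))) (trans (sym (ℤ.pos-+ (x₁ v z) (weight z))) (trans (cong pos (x₁+weight v z∈)) (ℤ.pos-+ (s v) κ))))
      where
      lem : ∀ a u w → 0ℤ ℤ.* (ℤ.- 1ℤ ℤ.* a) ℤ.+ (1ℤ ℤ.* (1ℤ ℤ.* u) ℤ.+ w) ≡ u ℤ.+ w
      lem = solve-∀ ℤring
      tail : sumℤ (λ a → pos (suc (suc (toℕ a))) ℤ.* (1ℤ ℤ.* pos (lookup (z Vec.++ y) (a ↑ˡ r′)))) ≡ pos (weight z)
      tail = trans (sumℤ-cong (λ a → trans (cong (λ w → pos (suc (suc (toℕ a))) ℤ.* w) (trans (ℤ.*-identityˡ _) (cong pos (Vec.lookup-++ˡ z y a)))) (sym (ℤ.pos-* (suc (suc (toℕ a))) (lookup z a)))))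
        (sym (pos-sumℕ (λ a → suc (suc (toℕ a)) * lookup z a)))

    source : ∀ {x} → x ∈ˡ 𝒳 → Σ (Vec ℕ D) λ v → v ∈ˡ allVec h D × Λ (part x) ≡ 0ℤ × Ω (part x) ≡ pos (s v) ℤ.+ pos κ
    source x∈ = let ((v , z , y) , m , eq) = ∈-map⁻ mk x∈ ; (v∈ , z∈ , _) = params⁻ m in
      v , v∈ , subst (λ x → Λ (part x) ≡ 0ℤ) (sym eq) (lin-mk v z y) , subst (λ x → Ω (part x) ≡ pos (s v) ℤ.+ pos κ) (sym eq) (Ω-mk v z∈ y)

    lin : ∀ {x} → x ∈ˡ 𝒳 → Λ (part x) ≡ 0ℤ
    lin x∈ = proj₁ (proj₂ (proj₂ (source x∈)))

    no-config : ¬ QConfig (suc r′) 𝒳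
    no-config cfg = separated (cong (λ v → pos (s v)) (s-convex (le i₁) (le i₂) (le i₃)
        (λ e → proj₁ (proj₂ at-distinct) (Fin.toℕ-injective e)) (λ e → proj₂ (proj₂ at-distinct) (Fin.toℕ-injective (sym e)))
        (v∈ i₁) (v∈ i₂) (v∈ i₃) rel))
      where
      open QConfig cfg using (tup∈)
      open Three lin cfg (pos κ) (λ m → pos (s (proj₁ (source m)))) (λ m → proj₂ (proj₂ (proj₂ (source m)))) hiding (s)
      v : Fin (suc r′) → Vec ℕ D
      v i = proj₁ (source (tup∈ i))
      v∈ : ∀ i → v i ∈ˡ allVec h D
      v∈ i = proj₁ (proj₂ (source (tup∈ i)))
      le : ∀ i → toℕ (at i) ≤ t
      le i = ℕ.<⇒≤ (Fin.toℕ<n (at i))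
      n₁ = toℕ (at i₁)
      n₂ = toℕ (at i₂)
      n₃ = toℕ (at i₃)
      rel : Convex.Rel n₁ n₂ n₃ (s (v i₁)) (s (v i₂)) (s (v i₃))
      rel = ℤ.+-injective (trans (Convex.pos-lin n₁ n₂ n₃ n₂ n₃ n₁ (s (v i₁)) (s (v i₂)) (s (v i₃))) (trans relation (sym (Convex.pos-lin n₁ n₂ n₃ n₃ n₁ n₂ (s (v i₁)) (s (v i₂)) (s (v i₃))))))

-- The extremal number exists

subset-length : ∀ {A : Set} (xs ys : List A) → Unique xs → (∀ {x} → x ∈ˡ xs → x ∈ˡ ys) → length xs ≤ length ys
subset-length []       ys _            sub = z≤n
subset-length (x ∷ xs) ys (fresh ∷ uq) sub = bound (split (sub (here refl)))
  where
  split : ∀ {ys} → x ∈ˡ ys → Σ (List _) λ as → Σ (List _) λ bs → ys ≡ as ++ x ∷ bs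
  split {y ∷ ys} (here refl) = [] , ys , refl
  split {y ∷ ys} (there p) = let (as , bs , eq) = split p in y ∷ as , bs , cong (y ∷_) eq
  bound : (Σ (List _) λ as → Σ (List _) λ bs → ys ≡ as ++ x ∷ bs) → suc (length xs) ≤ length ys
  bound (as , bs , refl) = ℕ.≤-trans (s≤s (subset-length xs (as ++ bs) uq avoid)) (ℕ.≤-reflexive (sym (trans (List.length-++ as) (trans (ℕ.+-suc (length as) (length bs)) (cong suc (sym (List.length-++ as)))))))
    where
    avoid : ∀ {y} → y ∈ˡ xs → y ∈ˡ as ++ bs
    avoid {y} y∈ = [ ∈-++⁺ˡ , (λ { (here refl) → contradiction refl (All.lookup fresh y∈) ; (there p) → ∈-++⁺ʳ as p }) ]′ (∈-++⁻ as (sub (there y∈)))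

-- The maximum exists by bounded search, which is only available under double negation.
extremal : ∀ {k r n} (H : KGraph k n) → ¬ ContainsQ k r H → (∀ M → IsExQ k r n M → e[ H ] ≤ M → ⊥) → ⊥
extremal {k} {r} {n} H free cont = climb (length (subsets n)) H free (ℕ.m≤n+m (length (subsets n)) e[ H ]) ℕ.≤-refl
  where
  climb : ∀ fuel (G : KGraph k n) → ¬ ContainsQ k r G → length (subsets n) ≤ e[ G ] + fuel → e[ H ] ≤ e[ G ] → ⊥
  climb fuel G G-free enough H≤G = cont e[ G ] ((G , G-free , refl) , maximal fuel enough) H≤G
    where
    maximal : ∀ fuel → length (subsets n) ≤ e[ G ] + fuel → (G′ : KGraph k n) → ¬ ContainsQ k r G′ → e[ G′ ] ≤ e[ G ]
    maximal zero enough G′ free′ = ℕ.≤-trans (subset-length (edges G′) (subsets n) (unique G′) (λ {e} _ → ∈-subsets e)) (subst (length (subsets n) ≤_) (ℕ.+-identityʳ e[ G ]) enough)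
    maximal (suc fuel) enough G′ free′ with e[ G′ ] ℕ.≤? e[ G ]
    ... | yes le = le
    ... | no gt = ⊥-elim (climb fuel G′ free′ (ℕ.≤-trans enough (ℕ.≤-trans (ℕ.≤-reflexive (ℕ.+-suc e[ G ] fuel)) (ℕ.+-monoˡ-≤ fuel (ℕ.≰⇒> gt)))) (ℕ.≤-trans H≤G (ℕ.<⇒≤ (ℕ.≰⇒> gt))))

-- Assembling the bounds

^-distribʳ-* : ∀ m a b → (a * b) ^ m ≡ a ^ m * b ^ m
^-distribʳ-* zero    a b = refl
^-distribʳ-* (suc m) a b = trans (cong (a * b *_) (^-distribʳ-* m a b)) (lem a b (a ^ m) (b ^ m))
  where
  lem : ∀ a b c d → a * b * (c * d) ≡ a * c * (b * d)
  lem = solve-∀ ℕring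

Θ-bounds : ℕ → ℕ → Set
Θ-bounds k r = Σ ℕ λ c → Σ ℕ λ C → Σ ℕ λ N → (n M : ℕ) → N ≤ n → IsExQ k r n M →
  (n ^ (k ∸ 1) ≤ c * M) × (M ≤ C * n ^ (k ∸ 1))

module Part₁ (t₁ r′ : ℕ) (2≤r′ : 2 ≤ r′) (t<r : suc t₁ < suc r′) where

  -- The `k` parts have size at most (t₁+2)·L once L ≥ 1, so L = n / c₀ makes the family fit.
  k r c₀ : ℕ
  k = suc t₁ + r′
  r = suc r′
  c₀ = k * suc (suc t₁)

  module _ (n : ℕ) (c₀≤n : c₀ ≤ n) where

    L : ℕ
    L = n / c₀

    1≤L : 1 ≤ L
    1≤L = m≥n⇒m/n>0 c₀≤n

    open Family₁ t₁ r′ L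

    fits : k * suc W ≤ n
    fits = ℕ.≤-trans (ℕ.*-monoʳ-≤ k (ℕ.+-monoˡ-≤ W 1≤L)) (ℕ.≤-trans (ℕ.≤-reflexive (trans (sym (ℕ.*-assoc k (suc (suc t₁)) L)) (ℕ.*-comm c₀ L))) (m/n*n≤m n c₀))

    open Partite k W n fits 𝒳 unique′ bounded

    free : ¬ ContainsQ k r graph
    free = graph-free r (s≤s 2≤r′) (no-config 2≤r′ t<r)

    n≤ : n ≤ 2 * c₀ * L
    n≤ = ℕ.≤-trans (ℕ.≤-reflexive (m≡m%n+[m/n]*n n c₀)) (ℕ.≤-trans (ℕ.+-mono-≤ (ℕ.≤-trans (ℕ.<⇒≤ (m%n<n n c₀)) (ℕ.≤-trans (ℕ.≤-reflexive (sym (ℕ.*-identityʳ c₀))) (ℕ.*-monoʳ-≤ c₀ 1≤L))) (ℕ.≤-reflexive (ℕ.*-comm L c₀)))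
      (ℕ.≤-reflexive (double c₀ L)))
      where
      double : ∀ c l → c * l + c * l ≡ 2 * c * l
      double = solve-∀ ℕring

    lower : ∀ M → IsExQ k r n M → n ^ (t₁ + r′) ≤ (2 * c₀) ^ (t₁ + r′) * M
    lower M (_ , max) = ℕ.≤-trans (ℕ.^-monoˡ-≤ (t₁ + r′) n≤) (ℕ.≤-trans (ℕ.≤-reflexive (^-distribʳ-* (t₁ + r′) (2 * c₀) L))
      (ℕ.*-monoʳ-≤ ((2 * c₀) ^ (t₁ + r′)) (ℕ.≤-trans (ℕ.≤-reflexive (sym (trans graph-size size))) (max graph free))))

  upper : ∀ n M → IsExQ k r (suc n) M → M ≤ (k + r) * suc n ^ (t₁ + r′)
  upper n M ((H , H-free , eq) , _) = subst (_≤ (k + r) * suc n ^ (t₁ + r′)) eq (edges≤n^[k-1] (t₁ + r′) r (s≤s (ℕ.m≤n+m r′ t₁)) n H H-free)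

  part₁ : Θ-bounds k r
  part₁ = (2 * c₀) ^ (t₁ + r′) , k + r , c₀ , both
    where
    both : ∀ n M → c₀ ≤ n → IsExQ k r n M → (n ^ (k ∸ 1) ≤ (2 * c₀) ^ (t₁ + r′) * M) × (M ≤ (k + r) * n ^ (k ∸ 1))
    both (suc n) M c₀≤n ex = lower (suc n) c₀≤n M ex , upper n M ex

module Part₂ (t₂ r′ : ℕ) (2≤r′ : 2 ≤ r′) (r′≤t₁ : r′ ≤ suc t₂) where

  t k r : ℕ
  t = suc (suc t₂)
  k = t + r′
  r = suc r′

  little-o : (d : ℕ) → Σ ℕ λ N → (n M : ℕ) → N ≤ n → IsExQ k r n M → suc d * M ≤ n ^ (k ∸ 1)
  little-o d = suc threshold , bound
    where
    open Sparse (suc t₂ + r′) r′ (s≤s 2≤r′) (s≤s (ℕ.m≤n+m r′ (suc t₂))) (s≤s (ℕ.≤-trans (ℕ.≤-reflexive (ℕ.+-suc r′ r′)) (s≤s (ℕ.+-monoˡ-≤ r′ r′≤t₁)))) d using (threshold; few-edges)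
    bound : (n M : ℕ) → suc threshold ≤ n → IsExQ k r n M → suc d * M ≤ n ^ (k ∸ 1)
    bound (suc n) M (s≤s n₀≤n) ((H , H-free , eq) , _) = subst (λ M → suc d * M ≤ suc n ^ (k ∸ 1)) eq (few-edges n n₀≤n H H-free)

  module NotPolynomial (p q C N : ℕ) (1≤p : 1 ≤ p)
                       (hyp : (n M : ℕ) → N ≤ n → IsExQ k r n M → M ^ q * n ^ p ≤ C * n ^ ((k ∸ 1) * q)) where

    -- The family has h^D · L^e edges on n ≤ c₁L vertices, where L ≤ c₂·h^(D+2). Together with L ≤ n
    -- ≤ n^p and h^D ≤ L the assumed bound reduces to h^D ≤ C″·h^(2q). With D = 2q + 1 this says h ≤
    -- C″, which the choice of `h` violates; the summand `N` makes n large enough.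
    D e c₁ c₂ C″ h : ℕ
    D  = suc (2 * q)
    e  = t₂ + r′
    c₁ = k * (2 + t * t + t)
    c₂ = (3 * t + 1) ^ D * suc D
    C″ = C * c₁ ^ (suc e * q) * c₂ ^ q
    h  = suc (C″ + N)

    open Family₂ t₂ r′ D h hiding (t)

    n : ℕ
    n = k * suc W

    open Partite k W n ℕ.≤-refl 𝒳 unique′ bounded

    free : ¬ ContainsQ k r graph
    free = graph-free r (s≤s 2≤r′) (no-config 2≤r′)

    1≤L : 1 ≤ L
    1≤L = ℕ.*-mono-≤ (ℕ.m^n>0 (suc B) D) (s≤s z≤n)

    h^D≤L : h ^ D ≤ L
    h^D≤L = ℕ.≤-trans (ℕ.^-monoˡ-≤ D h≤B) (ℕ.≤-trans (ℕ.≤-reflexive (sym (ℕ.*-identityʳ (suc B ^ D)))) (ℕ.*-monoʳ-≤ (suc B ^ D) (s≤s z≤n)))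

    L≤n : L ≤ n
    L≤n = ℕ.≤-trans L≤W (ℕ.≤-trans (ℕ.n≤1+n W) (ℕ.m≤m+n (suc W) _))

    N≤n : N ≤ n
    N≤n = ℕ.≤-trans (ℕ.≤-trans (ℕ.m≤n+m N C″) (ℕ.n≤1+n (C″ + N))) (ℕ.≤-trans (ℕ.≤-trans (ℕ.≤-reflexive (sym (ℕ.*-identityʳ h))) (ℕ.*-monoʳ-≤ h (ℕ.m^n>0 h (2 * q)))) (ℕ.≤-trans h^D≤L L≤n))

    n≤c₁L : n ≤ c₁ * L
    n≤c₁L = ℕ.≤-trans (ℕ.*-monoʳ-≤ k (ℕ.+-monoˡ-≤ W 1≤L)) (ℕ.≤-reflexive (lem k t L))
      where
      lem : ∀ k t l → k * (l + (l + t * (t * l) + t * l)) ≡ k * (2 + t * t + t) * l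
      lem = solve-∀ ℕring

    L≤c₂ : L ≤ c₂ * (h ^ D * h ^ 2)
    L≤c₂ = ℕ.≤-trans (ℕ.*-mono-≤ (ℕ.≤-trans (ℕ.^-monoˡ-≤ D base) (ℕ.≤-reflexive (^-distribʳ-* D (3 * t + 1) h))) top)
        (ℕ.≤-reflexive (lem ((3 * t + 1) ^ D) (h ^ D) (suc D) (h ^ 2)))
      where
      lem : ∀ a b c d → a * b * (c * d) ≡ a * c * (b * d)
      lem = solve-∀ ℕring
      1≤h : 1 ≤ h
      1≤h = s≤s z≤n
      base : suc B ≤ (3 * t + 1) * h
      base = ℕ.≤-trans (ℕ.+-monoˡ-≤ B 1≤h) (ℕ.≤-reflexive (lem₁ t h))
        where
        lem₁ : ∀ t h → h + 3 * (t * h) ≡ (3 * t + 1) * h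
        lem₁ = solve-∀ ℕring
      top : suc (D * (h * h)) ≤ suc D * h ^ 2
      top = ℕ.≤-trans (ℕ.+-monoˡ-≤ (D * (h * h)) (ℕ.*-mono-≤ 1≤h 1≤h)) (ℕ.≤-reflexive (cong (λ z → h * z + D * (h * z)) (sym (ℕ.*-identityʳ h))))

    absurd : ⊥
    absurd = extremal {r = r} graph free (λ M ex size≤M → ℕ.<-irrefl refl (ℕ.≤-trans (s≤s (ℕ.m≤m+n C″ N)) (small M (hyp n M N≤n ex) (ℕ.≤-trans (ℕ.≤-reflexive (sym (trans graph-size size))) size≤M))))
      where
      A P Q : ℕ
      A = (h ^ D) ^ q
      P = (L ^ e) ^ q
      Q = c₁ ^ (suc e * q)
      instance
        L≢0 : ℕ.NonZero L
        L≢0 = ℕ.>-nonZero 1≤L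
        P≢0 : ℕ.NonZero P
        P≢0 = ℕ.m^n≢0 (L ^ e) q {{ℕ.m^n≢0 L e}}
        A≢0 : ℕ.NonZero A
        A≢0 = ℕ.m^n≢0 (h ^ D) q {{ℕ.m^n≢0 h D}}
      left : ∀ M → h ^ D * L ^ e ≤ M → P * (A * L) ≤ M ^ q * n ^ p
      left M size≤M = ℕ.≤-trans (ℕ.≤-reflexive (trans (lem P A L) (cong (_* L) (sym (^-distribʳ-* q (h ^ D) (L ^ e))))))
          (ℕ.*-mono-≤ (ℕ.^-monoˡ-≤ q size≤M) (ℕ.≤-trans L≤n (ℕ.≤-trans (ℕ.≤-reflexive (sym (ℕ.*-identityʳ n))) (ℕ.^-monoʳ-≤ n {{ℕ.>-nonZero (ℕ.≤-trans 1≤L L≤n)}} 1≤p))))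
        where
        lem : ∀ p a l → p * (a * l) ≡ a * p * l
        lem = solve-∀ ℕring
      right : C * n ^ (suc e * q) ≤ P * (C * Q * L ^ q)
      right = ℕ.≤-trans (ℕ.*-monoʳ-≤ C (ℕ.≤-trans (ℕ.^-monoˡ-≤ (suc e * q) n≤c₁L) (ℕ.≤-reflexive (trans (^-distribʳ-* (suc e * q) c₁ L)
          (cong (Q *_) (trans (ℕ.^-distribˡ-+-* L q (e * q)) (cong (L ^ q *_) (sym (ℕ.^-*-assoc L e q)))))))))
          (ℕ.≤-reflexive (lem C Q (L ^ q) P))
        where
        lem : ∀ c q l p → c * (q * (l * p)) ≡ p * (c * q * l)
        lem = solve-∀ ℕring
      small : ∀ M → M ^ q * n ^ p ≤ C * n ^ (suc e * q) → h ^ D * L ^ e ≤ M → h ≤ C″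
      small M hyp′ size≤M = ℕ.*-cancelˡ-≤ (h ^ (2 * q)) {{ℕ.m^n≢0 h (2 * q)}} (ℕ.≤-trans (ℕ.≤-reflexive (ℕ.*-comm (h ^ (2 * q)) h)) (ℕ.≤-trans step₂ (ℕ.≤-reflexive (trans (cong (C″ *_) (ℕ.^-*-assoc h 2 q)) (ℕ.*-comm C″ (h ^ (2 * q)))))))
        where
        step₁ : A * L ≤ C * Q * L ^ q
        step₁ = ℕ.*-cancelˡ-≤ P (ℕ.≤-trans (left M size≤M) (ℕ.≤-trans hyp′ right))
        step₂ : h ^ D ≤ C″ * (h ^ 2) ^ q
        step₂ = ℕ.*-cancelˡ-≤ A (ℕ.≤-trans (ℕ.*-monoʳ-≤ A h^D≤L) (ℕ.≤-trans step₁ (ℕ.≤-trans (ℕ.*-monoʳ-≤ (C * Q) (ℕ.≤-trans (ℕ.^-monoˡ-≤ q L≤c₂)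
            (ℕ.≤-reflexive (trans (^-distribʳ-* q c₂ (h ^ D * h ^ 2)) (cong (c₂ ^ q *_) (^-distribʳ-* q (h ^ D) (h ^ 2)))))))
            (ℕ.≤-reflexive (lem C Q (c₂ ^ q) A ((h ^ 2) ^ q))))))
          where
          lem : ∀ c q d a g → c * q * (d * (a * g)) ≡ a * (c * q * d * g)
          lem = solve-∀ ℕring

  not-polynomial : (p q : ℕ) → 1 ≤ p → 1 ≤ q →
    ¬ (Σ ℕ λ C → Σ ℕ λ N → (n M : ℕ) → N ≤ n → IsExQ k r n M → M ^ q * n ^ p ≤ C * n ^ ((k ∸ 1) * q))
  not-polynomial p q 1≤p _ (C , N , hyp) = NotPolynomial.absurd p q C N 1≤p hyp

Sparse-bounds : ℕ → ℕ → Set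
Sparse-bounds k r =
      ((d : ℕ) → Σ ℕ λ N → (n M : ℕ) → N ≤ n → IsExQ k r n M → suc d * M ≤ n ^ (k ∸ 1))
      × ((p q : ℕ) → 1 ≤ p → 1 ≤ q →
          ¬ (Σ ℕ λ C → Σ ℕ λ N → (n M : ℕ) → N ≤ n → IsExQ k r n M → M ^ q * n ^ p ≤ C * n ^ ((k ∸ 1) * q)))

Bounds : ℕ → ℕ → Set
Bounds k r = (k + 2 ≤ 2 * r → Θ-bounds k r) × (2 * r ≤ k + 1 → Sparse-bounds k r)

-- Here k = t + r′ with t = t₁ + 1 = k + 1 - r, so the two hypotheses on `k` and `r` read t < r and
-- r ≤ t. The second excludes t₁ = 0, which leaves room for two dependent coordinates.
bounds : ∀ t₁ r′ → 2 ≤ r′ → Bounds (suc t₁ + r′) (suc r′)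
bounds t₁ r′ 2≤r′ = (λ h → Part₁.part₁ t₁ r′ 2≤r′ (s≤s (ℕ.+-cancelʳ-≤ (r′ + 2) (suc t₁) r′ (ℕ.≤-trans (ℕ.≤-reflexive (sym (ℕ.+-assoc (suc t₁) r′ 2))) (ℕ.≤-trans h (ℕ.≤-reflexive (lem₁ r′))))))) , second t₁
  where
  lem₁ : ∀ r → 2 * suc r ≡ r + (r + 2)
  lem₁ = solve-∀ ℕring
  lem₂ : ∀ t r → suc t + r + 1 ≡ t + (r + 2)
  lem₂ = solve-∀ ℕring
  r′≤ : ∀ t₁ → 2 * suc r′ ≤ suc t₁ + r′ + 1 → r′ ≤ t₁
  r′≤ t₁ h = ℕ.+-cancelʳ-≤ (r′ + 2) r′ t₁ (ℕ.≤-trans (ℕ.≤-reflexive (sym (lem₁ r′))) (ℕ.≤-trans h (ℕ.≤-reflexive (lem₂ t₁ r′))))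
  second : ∀ t₁ → 2 * suc r′ ≤ suc t₁ + r′ + 1 → Sparse-bounds (suc t₁ + r′) (suc r′)
  second zero     h = ⊥-elim (ℕ.<⇒≱ (ℕ.≤-trans (s≤s z≤n) 2≤r′) (r′≤ zero h))
  second (suc t₂) h = Part₂.little-o t₂ r′ 2≤r′ (r′≤ (suc t₂) h) , Part₂.not-polynomial t₂ r′ 2≤r′ (r′≤ (suc t₂) h)

theorem2 : (k r : ℕ) → 3 ≤ r → r ≤ k →
    (k + 2 ≤ 2 * r →
    Σ ℕ λ c → Σ ℕ λ C → Σ ℕ λ N → (n M : ℕ) → N ≤ n → IsExQ k r n M →
    (n ^ (k ∸ 1) ≤ c * M) × (M ≤ C * n ^ (k ∸ 1)))
    ×
    (2 * r ≤ k + 1 →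
    ((d : ℕ) → Σ ℕ λ N → (n M : ℕ) → N ≤ n → IsExQ k r n M →
    suc d * M ≤ n ^ (k ∸ 1))
    ×
    ((p q : ℕ) → 1 ≤ p → 1 ≤ q →
    ¬ (Σ ℕ λ C → Σ ℕ λ N → (n M : ℕ) → N ≤ n → IsExQ k r n M →
    M ^ q * n ^ p ≤ C * n ^ ((k ∸ 1) * q))))
theorem2 k (suc r′) (s≤s 2≤r′) r≤k = subst (λ k → Bounds k (suc r′)) (trans (sym (ℕ.+-suc (k ∸ suc r′) r′)) (ℕ.m∸n+n≡m r≤k)) (bounds (k ∸ suc r′) r′ 2≤r′)
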